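{- Let $q$ be an odd prime power, $\mathbb F_q$ the finite field of order $q$, $d$ a positive integer, and $A\subset \mathbb F_q^d$. Let $\mathcal{SQ}(A)$ be the number of pairs $(x,y)\in A\times A$ such that $\eta(\|x-y\|)=1$. \begin{enumerate} \item Let $d\equiv 3 \pmod 4$ and $q\equiv 3\pmod 4$. If $|A|\ge (q^{(d+1)/2}+q)/(1+q^{ -(d-1)/2})$, then $$\mathcal{SQ}(A)\le \frac{|A|^2}{2} + q^{\frac{d-1}{2}} |A| -\frac{|A|^2}{2q}- \frac{|A|^2}{2 q^{\frac{d-1}{2}}} - \frac{|A|^2}{2 q^{\frac{d+1}{2}}}.$$ If $|A|\le (q^{(d+1)/2}+q)/(1+q^{ -(d-1)/2})$, then $$\mathcal{SQ}(A) \le \frac{|A|^2}{2} + \frac{q^{\frac{d-1}{2}} |A|}{2} - \frac{|A|^2}{2 q^{\frac{d-1}{2}}} -\frac{|A|}{2}.$$ \item Let $d\equiv 1 \pmod 4$, or $d\equiv 3\pmod 4$ and $q\equiv 1\pmod 4$. Then $$\mathcal{SQ}(A) \le \frac{|A|^2}{2} - \frac{q^{\frac{d-1}{2}} |A|}{2} -\frac{|A|}{2}+ \min\left\{ \frac{q^{\frac{d+1}{2}} |A|}{2},~ \frac{q^{\frac{d-1}{2}} |A|}{2}+ \frac{|A|^2}{2},~\frac{|A|}{2}+ \frac{q^{\frac{d+1}{2}} |A|}{2}-\frac{|A|^2}{2q} \right\}.$$ \end{enumerate}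
   Context: For $x,y\in\mathbb F_q^d$, $\|x-y\|:=(x_1-y_1)^2+\cdots+(x_d-y_d)^2\in\mathbb F_q$. $\eta$ denotes the quadratic character of $\mathbb F_q$ (so $\eta(a)=1$ if $a$ is a nonzero square, $\eta(a)=-1$ if $a$ is a non-square) with the convention $\eta(0)=0$. -}

module Defs where

open import Algebra.Bundles using (CommutativeRing)
open import Data.Bool.Base using (if_then_else_)
open import Data.Fin.Base using (Fin)
import Data.Fin.Properties as Fin
open import Data.Integer.Base using (ℤ; +_; 0ℤ; 1ℤ; -1ℤ)
import Data.Integer.Properties as ℤ
open import Data.List.Base using (List; length; filter; cartesianProduct)
import Data.List.Relation.Unary.Unique.Setoid as UniqueSetoid
open import Data.Nat.Base as ℕ using (ℕ; NonZero; _^_; _∸_; ⌊_/2⌋)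
open import Data.Nat.DivMod using (_%_)
import Data.Nat.Properties as ℕ
open import Data.Nat.Primality using (Prime)
open import Data.Product.Base using (∃; ∃₂; _×_; _,_)
open import Data.Rational.Base as ℚ using (ℚ; 1ℚ; _/_; _÷_)
import Data.Rational.Properties as ℚ
open import Data.Vec.Functional using (Vector)
import Data.Vec.Functional.Relation.Binary.Equality.Setoid as VectorEquality
open import Function.Bundles using (Inverse)
open import Function.Properties.Inverse using (Inverse⇒Injection)
open import Level using (Level; _⊔_)
open import Relation.Binary.Bundles using (Setoid)
open import Relation.Binary.Definitions using (Decidable)
open import Relation.Binary.PropositionalEquality.Core using (_≡_)
open import Relation.Binary.PropositionalEquality.Properties using (setoid)
open import Relation.Nullary.Decidable using (Dec; does; map′; via-injection)
open import Relation.Nullary.Negation using (¬_)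

OddPrimePower : ℕ → Set
OddPrimePower q =
  (∃₂ λ p k → Prime p × 1 ℕ.≤ k × q ≡ p ^ k) × q % 2 ≡ 1

-- The equality of the underlying setoid plays the role of equality of field
-- elements; `enumeration` says that there are exactly q of them.
record FiniteField (c ℓ : Level) (q : ℕ) : Set (Level.suc (c ⊔ ℓ)) where
  field
    commutativeRing : CommutativeRing c ℓ

  open CommutativeRing commutativeRing public
    using (Carrier; _≈_; _*_; 0#; 1#)
    renaming (setoid to ≈-setoid)

  field
    1≉0         : ¬ (1# ≈ 0#)
    inverse     : ∀ x → ¬ (x ≈ 0#) → ∃ λ y → x * y ≈ 1#
    enumeration : Inverse ≈-setoid (setoid (Fin q))

module _ {c ℓ q} (F : FiniteField c ℓ q) where

  open FiniteField F using (enumeration) renaming (commutativeRing to R)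
  open CommutativeRing R
    using (Carrier; _≈_; 0#; +-commutativeMonoid)
    renaming (_*_ to _·_; _-_ to _−_; setoid to ≈-setoid)
  private module R = CommutativeRing R
  open Inverse enumeration using (to; from; strictlyInverseʳ)
  open import Algebra.Properties.CommutativeMonoid.Sum +-commutativeMonoid
    using (sum)

  _≟_ : Decidable _≈_
  _≟_ = via-injection (Inverse⇒Injection enumeration) Fin._≟_

  IsSquare : Carrier → Set (c ⊔ ℓ)
  IsSquare x = ∃ λ y → y · y ≈ x

  isSquare? : ∀ x → Dec (IsSquare x)
  isSquare? x = map′
    (λ (i , p) → from i , p)
    (λ (y , p) → to y , R.trans
      (R.*-cong (strictlyInverseʳ y) (strictlyInverseʳ y)) p)
    (Fin.any? λ i → (from i · from i) ≟ x)

  η : Carrier → ℤ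
  η x = if does (x ≟ 0#) then 0ℤ
        else if does (isSquare? x) then 1ℤ
        else -1ℤ

  Point : ℕ → Set c
  Point d = Vector Carrier d

  pointSetoid : ℕ → Setoid c ℓ
  pointSetoid = VectorEquality.≋-setoid ≈-setoid

  ‖_−_‖ : ∀ {d} → Point d → Point d → Carrier
  ‖ x − y ‖ = sum λ i → (x i − y i) · (x i − y i)

  -- A subset of F^d is given by a list of its points without repetitions, so
  -- that its cardinality is the length of the list.
  IsSubset : ∀ {d} → List (Point d) → Set (c ⊔ ℓ)
  IsSubset {d} = UniqueSetoid.Unique (pointSetoid d)

  SQ : ∀ {d} → List (Point d) → ℕ
  SQ A = length
    (filter (λ (x , y) → η ‖ x − y ‖ ℤ.≟ 1ℤ) (cartesianProduct A A))

1+p-nonZero : ∀ p → .{{ℚ.Positive p}} → ℚ.NonZero (1ℚ ℚ.+ p)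
1+p-nonZero p = ℚ.pos⇒nonZero (1ℚ ℚ.+ p) {{ℚ.pos+pos⇒pos 1ℚ p}}

-- (q^((d+1)/2) + q) / (1 + q^(-(d-1)/2)). Only used for odd d, where halving
-- d ∸ 1 and d + 1 is exact.
threshold : (q d : ℕ) .{{_ : NonZero q}} → ℚ
threshold q d =
  let m  = ⌊ d ∸ 1 /2⌋
      m⁺ = ⌊ d ℕ.+ 1 /2⌋
      instance
        _ = ℕ.m^n≢0 q m
        _ = ℚ.normalize-pos 1 (q ^ m)
        _ = 1+p-nonZero (+ 1 / (q ^ m))
  in (+ (q ^ m⁺ ℕ.+ q) / 1) ÷ (1ℚ ℚ.+ + 1 / (q ^ m))

{-
Write q for the order of the field, d = 2m + 1, ε = η(-1)ᵐ, and let S and Z be the sums of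
η‖x−y‖ and of the indicator of ‖x−y‖ = 0 over A × A, so that 2 SQ(A) = |A|² − Z + S and Z ≥ |A|.

The kernels η‖x−y‖ and [‖x−y‖ = 0] are diagonalised by Fourier transform, with eigenvalue at the
frequency ξ equal to ε qᵐ (q [‖ξ‖ = 0] − 1) and q²ᵐ [ξ = 0] + ε qᵐ η‖ξ‖ respectively. Both are
constant on punctured lines {s ξ : s ≠ 0}, and the sum of the characters over such a line is
q [ξ·z = 0] − 1; so the diagonalisation is a family of identities between integers, and no
characters are needed. They amount to counting ‖ξ‖ on the hyperplane ξ·z = 0. Shifting ξ by t z
shows that summing g(‖ξ‖ − ‖z‖ t²) over all t and ξ is the same as summing g(‖ξ‖ + 2 t ξ·z), which
separates the hyperplane from its complement; and the diagonal form ‖ξ‖ − ‖z‖ t² is counted two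
squares at a time, from ∑ η(c) η(c − b) = q [b = 0] − 1.

The weights w(ξ) = q |{(x , y) ∈ A² : ξ·x = ξ·y}| − |A|² are nonnegative by Cauchy–Schwarz, and
w(0) = (q − 1)|A|². Every bound is then a pointwise inequality between eigenvalues, summed against w.
-}
module Submission where

open import Defs
import Data.Nat.Base as ℕ
import Data.Nat.Properties as ℕ
import Level
open import Data.List.Base using (List)
open import Data.Nat.Base using (ℕ; zero; suc; NonZero)
open import Data.Nat.DivMod using (_%_)
open import Relation.Binary.PropositionalEquality.Core using (_≡_)

-- Pairing the squares of an odd number of coordinates leaves one over, and a single square hits b
-- exactly 1 + η(b) times. Hence the transform exchanges η‖ξ‖ with the centred indicator q [‖ξ‖ = 0]
-- - 1, up to a factor.
--
-- The two parts of the theorem differ through ε: it is -1 in the first and 1 in the second. The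
-- eigenvalue ε qᵐ (q - 1) of the kernel η‖x-y‖ sits on the isotropic frequencies, among them ξ = 0.
-- For ε = 1 it is the positive one, and S ≤ qᵐ (q - 1)|A| because the anisotropic weight is
-- nonnegative. For ε = -1 it is negative, the positive eigenvalue is only qᵐ, and the large weight
-- at 0 saves |A|²/qᵐ: S ≤ qᵐ|A| - |A|²/qᵐ.
--
-- There remain two ways to bound Z from below: Z ≥ |A|, or a comparison of Z with its expected size
-- |A|²/q, obtained from frequencies whose norm is a square (ε = 1) or a nonsquare (ε = -1). For ε =
-- -1 they yield the two bounds of the first part, and the threshold is the positive cardinality at
-- which these agree; beyond it the second way is the stronger one.

-- Finite sums of integers and indicators

module IntegerSums where
  open import Data.Bool.Base using (true; false; if_then_else_)
  open import Data.Integer.Base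
    using (ℤ; +_; 0ℤ; 1ℤ; _+_; _*_; _≤_; +≤+)
  import Data.Integer.Properties as ℤ
  open import Data.Integer.Tactic.RingSolver using (solve-∀)
  open import Data.List.Base
    using ([]; _∷_; _++_; map; filter; length; cartesianProductWith)
  open import Data.List.Relation.Unary.All using (All; []; _∷_)
  import Data.List.Relation.Unary.All as All
  open import Data.List.Relation.Unary.AllPairs using ([]; _∷_)
  open import Data.List.Relation.Unary.Any using (here; there)
  import Data.List.Membership.Setoid as Membership
  import Data.List.Relation.Unary.Unique.Setoid as UniqueSetoid
  open import Data.Empty using (⊥)
  open import Function.Base using (_∘_)
  open import Level using (Level)
  open import Relation.Binary.Bundles using (Setoid)
  open import Relation.Binary.Definitions using (Decidable)
  open import Relation.Binary.PropositionalEquality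
    using (refl; sym; trans; cong; cong₂; module ≡-Reasoning)
  open import Relation.Nullary.Decidable using (Dec; does; yes; no)
  open import Relation.Nullary.Negation using (¬_; contradiction)
  import Relation.Unary as Unary

  private variable
    a b p : Level
    X Y Z : Set a
    P P′ : Set p

  𝟙 : Dec P → ℤ
  𝟙 P? = if does P? then 1ℤ else 0ℤ

  𝟙-true : (P? : Dec P) → P → 𝟙 P? ≡ 1ℤ
  𝟙-true (yes _) p = refl
  𝟙-true (no ¬p) p = contradiction p ¬p

  𝟙-false : (P? : Dec P) → ¬ P → 𝟙 P? ≡ 0ℤ
  𝟙-false (yes p) ¬p = contradiction p ¬p
  𝟙-false (no _)  ¬p = refl

  𝟙-mono : (P? : Dec P) (P′? : Dec P′) → (P → P′) → 𝟙 P? ≤ 𝟙 P′?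
  𝟙-mono (yes p) P′? f = ℤ.≤-reflexive (sym (𝟙-true P′? (f p)))
  𝟙-mono (no _)  (yes _) f = +≤+ ℕ.z≤n
  𝟙-mono (no _)  (no _)  f = ℤ.≤-refl

  𝟙-cong : (P? : Dec P) (P′? : Dec P′) → (P → P′) → (P′ → P) → 𝟙 P? ≡ 𝟙 P′?
  𝟙-cong P? P′? f g = ℤ.≤-antisym (𝟙-mono P? P′? f) (𝟙-mono P′? P? g)

  𝟙-nonneg : (P? : Dec P) → 0ℤ ≤ 𝟙 P?
  𝟙-nonneg (yes _) = +≤+ ℕ.z≤n
  𝟙-nonneg (no _)  = ℤ.≤-refl

  ∑ : List X → (X → ℤ) → ℤ
  ∑ []       f = 0ℤ
  ∑ (x ∷ xs) f = f x + ∑ xs f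

  infixr 5 ∑
  syntax ∑ xs (λ x → e) = ∑[ x ∈ xs ] e

  ∑-cong : ∀ (xs : List X) {f g : X → ℤ} → (∀ x → f x ≡ g x) → ∑ xs f ≡ ∑ xs g
  ∑-cong []       eq = refl
  ∑-cong (x ∷ xs) eq = cong₂ _+_ (eq x) (∑-cong xs eq)

  ∑-cong-All : {xs : List X} {f g : X → ℤ} → All (λ x → f x ≡ g x) xs → ∑ xs f ≡ ∑ xs g
  ∑-cong-All []         = refl
  ∑-cong-All (eq ∷ eqs) = cong₂ _+_ eq (∑-cong-All eqs)

  ∑-mono-≤ : ∀ (xs : List X) {f g : X → ℤ} → (∀ x → f x ≤ g x) → ∑ xs f ≤ ∑ xs g
  ∑-mono-≤ []       le = ℤ.≤-refl
  ∑-mono-≤ (x ∷ xs) le = ℤ.+-mono-≤ (le x) (∑-mono-≤ xs le)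

  ∑-+ : ∀ (xs : List X) (f g : X → ℤ) → ∑ xs (λ x → f x + g x) ≡ ∑ xs f + ∑ xs g
  ∑-+ []       f g = refl
  ∑-+ (x ∷ xs) f g = trans (cong (_+_ (f x + g x)) (∑-+ xs f g)) (lemma (f x) (g x) _ _)
    where
    lemma : ∀ a b c d → (a + b) + (c + d) ≡ (a + c) + (b + d)
    lemma = solve-∀

  ∑-*ˡ : ∀ (xs : List X) k (f : X → ℤ) → ∑ xs (λ x → k * f x) ≡ k * ∑ xs f
  ∑-*ˡ []       k f = sym (ℤ.*-zeroʳ k)
  ∑-*ˡ (x ∷ xs) k f = trans (cong (_+_ (k * f x)) (∑-*ˡ xs k f)) (sym (ℤ.*-distribˡ-+ k (f x) _))

  ∑-const : ∀ (xs : List X) k → ∑[ x ∈ xs ] k ≡ + length xs * k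
  ∑-const []       k = sym (ℤ.*-zeroˡ k)
  ∑-const (x ∷ xs) k = trans (cong (_+_ k) (∑-const xs k)) (lemma k (+ length xs))
    where
    lemma : ∀ k n → k + n * k ≡ (1ℤ + n) * k
    lemma = solve-∀

  ∑-zero : ∀ (xs : List X) → ∑[ x ∈ xs ] 0ℤ ≡ 0ℤ
  ∑-zero xs = trans (∑-const xs 0ℤ) (ℤ.*-zeroʳ (+ length xs))

  ∑-nonneg : ∀ (xs : List X) {f : X → ℤ} → (∀ x → 0ℤ ≤ f x) → 0ℤ ≤ ∑ xs f
  ∑-nonneg xs {f} le = ℤ.≤-trans (ℤ.≤-reflexive (sym (∑-zero xs))) (∑-mono-≤ xs le)

  ∑-linear : ∀ (xs : List X) k l (f g : X → ℤ) →
             ∑ xs (λ x → k * f x + l * g x) ≡ k * ∑ xs f + l * ∑ xs g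
  ∑-linear xs k l f g = trans (∑-+ xs _ _) (cong₂ _+_ (∑-*ˡ xs k f) (∑-*ˡ xs l g))

  ∑-*ʳ : ∀ (xs : List X) k (f : X → ℤ) → ∑ xs (λ x → f x * k) ≡ ∑ xs f * k
  ∑-*ʳ xs k f = trans (∑-cong xs λ x → ℤ.*-comm (f x) k)
    (trans (∑-*ˡ xs k f) (ℤ.*-comm k _))

  ∑-swap : ∀ (xs : List X) (ys : List Y) (f : X → Y → ℤ) →
           ∑[ x ∈ xs ] ∑[ y ∈ ys ] f x y ≡ ∑[ y ∈ ys ] ∑[ x ∈ xs ] f x y
  ∑-swap []       ys f = sym (∑-zero ys)
  ∑-swap (x ∷ xs) ys f = trans (cong (_+_ (∑ ys (f x))) (∑-swap xs ys f)) (sym (∑-+ ys _ _))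

  ∑-++ : ∀ (xs ys : List X) (f : X → ℤ) → ∑ (xs ++ ys) f ≡ ∑ xs f + ∑ ys f
  ∑-++ []       ys f = sym (ℤ.+-identityˡ _)
  ∑-++ (x ∷ xs) ys f = trans (cong (_+_ (f x)) (∑-++ xs ys f)) (sym (ℤ.+-assoc (f x) _ _))

  ∑-map : ∀ (g : X → Y) (xs : List X) (f : Y → ℤ) → ∑ (map g xs) f ≡ ∑ xs (f ∘ g)
  ∑-map g []       f = refl
  ∑-map g (x ∷ xs) f = cong (_+_ (f (g x))) (∑-map g xs f)

  ∑-cartesianProductWith : ∀ (g : X → Y → Z) xs ys (f : Z → ℤ) →
    ∑ (cartesianProductWith g xs ys) f ≡ ∑[ x ∈ xs ] ∑[ y ∈ ys ] f (g x y)
  ∑-cartesianProductWith g []       ys f = refl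
  ∑-cartesianProductWith g (x ∷ xs) ys f = trans (∑-++ (map (g x) ys) _ f)
    (cong₂ _+_ (∑-map (g x) ys f) (∑-cartesianProductWith g xs ys f))

  length-filter-∑ : {P : X → Set p} (P? : Unary.Decidable P) (xs : List X) →
    + length (filter P? xs) ≡ ∑[ x ∈ xs ] 𝟙 (P? x)
  length-filter-∑ P? []       = refl
  length-filter-∑ P? (x ∷ xs) with does (P? x)
  ... | true  = cong (_+_ 1ℤ) (length-filter-∑ P? xs)
  ... | false = trans (length-filter-∑ P? xs) (sym (ℤ.+-identityˡ _))

  module _ (S : Setoid a b) (_≟_ : Decidable (Setoid._≈_ S)) where
    open Setoid S using (_≈_) renaming (Carrier to C; sym to ≈-sym; trans to ≈-trans)
    open Membership S using (_∈_)
    open UniqueSetoid S using (Unique)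

    ∑-𝟙-absent : ∀ {x xs} (g : C → ℤ) → All (λ y → ¬ x ≈ y) xs →
                 ∑[ y ∈ xs ] 𝟙 (x ≟ y) * g y ≡ 0ℤ
    ∑-𝟙-absent g []          = refl
    ∑-𝟙-absent {x} g (x≉y ∷ x≉) = cong₂ (λ i s → i * _ + s) (𝟙-false (x ≟ _) x≉y) (∑-𝟙-absent g x≉)

    -- Uniqueness leaves a single entry equivalent to `x`. The list may hold a representative other
    -- than `x` itself, hence the congruence of `g`.
    ∑-𝟙-select : ∀ {x xs} (g : C → ℤ) → (∀ {y z} → y ≈ z → g y ≡ g z) →
                 Unique xs → x ∈ xs → ∑[ y ∈ xs ] 𝟙 (x ≟ y) * g y ≡ g x
    ∑-𝟙-select {x} {y ∷ ys} g g-cong (y≉ ∷ ys!) (here x≈y) = begin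
      𝟙 (x ≟ y) * g y + (∑[ z ∈ ys ] 𝟙 (x ≟ z) * g z)
        ≡⟨ cong₂ (λ i s → i * g y + s) (𝟙-true (x ≟ y) x≈y)
             (∑-𝟙-absent g (All.map (λ y≉z x≈z → y≉z (≈-trans (≈-sym x≈y) x≈z)) y≉)) ⟩
      1ℤ * g y + 0ℤ
        ≡⟨ trans (ℤ.+-identityʳ _) (ℤ.*-identityˡ _) ⟩
      g y
        ≡⟨ g-cong (≈-sym x≈y) ⟩
      g x ∎
      where open ≡-Reasoning
    ∑-𝟙-select {x} {y ∷ ys} g g-cong (y≉ ∷ ys!) (there x∈ys) = trans
      (cong₂ (λ i s → i * g y + s) (𝟙-false (x ≟ y) x≉y) (∑-𝟙-select g g-cong ys! x∈ys))
      (trans (cong (_+ g x) (ℤ.*-zeroˡ (g y))) (ℤ.+-identityˡ _))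
      where
      x≉y : ¬ x ≈ y
      x≉y x≈y = All.lookupWith {Q = λ z → x ≈ z} {R = λ _ → ⊥}
        (λ y≉z x≈z → y≉z (≈-trans (≈-sym x≈y) x≈z)) y≉ x∈ys

    ∑∑-𝟙 : ∀ {xs} → Unique xs → ∑[ x ∈ xs ] ∑[ y ∈ xs ] 𝟙 (x ≟ y) ≡ + length xs
    ∑∑-𝟙 {xs} xs! = trans
      (∑-cong-All {xs = xs} (All.tabulateₛ S λ x∈xs → row x∈xs))
      (trans (∑-const xs 1ℤ) (ℤ.*-identityʳ _))
      where
      row : ∀ {x} → x ∈ xs → ∑[ y ∈ xs ] 𝟙 (x ≟ y) ≡ 1ℤ
      row {x} x∈xs = trans (∑-cong xs λ y → sym (ℤ.*-identityʳ _))
        (∑-𝟙-select (λ _ → 1ℤ) (λ _ → refl) xs! x∈xs)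

-- Summation over the field and the quadratic character

module QuadraticCharacter {c ℓ q} (F : FiniteField c ℓ q) where
  open IntegerSums
  open import Algebra.Bundles using (CommutativeRing)
  import Algebra.Properties.Ring as RingProperties
  open import Algebra.Properties.CommutativeSemigroup using (interchange)
  open import Data.Bool.Base using (if_then_else_)
  open import Data.Fin.Base using (Fin)
  import Data.Fin.Properties as Fin
  open import Data.Integer.Base
    using (ℤ; +_; 0ℤ; 1ℤ; -1ℤ; _+_; _*_; _-_; -_; _≤_; -≤+; +≤+; ∣_∣)
  import Data.Integer.Properties as ℤ
  open import Data.Integer.Tactic.RingSolver using (solve-∀)
  open import Data.List.Base using (length; tabulate)
  import Data.List.Membership.Setoid as Membership
  open import Data.List.Membership.Setoid.Properties using (∈-tabulate⁺; ∈-resp-≈)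
  open import Data.List.Properties using (length-tabulate)
  import Data.List.Relation.Unary.Unique.Setoid as UniqueSetoid
  open import Data.List.Relation.Unary.Unique.Setoid.Properties using (tabulate⁺)
  import Data.Nat.DivMod as ℕ
  open import Data.Product.Base using (∃; _×_; _,_; proj₁; proj₂)
  open import Data.Sum.Base using (_⊎_; inj₁; inj₂)
  open import Function.Base using (_∘_)
  open import Function.Bundles using (Inverse)
  open import Relation.Binary.Definitions using (tri<; tri≈; tri>)
  open import Relation.Binary.PropositionalEquality
    using (_≢_; refl; sym; trans; cong; cong₂; module ≡-Reasoning)
  open import Relation.Nullary.Decidable using (Dec; does; yes; no; dec-true; dec-false)
  open import Relation.Nullary.Negation using (¬_; contradiction)

  open FiniteField F using (enumeration; 1≉0; inverse) renaming (commutativeRing to R)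
  private module R = CommutativeRing R
  open R using (Carrier; _≈_; 0#; 1#)
    renaming (_+_ to _⊕_; -_ to ⊖_; _*_ to _·_; _-_ to _−_; setoid to ≈-setoid)
  open RingProperties R.ring
    using (-‿distribˡ-*; [y-z]x≈yx-zx; x[y-z]≈xy-xz; -1*x≈-x)
    renaming ( x∙y⁻¹≈ε⇒x≈y to x−y≈0⇒x≈y; x≈y⇒x∙y⁻¹≈ε to x≈y⇒x−y≈0
             ; -‿involutive to ⊖-involutive; +-inverseʳ-unique to ⊖-unique
             ; //-rightDividesˡ to x−y⊕y≈x; //-rightDividesʳ to x⊕y−y≈x
             ; ⁻¹-anti-homo-// to ⊖[x−y]≈y−x; -0#≈0# to ⊖0≈0 )
  open Inverse enumeration using (to; from; to-cong; strictlyInverseˡ; strictlyInverseʳ)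
  private
    module ≈-Reasoning where
      open import Relation.Binary.Reasoning.Setoid ≈-setoid public

  infix 4 _≟ᶠ_

  -- Opaque copies keep the type checker from unfolding the searches through Fin q.
  opaque
    _≟ᶠ_ : ∀ x y → Dec (x ≈ y)
    _≟ᶠ_ = _≟_ F

    χ : Carrier → ℤ
    χ = η F

  Respects : ∀ {a} {A : Set a} → (Carrier → A) → Set _
  Respects g = ∀ {x y} → x ≈ y → g x ≡ g y

  𝟙-≟-cong : ∀ {x x′ y y′} → x ≈ x′ → y ≈ y′ → 𝟙 (x ≟ᶠ y) ≡ 𝟙 (x′ ≟ᶠ y′)
  𝟙-≟-cong {x} {x′} {y} {y′} x≈x′ y≈y′ = 𝟙-cong (x ≟ᶠ y) (x′ ≟ᶠ y′)
    (λ x≈y → R.trans (R.sym x≈x′) (R.trans x≈y y≈y′))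
    (λ x′≈y′ → R.trans x≈x′ (R.trans x′≈y′ (R.sym y≈y′)))

  𝔽 : List Carrier
  𝔽 = tabulate from

  length-𝔽 : + length 𝔽 ≡ + q
  length-𝔽 = cong +_ (length-tabulate from)

  𝔽-unique : UniqueSetoid.Unique ≈-setoid 𝔽
  𝔽-unique = tabulate⁺ ≈-setoid λ {i} {j} eq →
    trans (sym (strictlyInverseˡ i)) (trans (to-cong eq) (strictlyInverseˡ j))

  𝔽-complete : ∀ x → Membership._∈_ ≈-setoid x 𝔽
  𝔽-complete x = ∈-resp-≈ ≈-setoid (strictlyInverseʳ x) (∈-tabulate⁺ ≈-setoid (to x))

  ∑𝔽-const : ∀ k → ∑[ x ∈ 𝔽 ] k ≡ + q * k
  ∑𝔽-const k = trans (∑-const 𝔽 k) (cong (_* k) length-𝔽)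

  ∑𝔽-select : ∀ c (g : Carrier → ℤ) → Respects g → ∑[ x ∈ 𝔽 ] 𝟙 (c ≟ᶠ x) * g x ≡ g c
  ∑𝔽-select c g g-cong = ∑-𝟙-select ≈-setoid _≟ᶠ_ g g-cong 𝔽-unique (𝔽-complete c)

  ∑𝔽-𝟙 : ∀ c → ∑[ x ∈ 𝔽 ] 𝟙 (c ≟ᶠ x) ≡ 1ℤ
  ∑𝔽-𝟙 c = trans (∑-cong 𝔽 λ x → sym (ℤ.*-identityʳ _)) (∑𝔽-select c (λ _ → 1ℤ) (λ _ → refl))

  term≤∑𝔽 : ∀ (f : Carrier → ℤ) → Respects f → (∀ x → 0ℤ ≤ f x) → ∀ c → f c ≤ ∑ 𝔽 f
  term≤∑𝔽 f f-cong f≥0 c = ℤ.≤-trans (ℤ.≤-reflexive (sym (∑𝔽-select c f f-cong)))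
    (∑-mono-≤ 𝔽 λ x → bound x (c ≟ᶠ x))
    where
    bound : ∀ x (P? : Dec (c ≈ x)) → 𝟙 P? * f x ≤ f x
    bound x (yes _) = ℤ.≤-reflexive (ℤ.*-identityˡ _)
    bound x (no _)  = ℤ.≤-trans (ℤ.≤-reflexive (ℤ.*-zeroˡ (f x))) (f≥0 x)

  -- Inserting the indicator of the value `φ x` and exchanging the sums turns a substitution into
  -- the counting of fibres.
  ∑𝔽-fibres : ∀ {a} {X : Set a} (xs : List X) (φ : X → Carrier) (g : Carrier → ℤ) → Respects g →
              ∑[ x ∈ xs ] g (φ x) ≡ ∑[ c ∈ 𝔽 ] (∑[ x ∈ xs ] 𝟙 (φ x ≟ᶠ c)) * g c
  ∑𝔽-fibres xs φ g g-cong = trans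
    (∑-cong xs λ x → sym (∑𝔽-select (φ x) g g-cong))
    (trans (∑-swap xs 𝔽 _) (∑-cong 𝔽 λ c → ∑-*ʳ xs (g c) _))

  -- The fibre of `φ` over `c` is the single class of `ψ c`. The two implications express both
  -- inverse laws and the congruence of `φ` and `ψ` at once.
  ∑𝔽-reindex : ∀ (φ ψ : Carrier → Carrier) →
    (∀ {x c} → φ x ≈ c → ψ c ≈ x) → (∀ {x c} → ψ c ≈ x → φ x ≈ c) →
    ∀ (g : Carrier → ℤ) → Respects g → ∑[ x ∈ 𝔽 ] g (φ x) ≡ ∑ 𝔽 g
  ∑𝔽-reindex φ ψ φ⇒ψ ψ⇒φ g g-cong = trans (∑𝔽-fibres 𝔽 φ g g-cong) (∑-cong 𝔽 λ c →
    trans (cong (_* g c) (trans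
      (∑-cong 𝔽 λ x → 𝟙-cong (φ x ≟ᶠ c) (ψ c ≟ᶠ x) φ⇒ψ ψ⇒φ) (∑𝔽-𝟙 (ψ c))))
    (ℤ.*-identityˡ _))

  ∑𝔽-translate : ∀ b (g : Carrier → ℤ) → Respects g → ∑[ x ∈ 𝔽 ] g (x ⊕ b) ≡ ∑ 𝔽 g
  ∑𝔽-translate b = ∑𝔽-reindex (_⊕ b) (_− b)
    (λ eq → R.trans (R.+-congʳ (R.sym eq)) (x⊕y−y≈x b _))
    (λ eq → R.trans (R.+-congʳ (R.sym eq)) (x−y⊕y≈x b _))

  ∑𝔽-reflect : ∀ b (g : Carrier → ℤ) → Respects g → ∑[ x ∈ 𝔽 ] g (b − x) ≡ ∑ 𝔽 g
  ∑𝔽-reflect b = ∑𝔽-reindex (b −_) (b −_) flip-minus flip-minus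
    where
    flip-minus : ∀ {x y} → b − x ≈ y → b − y ≈ x
    flip-minus {x} {y} eq = begin
      b ⊕ ⊖ y        ≈⟨ R.+-congˡ (R.-‿cong eq) ⟨
      b ⊕ ⊖ (b − x)  ≈⟨ R.+-congˡ (⊖[x−y]≈y−x b x) ⟩
      b ⊕ (x − b)    ≈⟨ R.+-comm b _ ⟩
      (x − b) ⊕ b    ≈⟨ x−y⊕y≈x b x ⟩
      x              ∎
      where open ≈-Reasoning

  ∑𝔽-scale : ∀ {a} → ¬ a ≈ 0# → ∀ (g : Carrier → ℤ) → Respects g → ∑[ x ∈ 𝔽 ] g (a · x) ≡ ∑ 𝔽 g
  ∑𝔽-scale {a} a≉0 = ∑𝔽-reindex (a ·_) (a⁻¹ ·_)
    (λ eq → R.trans (R.*-congˡ (R.sym eq)) (cancel a⁻¹ a (R.trans (R.*-comm a⁻¹ a) aa⁻¹≈1)))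
    (λ eq → R.trans (R.*-congˡ (R.sym eq)) (cancel a a⁻¹ aa⁻¹≈1))
    where
    a⁻¹ = proj₁ (inverse a a≉0)
    aa⁻¹≈1 = proj₂ (inverse a a≉0)
    cancel : ∀ u v {x} → u · v ≈ 1# → u · (v · x) ≈ x
    cancel u v eq = R.trans (R.sym (R.*-assoc u v _)) (R.trans (R.*-congʳ eq) (R.*-identityˡ _))

  ·-cancelˡ : ∀ {a x y} → ¬ a ≈ 0# → a · x ≈ a · y → x ≈ y
  ·-cancelˡ {a} {x} {y} a≉0 eq = begin
    x                ≈⟨ cancel x ⟨
    a⁻¹ · (a · x)    ≈⟨ R.*-congˡ eq ⟩
    a⁻¹ · (a · y)    ≈⟨ cancel y ⟩
    y                ∎
    where
    open ≈-Reasoning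
    a⁻¹ = proj₁ (inverse a a≉0)
    cancel : ∀ z → a⁻¹ · (a · z) ≈ z
    cancel z = R.trans (R.sym (R.*-assoc a⁻¹ a z)) (R.trans
      (R.*-congʳ (R.trans (R.*-comm a⁻¹ a) (proj₂ (inverse a a≉0)))) (R.*-identityˡ z))

  x·y≈0⇒y≈0 : ∀ {x y} → ¬ x ≈ 0# → x · y ≈ 0# → y ≈ 0#
  x·y≈0⇒y≈0 x≉0 eq = ·-cancelˡ x≉0 (R.trans eq (R.sym (R.zeroʳ _)))

  x·y≉0 : ∀ {x y} → ¬ x ≈ 0# → ¬ y ≈ 0# → ¬ x · y ≈ 0#
  x·y≉0 x≉0 y≉0 eq = y≉0 (x·y≈0⇒y≈0 x≉0 eq)

  x·x≈0⇒x≈0 : ∀ {x} → x · x ≈ 0# → x ≈ 0#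
  x·x≈0⇒x≈0 {x} eq with x ≟ᶠ 0#
  ... | yes x≈0 = x≈0
  ... | no  x≉0 = x·y≈0⇒y≈0 x≉0 eq

  x·x≈y·y⇒x≈±y : ∀ {x y} → x · x ≈ y · y → x ≈ y ⊎ x ≈ ⊖ y
  x·x≈y·y⇒x≈±y {x} {y} eq with x ≟ᶠ y
  ... | yes x≈y = inj₁ x≈y
  ... | no  x≉y = inj₂ (R.trans (⊖-unique y x (R.trans (R.+-comm y x) x+y≈0)) R.refl)
    where
    open ≈-Reasoning
    x+y≈0 : x ⊕ y ≈ 0#
    x+y≈0 = x·y≈0⇒y≈0 (λ x−y≈0 → x≉y (x−y≈0⇒x≈y x y x−y≈0)) (begin
      (x − y) · (x ⊕ y)            ≈⟨ [y-z]x≈yx-zx (x ⊕ y) x y ⟩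
      x · (x ⊕ y) − y · (x ⊕ y)    ≈⟨ x≈y⇒x−y≈0 (begin
        x · (x ⊕ y)      ≈⟨ R.distribˡ x x y ⟩
        x · x ⊕ x · y    ≈⟨ R.+-cong eq (R.*-comm x y) ⟩
        y · y ⊕ y · x    ≈⟨ R.+-comm _ _ ⟩
        y · x ⊕ y · y    ≈⟨ R.distribˡ y x y ⟨
        y · (x ⊕ y)      ∎) ⟩
      0#                           ∎)

  -- The indicators of `0#` and of `1#` have total 1 each and disjoint supports.
  2≤q : + 2 ≤ + q
  2≤q = begin
    + 2                                             ≡⟨ cong₂ _+_ (∑𝔽-𝟙 0#) (∑𝔽-𝟙 1#) ⟨
    (∑[ x ∈ 𝔽 ] 𝟙 (0# ≟ᶠ x)) + (∑[ x ∈ 𝔽 ] 𝟙 (1# ≟ᶠ x))  ≡⟨ ∑-+ 𝔽 _ _ ⟨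
    ∑[ x ∈ 𝔽 ] 𝟙 (0# ≟ᶠ x) + 𝟙 (1# ≟ᶠ x)            ≤⟨ ∑-mono-≤ 𝔽 (λ x → bound x (0# ≟ᶠ x) (1# ≟ᶠ x)) ⟩
    ∑[ x ∈ 𝔽 ] 1ℤ                                   ≡⟨ ∑𝔽-const 1ℤ ⟩
    + q * 1ℤ                                        ≡⟨ ℤ.*-identityʳ _ ⟩
    + q                                             ∎
    where
    open ℤ.≤-Reasoning
    bound : ∀ x (P? : Dec (0# ≈ x)) (P′? : Dec (1# ≈ x)) → 𝟙 P? + 𝟙 P′? ≤ 1ℤ
    bound x (yes 0≈x) (yes 1≈x) = contradiction (R.trans 1≈x (R.sym 0≈x)) 1≉0
    bound x (yes _)   (no _)    = ℤ.≤-refl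
    bound x (no _)    (yes _)   = ℤ.≤-refl
    bound x (no _)    (no _)    = +≤+ ℕ.z≤n

  -- Each class carries a witness along with the value of `χ`, so that one match yields both while
  -- `χ` stays opaque.
  data QuadraticClass (x : Carrier) : Set (c Level.⊔ ℓ) where
    zero      : x ≈ 0# → χ x ≡ 0ℤ → QuadraticClass x
    square    : ∀ r → ¬ r ≈ 0# → r · r ≈ x → χ x ≡ 1ℤ → QuadraticClass x
    nonsquare : ¬ x ≈ 0# → ¬ IsSquare F x → χ x ≡ -1ℤ → QuadraticClass x

  opaque
    unfolding χ

    χ≡η : ∀ x → χ x ≡ η F x
    χ≡η x = refl

    classify : ∀ x → QuadraticClass x
    classify x with _≟_ F x 0# | isSquare? F x
    ... | yes x≈0 | _ = zero x≈0
      (cong (λ b → if b then 0ℤ else (if does (isSquare? F x) then 1ℤ else -1ℤ)) (dec-true (_≟_ F x 0#) x≈0))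
    ... | no x≉0 | yes (r , r·r≈x) = square r r≉0 r·r≈x
      (cong₂ (λ b b′ → if b then 0ℤ else (if b′ then 1ℤ else -1ℤ))
        (dec-false (_≟_ F x 0#) x≉0) (dec-true (isSquare? F x) (r , r·r≈x)))
      where
      r≉0 : ¬ r ≈ 0#
      r≉0 r≈0 = x≉0 (R.trans (R.sym r·r≈x) (R.trans (R.*-congʳ r≈0) (R.zeroˡ r)))
    ... | no x≉0 | no ¬sq = nonsquare x≉0 ¬sq
      (cong₂ (λ b b′ → if b then 0ℤ else (if b′ then 1ℤ else -1ℤ))
        (dec-false (_≟_ F x 0#) x≉0) (dec-false (isSquare? F x) ¬sq))

  χ-zero : ∀ {x} → x ≈ 0# → χ x ≡ 0ℤ
  χ-zero {x} x≈0 with classify x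
  ... | zero _ eq            = eq
  ... | square r r≉0 r·r≈x _ = contradiction (x·x≈0⇒x≈0 (R.trans r·r≈x x≈0)) r≉0
  ... | nonsquare x≉0 _ _    = contradiction x≈0 x≉0

  χ-square : ∀ {x} r → ¬ r ≈ 0# → r · r ≈ x → χ x ≡ 1ℤ
  χ-square {x} r r≉0 r·r≈x with classify x
  ... | zero x≈0 _       = contradiction (x·x≈0⇒x≈0 (R.trans r·r≈x x≈0)) r≉0
  ... | square _ _ _ eq  = eq
  ... | nonsquare _ ¬□ _ = contradiction (r , r·r≈x) ¬□

  χ-nonsquare : ∀ {x} → ¬ IsSquare F x → χ x ≡ -1ℤ
  χ-nonsquare {x} ¬□ with classify x
  ... | zero x≈0 _         = contradiction (0# , R.trans (R.zeroˡ 0#) (R.sym x≈0)) ¬□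
  ... | square r _ r·r≈x _ = contradiction (r , r·r≈x) ¬□
  ... | nonsquare _ _ eq   = eq

  χ-cong : Respects χ
  χ-cong {x} {y} x≈y with classify x
  ... | zero x≈0 eq            = trans eq (sym (χ-zero (R.trans (R.sym x≈y) x≈0)))
  ... | square r r≉0 r·r≈x eq  = trans eq (sym (χ-square r r≉0 (R.trans r·r≈x x≈y)))
  ... | nonsquare _ ¬□ eq      =
    trans eq (sym (χ-nonsquare λ (r , r·r≈y) → ¬□ (r , R.trans r·r≈y (R.sym x≈y))))

  χ-one : χ 1# ≡ 1ℤ
  χ-one = χ-square 1# 1≉0 (R.*-identityˡ 1#)

  χ-squared : ∀ x → χ x * χ x ≡ 1ℤ - 𝟙 (0# ≟ᶠ x)
  χ-squared x with classify x
  ... | zero x≈0 eq rewrite eq | 𝟙-true (0# ≟ᶠ x) (R.sym x≈0) = refl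
  ... | square r r≉0 r·r≈x eq rewrite eq
      | 𝟙-false (0# ≟ᶠ x) (λ 0≈x → r≉0 (x·x≈0⇒x≈0 (R.trans r·r≈x (R.sym 0≈x)))) = refl
  ... | nonsquare x≉0 _ eq rewrite eq | 𝟙-false (0# ≟ᶠ x) (x≉0 ∘ R.sym) = refl

  ∣χ∣≤1 : ∀ x → χ x ≤ 1ℤ × -1ℤ ≤ χ x
  ∣χ∣≤1 x with classify x
  ... | zero _ eq rewrite eq       = +≤+ ℕ.z≤n , -≤+
  ... | square _ _ _ eq rewrite eq = ℤ.≤-refl , -≤+
  ... | nonsquare _ _ eq rewrite eq = -≤+ , ℤ.≤-refl

  -- Root counts, multiplicativity and correlations of the character

  module OddOrder (q-odd : q % 2 ≡ 1) where

    -- If 2 = 0 then x ↦ x + 1 is a fixed-point-free involution, and 𝔽 splits into two halves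
    -- according to whether it increases or decreases the index.
    2≉0 : ¬ 1# ⊕ 1# ≈ 0#
    2≉0 2≈0 = odd≢even (∑ 𝔽 up) (begin
      + q                                           ≡⟨ ℤ.*-identityʳ _ ⟨
      + q * 1ℤ                                      ≡⟨ ∑𝔽-const 1ℤ ⟨
      ∑[ x ∈ 𝔽 ] 1ℤ                                 ≡⟨ ∑-cong 𝔽 (λ x → sym (halves x)) ⟩
      ∑[ x ∈ 𝔽 ] up x + up (x ⊕ 1#)                 ≡⟨ ∑-+ 𝔽 _ _ ⟩
      ∑ 𝔽 up + (∑[ x ∈ 𝔽 ] up (x ⊕ 1#))             ≡⟨ cong (_+_ (∑ 𝔽 up)) (∑𝔽-translate 1# up up-cong) ⟩
      ∑ 𝔽 up + ∑ 𝔽 up                               ∎)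
      where
      open ≡-Reasoning
      up : Carrier → ℤ
      up x = 𝟙 (to x Fin.<? to (x ⊕ 1#))
      up-cong : Respects up
      up-cong eq = cong₂ (λ i j → 𝟙 (i Fin.<? j)) (to-cong eq) (to-cong (R.+-congʳ eq))
      to-injective : ∀ {x y} → to x ≡ to y → x ≈ y
      to-injective {x} {y} eq = R.trans (R.sym (strictlyInverseʳ x))
        (R.trans (R.reflexive (cong from eq)) (strictlyInverseʳ y))
      x⊕1≉x : ∀ x → ¬ x ≈ x ⊕ 1#
      x⊕1≉x x eq = 1≉0 (begin′
        1#              ≈⟨ x⊕y−y≈x x 1# ⟨
        (1# ⊕ x) − x    ≈⟨ x≈y⇒x−y≈0 (R.trans (R.+-comm 1# x) (R.sym eq)) ⟩
        0#              ∎′)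
        where open ≈-Reasoning renaming (begin_ to begin′_; _∎ to _∎′)
      x⊕1⊕1≈x : ∀ x → (x ⊕ 1#) ⊕ 1# ≈ x
      x⊕1⊕1≈x x = R.trans (R.+-assoc x 1# 1#) (R.trans (R.+-congˡ 2≈0) (R.+-identityʳ x))
      halves : ∀ x → up x + up (x ⊕ 1#) ≡ 1ℤ
      halves x rewrite to-cong (x⊕1⊕1≈x x) with Fin.<-cmp (to x) (to (x ⊕ 1#))
      ... | tri< lt _ ngt = cong₂ _+_ (𝟙-true (_ Fin.<? _) lt) (𝟙-false (_ Fin.<? _) ngt)
      ... | tri≈ _ eq _   = contradiction (to-injective eq) (x⊕1≉x x)
      ... | tri> nlt _ gt = cong₂ _+_ (𝟙-false (_ Fin.<? _) nlt) (𝟙-true (_ Fin.<? _) gt)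
      odd≢even : ∀ k → + q ≢ k + k
      odd≢even k eq = contradiction q-odd λ q%2≡1 → 0≢1 (trans (sym q%2≡0) q%2≡1)
        where
        0≢1 : 0 ≢ 1
        0≢1 ()
        q≡∣k∣*2 : q ≡ ∣ k ∣ ℕ.* 2
        q≡∣k∣*2 = trans (cong ∣_∣ (trans eq (double k))) (ℤ.abs-* k (+ 2))
          where
          double : ∀ k → k + k ≡ k * + 2
          double = solve-∀
        q%2≡0 : q % 2 ≡ 0
        q%2≡0 = trans (cong (_% 2) q≡∣k∣*2) (ℕ.m*n%n≡0 ∣ k ∣ 2)

    r≉⊖r : ∀ {r} → ¬ r ≈ 0# → ¬ r ≈ ⊖ r
    r≉⊖r {r} r≉0 eq = 2≉0 (x·y≈0⇒y≈0 r≉0 (begin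
      r · (1# ⊕ 1#)      ≈⟨ R.distribˡ r 1# 1# ⟩
      r · 1# ⊕ r · 1#    ≈⟨ R.+-cong (R.*-identityʳ r) (R.*-identityʳ r) ⟩
      r ⊕ r              ≈⟨ R.+-congˡ eq ⟩
      r ⊕ ⊖ r            ≈⟨ R.-‿inverseʳ r ⟩
      0#                 ∎))
      where open ≈-Reasoning

    -- Zero has one root, a nonzero square the two roots ± r, which differ because 2 ≠ 0, and a
    -- nonsquare none. This is how `χ` enters every count of squares.
    ∑𝟙[y²≡c]≡1+χ[c] : ∀ c → ∑[ y ∈ 𝔽 ] 𝟙 (y · y ≟ᶠ c) ≡ 1ℤ + χ c
    ∑𝟙[y²≡c]≡1+χ[c] c with classify c
    ... | zero c≈0 χc≡0 rewrite χc≡0 = trans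
      (∑-cong 𝔽 λ y → 𝟙-cong (y · y ≟ᶠ c) (0# ≟ᶠ y)
        (λ y²≈c → R.sym (x·x≈0⇒x≈0 (R.trans y²≈c c≈0)))
        (λ 0≈y → R.trans (R.*-congʳ (R.sym 0≈y)) (R.trans (R.zeroˡ y) (R.sym c≈0))))
      (∑𝔽-𝟙 0#)
    ... | square r r≉0 r²≈c χc≡1 rewrite χc≡1 = trans
      (∑-cong 𝔽 λ y → roots y (y · y ≟ᶠ c) (r ≟ᶠ y) (⊖ r ≟ᶠ y))
      (trans (∑-+ 𝔽 _ _) (cong₂ _+_ (∑𝔽-𝟙 r) (∑𝔽-𝟙 (⊖ r))))
      where
      [⊖r]²≈r² : ⊖ r · ⊖ r ≈ r · r
      [⊖r]²≈r² = begin
        ⊖ r · ⊖ r      ≈⟨ -‿distribˡ-* r (⊖ r) ⟨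
        ⊖ (r · ⊖ r)    ≈⟨ R.-‿cong (R.*-comm r (⊖ r)) ⟩
        ⊖ (⊖ r · r)    ≈⟨ R.-‿cong (-‿distribˡ-* r r) ⟨
        ⊖ (⊖ (r · r))  ≈⟨ ⊖-involutive _ ⟩
        r · r          ∎
        where open ≈-Reasoning
      roots : ∀ y (P : Dec (y · y ≈ c)) (P₊ : Dec (r ≈ y)) (P₋ : Dec (⊖ r ≈ y)) → 𝟙 P ≡ 𝟙 P₊ + 𝟙 P₋
      roots y P       (yes r≈y) (yes ⊖r≈y) = contradiction (R.trans r≈y (R.sym ⊖r≈y)) (r≉⊖r r≉0)
      roots y P       (yes r≈y) (no _)     = 𝟙-true P
        (R.trans (R.*-cong (R.sym r≈y) (R.sym r≈y)) r²≈c)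
      roots y P       (no _)    (yes ⊖r≈y) = 𝟙-true P
        (R.trans (R.*-cong (R.sym ⊖r≈y) (R.sym ⊖r≈y)) (R.trans [⊖r]²≈r² r²≈c))
      roots y (no _)  (no _)    (no _)     = refl
      roots y (yes y²≈c) (no r≉y) (no ⊖r≉y) with x·x≈y·y⇒x≈±y (R.trans y²≈c (R.sym r²≈c))
      ... | inj₁ y≈r  = contradiction (R.sym y≈r) r≉y
      ... | inj₂ y≈⊖r = contradiction (R.sym y≈⊖r) ⊖r≉y
    ... | nonsquare _ ¬□ χc≡-1 rewrite χc≡-1 = trans
      (∑-cong 𝔽 λ y → 𝟙-false (y · y ≟ᶠ c) (λ y²≈c → ¬□ (y , y²≈c))) (∑-zero 𝔽)

    ∑𝔽-squares : ∀ (g : Carrier → ℤ) → Respects g →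
                 ∑[ y ∈ 𝔽 ] g (y · y) ≡ ∑[ c ∈ 𝔽 ] (1ℤ + χ c) * g c
    ∑𝔽-squares g g-cong = trans (∑𝔽-fibres 𝔽 (λ y → y · y) g g-cong)
      (∑-cong 𝔽 λ c → cong (_* g c) (∑𝟙[y²≡c]≡1+χ[c] c))

    -- Sorting the q elements of the field by their squares gives q = ∑ (1 + χ c) = q + ∑ χ.
    ∑χ≡0 : ∑ 𝔽 χ ≡ 0ℤ
    ∑χ≡0 = RingProperties.+-cancelˡ ℤ.+-*-ring (+ q * 1ℤ) _ _ (begin
      + q * 1ℤ + ∑ 𝔽 χ               ≡⟨ cong (_+ ∑ 𝔽 χ) (∑𝔽-const 1ℤ) ⟨
      (∑[ c ∈ 𝔽 ] 1ℤ) + ∑ 𝔽 χ        ≡⟨ ∑-+ 𝔽 _ _ ⟨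
      ∑[ c ∈ 𝔽 ] 1ℤ + χ c              ≡⟨ ∑-cong 𝔽 (λ c → sym (ℤ.*-identityʳ _)) ⟩
      ∑[ c ∈ 𝔽 ] (1ℤ + χ c) * 1ℤ       ≡⟨ ∑𝔽-squares (λ _ → 1ℤ) (λ _ → refl) ⟨
      ∑[ y ∈ 𝔽 ] 1ℤ                      ≡⟨ ∑𝔽-const 1ℤ ⟩
      + q * 1ℤ                           ≡⟨ ℤ.+-identityʳ _ ⟨
      + q * 1ℤ + 0ℤ                      ∎)
      where open ≡-Reasoning

    -- Multiplication by r² preserves each quadratic class, because roots scale by r. Full
    -- multiplicativity is bootstrapped from this case.
    χ-[r²x] : ∀ {r} → ¬ r ≈ 0# → ∀ x → χ ((r · r) · x) ≡ χ x
    χ-[r²x] {r} r≉0 x with classify x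
    ... | zero x≈0 eq = trans (χ-zero (R.trans (R.*-congˡ x≈0) (R.zeroʳ _))) (sym eq)
    ... | square s s≉0 s²≈x eq = trans (χ-square (r · s) (x·y≉0 r≉0 s≉0)
      (R.trans (interchange R.*-commutativeSemigroup r s r s) (R.*-congˡ s²≈x))) (sym eq)
    ... | nonsquare x≉0 ¬□ eq = trans (χ-nonsquare λ (s , s²≈r²x) → ¬□ (r⁻¹ · s , (begin
      (r⁻¹ · s) · (r⁻¹ · s)              ≈⟨ interchange R.*-commutativeSemigroup r⁻¹ s r⁻¹ s ⟩
      (r⁻¹ · r⁻¹) · (s · s)              ≈⟨ R.*-congˡ s²≈r²x ⟩
      (r⁻¹ · r⁻¹) · ((r · r) · x)        ≈⟨ R.*-assoc _ _ x ⟨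
      ((r⁻¹ · r⁻¹) · (r · r)) · x        ≈⟨ R.*-congʳ (interchange R.*-commutativeSemigroup r⁻¹ r⁻¹ r r) ⟩
      ((r⁻¹ · r) · (r⁻¹ · r)) · x        ≈⟨ R.*-congʳ (R.*-cong r⁻¹r≈1 r⁻¹r≈1) ⟩
      (1# · 1#) · x                      ≈⟨ R.*-congʳ (R.*-identityˡ 1#) ⟩
      1# · x                             ≈⟨ R.*-identityˡ x ⟩
      x                                  ∎))) (sym eq)
      where
      open ≈-Reasoning
      r⁻¹ = proj₁ (inverse r r≉0)
      r⁻¹r≈1 = R.trans (R.*-comm r⁻¹ r) (proj₂ (inverse r r≉0))

    -- For a nonsquare n, χ(n c) + χ(c) ≤ 0 for all c, while these terms add up to 0.
    χ-* : ∀ x y → χ (x · y) ≡ χ x * χ y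
    χ-* x y with classify x
    ... | zero x≈0 eq rewrite eq = χ-zero (R.trans (R.*-congʳ x≈0) (R.zeroˡ y))
    ... | square r r≉0 r²≈x eq rewrite eq = trans (χ-cong (R.*-congʳ (R.sym r²≈x)))
      (trans (χ-[r²x] r≉0 y) (sym (ℤ.*-identityˡ _)))
    ... | nonsquare x≉0 ¬□ eq rewrite eq = trans
      (negate _ _ (ℤ.≤-antisym (ℤ.≤-trans (term≤∑𝔽 f f-cong f≥0 y) (ℤ.≤-reflexive ∑f≡0)) (f≥0 y)))
      (sym (ℤ.-1*i≡-i _))
      where
      open ≡-Reasoning
      negate : ∀ a b → - (a + b) ≡ 0ℤ → a ≡ - b
      negate a b eq = trans (rearrange a b) (trans (cong (λ z → - z - b) eq) (ℤ.+-identityˡ _))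
        where
        rearrange : ∀ a b → a ≡ - - (a + b) - b
        rearrange = solve-∀
      f : Carrier → ℤ
      f c = - (χ (x · c) + χ c)
      f-cong : Respects f
      f-cong c≈c′ = cong₂ (λ u v → - (u + v)) (χ-cong (R.*-congˡ c≈c′)) (χ-cong c≈c′)
      f≥0 : ∀ c → 0ℤ ≤ f c
      f≥0 c with classify c
      ... | zero c≈0 eq′ rewrite eq′ | χ-zero (R.trans (R.*-congˡ {x} c≈0) (R.zeroʳ x)) = ℤ.≤-refl
      ... | square r r≉0 r²≈c eq′ rewrite eq′
          | χ-cong (R.trans (R.*-comm x c) (R.*-congʳ (R.sym r²≈c)))
          | χ-[r²x] r≉0 x | eq = ℤ.≤-refl
      ... | nonsquare _ _ eq′ rewrite eq′ =
        ℤ.neg-mono-≤ (ℤ.+-mono-≤ (proj₁ (∣χ∣≤1 (x · c))) (ℤ.≤-refl { -1ℤ}))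
      ∑f≡0 : ∑ 𝔽 f ≡ 0ℤ
      ∑f≡0 = begin
        ∑ 𝔽 f                                                  ≡⟨ ∑-cong 𝔽 (λ c → sym (ℤ.-1*i≡-i (χ (x · c) + χ c))) ⟩
        ∑[ c ∈ 𝔽 ] -1ℤ * (χ (x · c) + χ c)                 ≡⟨ ∑-*ˡ 𝔽 -1ℤ (λ c → χ (x · c) + χ c) ⟩
        -1ℤ * (∑[ c ∈ 𝔽 ] χ (x · c) + χ c)                 ≡⟨ cong (_*_ -1ℤ) (∑-+ 𝔽 _ _) ⟩
        -1ℤ * ((∑[ c ∈ 𝔽 ] χ (x · c)) + ∑ 𝔽 χ)
          ≡⟨ cong (λ s → -1ℤ * (s + ∑ 𝔽 χ)) (∑𝔽-scale x≉0 χ χ-cong) ⟩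
        -1ℤ * (∑ 𝔽 χ + ∑ 𝔽 χ)                          ≡⟨ cong (λ s → -1ℤ * (s + s)) ∑χ≡0 ⟩
        0ℤ                                                     ∎

    correlation : Carrier → ℤ
    correlation b = ∑[ c ∈ 𝔽 ] χ c * χ (c − b)

    correlation-0 : ∀ {b} → b ≈ 0# → correlation b ≡ + q - 1ℤ
    correlation-0 {b} b≈0 = begin
      ∑[ c ∈ 𝔽 ] χ c * χ (c − b)         ≡⟨ ∑-cong 𝔽 (λ c → cong (_*_ (χ c)) (χ-cong (c−b≈c c))) ⟩
      ∑[ c ∈ 𝔽 ] χ c * χ c               ≡⟨ ∑-cong 𝔽 (λ c → trans (χ-squared c) (as-linear (𝟙 (0# ≟ᶠ c)))) ⟩
      ∑[ c ∈ 𝔽 ] 1ℤ * 1ℤ + -1ℤ * 𝟙 (0# ≟ᶠ c)  ≡⟨ ∑-linear 𝔽 1ℤ -1ℤ (λ _ → 1ℤ) (λ c → 𝟙 (0# ≟ᶠ c)) ⟩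
      1ℤ * (∑[ c ∈ 𝔽 ] 1ℤ) + -1ℤ * (∑[ c ∈ 𝔽 ] 𝟙 (0# ≟ᶠ c))
        ≡⟨ cong₂ (λ s t → 1ℤ * s + -1ℤ * t) (∑𝔽-const 1ℤ) (∑𝔽-𝟙 0#) ⟩
      1ℤ * (+ q * 1ℤ) + -1ℤ * 1ℤ              ≡⟨ simplify (+ q) ⟩
      + q - 1ℤ                                ∎
      where
      open ≡-Reasoning
      c−b≈c : ∀ c → c − b ≈ c
      c−b≈c c = R.trans (R.+-congˡ (R.trans (R.-‿cong b≈0) ⊖0≈0)) (R.+-identityʳ c)
      as-linear : ∀ i → 1ℤ - i ≡ 1ℤ * 1ℤ + -1ℤ * i
      as-linear = solve-∀
      simplify : ∀ q → 1ℤ * (q * 1ℤ) + -1ℤ * 1ℤ ≡ q - 1ℤ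
      simplify = solve-∀

    -- The substitution of b c for c pulls a factor `χ b` out of both characters, and its square is
    -- 1.
    correlation-scale : ∀ {b} → ¬ b ≈ 0# → correlation b ≡ correlation 1#
    correlation-scale {b} b≉0 = begin
      ∑[ c ∈ 𝔽 ] χ c * χ (c − b)
        ≡⟨ ∑𝔽-scale b≉0 _ (λ eq → cong₂ _*_ (χ-cong eq) (χ-cong (R.+-congʳ eq))) ⟨
      ∑[ c ∈ 𝔽 ] χ (b · c) * χ (b · c − b)
        ≡⟨ ∑-cong 𝔽 (λ c → cong₂ _*_ (χ-* b c) (trans (χ-cong (factor c)) (χ-* b (c − 1#)))) ⟩
      ∑[ c ∈ 𝔽 ] (χ b * χ c) * (χ b * χ (c − 1#))
        ≡⟨ ∑-cong 𝔽 (λ c → trans (regroup (χ b) (χ c) (χ (c − 1#))) (cong (_* (χ c * χ (c − 1#))) χ[b]²≡1)) ⟩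
      ∑[ c ∈ 𝔽 ] 1ℤ * (χ c * χ (c − 1#))
        ≡⟨ ∑-cong 𝔽 (λ c → ℤ.*-identityˡ (χ c * χ (c − 1#))) ⟩
      ∑[ c ∈ 𝔽 ] χ c * χ (c − 1#) ∎
      where
      open ≡-Reasoning
      factor : ∀ c → b · c − b ≈ b · (c − 1#)
      factor c = R.sym (R.trans (x[y-z]≈xy-xz b c 1#) (R.+-congˡ (R.-‿cong (R.*-identityʳ b))))
      regroup : ∀ a x y → (a * x) * (a * y) ≡ (a * a) * (x * y)
      regroup = solve-∀
      χ[b]²≡1 : χ b * χ b ≡ 1ℤ
      χ[b]²≡1 = trans (χ-squared b) (cong (_-_ 1ℤ) (𝟙-false (0# ≟ᶠ b) (b≉0 ∘ R.sym)))

    q-1≢0 : + q - 1ℤ ≢ 0ℤ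
    q-1≢0 eq = contradiction (ℤ.≤-trans 2≤q (ℤ.≤-reflexive (ℤ.i-j≡0⇒i≡j (+ q) 1ℤ eq))) λ { (+≤+ (ℕ.s≤s ())) }

    -- The correlation has the same value at every b ≠ 0, and its values add up to (∑ χ)² = 0.
    correlation-≡ : ∀ b → correlation b ≡ + q * 𝟙 (0# ≟ᶠ b) - 1ℤ
    correlation-≡ b = trans (as-step b)
      (trans (cong (λ j → j + (+ q - 1ℤ - j) * 𝟙 (0# ≟ᶠ b)) j₁≡-1) (final (+ q) (𝟙 (0# ≟ᶠ b))))
      where
      open ≡-Reasoning
      j₁ = correlation 1#
      as-step : ∀ b → correlation b ≡ j₁ + (+ q - 1ℤ - j₁) * 𝟙 (0# ≟ᶠ b)
      as-step b = step (0# ≟ᶠ b)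
        where
        at-0 : ∀ q j → q - 1ℤ ≡ j + (q - 1ℤ - j) * 1ℤ
        at-0 = solve-∀
        off-0 : ∀ q j → j ≡ j + (q - 1ℤ - j) * 0ℤ
        off-0 = solve-∀
        step : (P : Dec (0# ≈ b)) → correlation b ≡ j₁ + (+ q - 1ℤ - j₁) * 𝟙 P
        step (yes 0≈b) = trans (correlation-0 (R.sym 0≈b)) (at-0 (+ q) j₁)
        step (no 0≉b)  = trans (correlation-scale (0≉b ∘ R.sym)) (off-0 (+ q) j₁)
      total : ∑ 𝔽 correlation ≡ 0ℤ
      total = begin
        ∑ 𝔽 correlation                                   ≡⟨ ∑-swap 𝔽 𝔽 _ ⟩
        ∑[ c ∈ 𝔽 ] ∑[ b ∈ 𝔽 ] χ c * χ (c − b)         ≡⟨ ∑-cong 𝔽 (λ c → ∑-*ˡ 𝔽 (χ c) (λ b → χ (c − b))) ⟩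
        ∑[ c ∈ 𝔽 ] χ c * (∑[ b ∈ 𝔽 ] χ (c − b))
          ≡⟨ ∑-cong 𝔽 (λ c → cong (_*_ (χ c)) (trans (∑𝔽-reflect c χ χ-cong) ∑χ≡0)) ⟩
        ∑[ c ∈ 𝔽 ] χ c * 0ℤ                             ≡⟨ ∑-cong 𝔽 (λ c → ℤ.*-zeroʳ (χ c)) ⟩
        ∑[ c ∈ 𝔽 ] 0ℤ                                     ≡⟨ ∑-zero 𝔽 ⟩
        0ℤ                                                ∎
      total′ : ∑ 𝔽 correlation ≡ + q * j₁ + (+ q - 1ℤ - j₁)
      total′ = begin
        ∑ 𝔽 correlation                                             ≡⟨ ∑-cong 𝔽 as-step ⟩
        ∑[ b ∈ 𝔽 ] j₁ + (+ q - 1ℤ - j₁) * 𝟙 (0# ≟ᶠ b)               ≡⟨ ∑-+ 𝔽 _ _ ⟩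
        (∑[ b ∈ 𝔽 ] j₁) + (∑[ b ∈ 𝔽 ] (+ q - 1ℤ - j₁) * 𝟙 (0# ≟ᶠ b))
          ≡⟨ cong₂ _+_ (∑𝔽-const j₁) (trans (∑-*ˡ 𝔽 (+ q - 1ℤ - j₁) (λ b → 𝟙 (0# ≟ᶠ b)))
               (trans (cong (_*_ (+ q - 1ℤ - j₁)) (∑𝔽-𝟙 0#)) (ℤ.*-identityʳ _))) ⟩
        + q * j₁ + (+ q - 1ℤ - j₁) ∎
      factored : ∀ q j → (q - 1ℤ) * (j + 1ℤ) ≡ q * j + (q - 1ℤ - j)
      factored = solve-∀
      j₁≡-1 : j₁ ≡ -1ℤ
      j₁≡-1 with ℤ.i*j≡0⇒i≡0∨j≡0 (+ q - 1ℤ) (trans (factored (+ q) j₁) (trans (sym total′) total))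
      ... | inj₁ q-1≡0 = contradiction q-1≡0 q-1≢0
      ... | inj₂ j₁+1≡0 = ℤ.i-j≡0⇒i≡j j₁ -1ℤ j₁+1≡0
      final : ∀ q i → -1ℤ + (q - 1ℤ - -1ℤ) * i ≡ q * i - 1ℤ
      final = solve-∀

    -- Reversing c - b into b - c costs a factor χ(-1). This is the origin of `ε`, which collects
    -- one such factor for each pair of squares.
    ∑-χ*χ-reflected : ∀ b → ∑[ c ∈ 𝔽 ] χ c * χ (b − c) ≡ χ (⊖ 1#) * (+ q * 𝟙 (0# ≟ᶠ b) - 1ℤ)
    ∑-χ*χ-reflected b = begin
      ∑[ c ∈ 𝔽 ] χ c * χ (b − c)
        ≡⟨ ∑-cong 𝔽 (λ c → cong (_*_ (χ c)) (trans (χ-cong (negated c)) (χ-* (⊖ 1#) (c − b)))) ⟩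
      ∑[ c ∈ 𝔽 ] χ c * (χ (⊖ 1#) * χ (c − b))
        ≡⟨ ∑-cong 𝔽 (λ c → pull (χ c) (χ (⊖ 1#)) (χ (c − b))) ⟩
      ∑[ c ∈ 𝔽 ] χ (⊖ 1#) * (χ c * χ (c − b))
        ≡⟨ trans (∑-*ˡ 𝔽 (χ (⊖ 1#)) (λ c → χ c * χ (c − b))) (cong (_*_ (χ (⊖ 1#))) (correlation-≡ b)) ⟩
      χ (⊖ 1#) * (+ q * 𝟙 (0# ≟ᶠ b) - 1ℤ) ∎
      where
      open ≡-Reasoning
      negated : ∀ c → b − c ≈ ⊖ 1# · (c − b)
      negated c = R.trans (R.sym (⊖[x−y]≈y−x c b)) (R.sym (-1*x≈-x (c − b)))
      pull : ∀ a b c → a * (b * c) ≡ b * (a * c)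
      pull = solve-∀

    -- The left side is the number of solutions of x² + y² = b, sorted by c = x².
    ∑-[1+χ]*[1+χ]-reflected : ∀ b → ∑[ c ∈ 𝔽 ] (1ℤ + χ c) * (1ℤ + χ (b − c))
                                     ≡ + q + χ (⊖ 1#) * (+ q * 𝟙 (0# ≟ᶠ b) - 1ℤ)
    ∑-[1+χ]*[1+χ]-reflected b = begin
      ∑[ c ∈ 𝔽 ] (1ℤ + χ c) * (1ℤ + χ (b − c))
        ≡⟨ ∑-cong 𝔽 (λ c → expand (χ c) (χ (b − c))) ⟩
      ∑[ c ∈ 𝔽 ] 1ℤ + (χ c + (χ (b − c) + χ c * χ (b − c)))
        ≡⟨ trans (∑-+ 𝔽 _ _) (cong (_+_ (∑ 𝔽 (λ _ → 1ℤ))) (trans (∑-+ 𝔽 _ _)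
             (cong (_+_ (∑ 𝔽 χ)) (∑-+ 𝔽 (λ c → χ (b − c)) (λ c → χ c * χ (b − c)))))) ⟩
      (∑[ c ∈ 𝔽 ] 1ℤ) + (∑ 𝔽 χ + ((∑[ c ∈ 𝔽 ] χ (b − c)) + (∑[ c ∈ 𝔽 ] χ c * χ (b − c))))
        ≡⟨ cong₂ _+_ (trans (∑𝔽-const 1ℤ) (ℤ.*-identityʳ (+ q))) (cong₂ _+_ ∑χ≡0
             (cong₂ _+_ (trans (∑𝔽-reflect b χ χ-cong) ∑χ≡0) (∑-χ*χ-reflected b))) ⟩
      + q + (0ℤ + (0ℤ + j))
        ≡⟨ cong (_+_ (+ q)) (trans (ℤ.+-identityˡ (0ℤ + j)) (ℤ.+-identityˡ j)) ⟩
      + q + j ∎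
      where
      open ≡-Reasoning
      j = χ (⊖ 1#) * (+ q * 𝟙 (0# ≟ᶠ b) - 1ℤ)
      expand : ∀ x y → (1ℤ + x) * (1ℤ + y) ≡ 1ℤ + (x + (y + x * y))
      expand = solve-∀

    -- The conic x² + y² = 1 has q − χ(−1) points: four with x y = 0, and the others come in
    -- quadruples (± x , ± y).
    4∣q-χ[-1] : ∃ λ k → + q - χ (⊖ 1#) ≡ + 4 * k
    4∣q-χ[-1] = 1ℤ + ∑ 𝔽 k , (begin
      + q - χ (⊖ 1#)
        ≡⟨ as-conic (+ q) (χ (⊖ 1#)) ⟩
      + q + χ (⊖ 1#) * (+ q * 0ℤ - 1ℤ)
        ≡⟨ cong (λ i → + q + χ (⊖ 1#) * (+ q * i - 1ℤ)) (𝟙-false (0# ≟ᶠ 1#) (1≉0 ∘ R.sym)) ⟨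
      + q + χ (⊖ 1#) * (+ q * 𝟙 (0# ≟ᶠ 1#) - 1ℤ)
        ≡⟨ ∑-[1+χ]*[1+χ]-reflected 1# ⟨
      ∑[ c ∈ 𝔽 ] (1ℤ + χ c) * (1ℤ + χ (1# − c))
        ≡⟨ ∑-cong 𝔽 quadruples ⟩
      ∑[ c ∈ 𝔽 ] + 2 * (𝟙 (0# ≟ᶠ c) + 𝟙 (1# ≟ᶠ c)) + + 4 * k c
        ≡⟨ ∑-linear 𝔽 (+ 2) (+ 4) (λ c → 𝟙 (0# ≟ᶠ c) + 𝟙 (1# ≟ᶠ c)) k ⟩
      + 2 * (∑[ c ∈ 𝔽 ] 𝟙 (0# ≟ᶠ c) + 𝟙 (1# ≟ᶠ c)) + + 4 * ∑ 𝔽 k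
        ≡⟨ cong (λ s → + 2 * s + + 4 * ∑ 𝔽 k)
             (trans (∑-+ 𝔽 _ _) (cong₂ _+_ (∑𝔽-𝟙 0#) (∑𝔽-𝟙 1#))) ⟩
      + 4 + + 4 * ∑ 𝔽 k
        ≡⟨ collect (∑ 𝔽 k) ⟩
      + 4 * (1ℤ + ∑ 𝔽 k) ∎)
      where
      open ≡-Reasoning
      as-conic : ∀ q x → q - x ≡ q + x * (q * 0ℤ - 1ℤ)
      as-conic = solve-∀
      collect : ∀ k → + 4 + + 4 * k ≡ + 4 * (1ℤ + k)
      collect = solve-∀
      k : Carrier → ℤ
      k c = 𝟙 (χ c ℤ.≟ 1ℤ) * 𝟙 (χ (1# − c) ℤ.≟ 1ℤ)
      1−c≈0⇒1≈c : ∀ {c} → 1# − c ≈ 0# → 1# ≈ c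
      1−c≈0⇒1≈c {c} = x−y≈0⇒x≈y 1# c
      quadruples′ : ∀ c (a b : ℤ) → χ c ≡ a → χ (1# − c) ≡ b → ¬ c ≈ 0# → ¬ 1# − c ≈ 0# →
        (1ℤ + a) * (1ℤ + b) ≡ + 4 * (𝟙 (a ℤ.≟ 1ℤ) * 𝟙 (b ℤ.≟ 1ℤ)) →
        (1ℤ + χ c) * (1ℤ + χ (1# − c)) ≡ + 2 * (𝟙 (0# ≟ᶠ c) + 𝟙 (1# ≟ᶠ c)) + + 4 * k c
      quadruples′ c _ _ refl refl c≉0 1−c≉0 eq = trans eq (trans (sym (ℤ.+-identityˡ _))
        (cong (_+ + 4 * k c) (sym (cong (_*_ (+ 2)) (cong₂ _+_
          (𝟙-false (0# ≟ᶠ c) (c≉0 ∘ R.sym)) (𝟙-false (1# ≟ᶠ c) (1−c≉0 ∘ x≈y⇒x−y≈0)))))))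
      quadruples : ∀ c → (1ℤ + χ c) * (1ℤ + χ (1# − c))
                         ≡ + 2 * (𝟙 (0# ≟ᶠ c) + 𝟙 (1# ≟ᶠ c)) + + 4 * k c
      quadruples c with classify c | classify (1# − c)
      ... | zero c≈0 eq | _
        rewrite eq | 𝟙-true (0# ≟ᶠ c) (R.sym c≈0)
              | 𝟙-false (1# ≟ᶠ c) (λ 1≈c → 1≉0 (R.trans 1≈c c≈0))
              | χ-cong {1# − c} {1#} (R.trans (R.+-congˡ (R.trans (R.-‿cong c≈0) ⊖0≈0)) (R.+-identityʳ 1#))
              | χ-one = refl
      ... | square _ _ _ _ | zero 1−c≈0 eq
        rewrite eq | 𝟙-true (1# ≟ᶠ c) (1−c≈0⇒1≈c 1−c≈0)
              | 𝟙-false (0# ≟ᶠ c) (λ 0≈c → 1≉0 (R.trans (1−c≈0⇒1≈c 1−c≈0) (R.sym 0≈c)))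
              | χ-cong (R.sym (1−c≈0⇒1≈c 1−c≈0)) | χ-one = refl
      ... | nonsquare _ ¬□ _ | zero 1−c≈0 _ =
        contradiction (1# , R.trans (R.*-identityˡ 1#) (1−c≈0⇒1≈c 1−c≈0)) ¬□
      ... | square r r≉0 r²≈c eq | square s s≉0 s²≈ eq′ =
        quadruples′ c 1ℤ 1ℤ eq eq′ (λ c≈0 → r≉0 (x·x≈0⇒x≈0 (R.trans r²≈c c≈0)))
          (λ 1−c≈0 → s≉0 (x·x≈0⇒x≈0 (R.trans s²≈ 1−c≈0))) refl
      ... | square r r≉0 r²≈c eq | nonsquare 1−c≉0 _ eq′ =
        quadruples′ c 1ℤ -1ℤ eq eq′ (λ c≈0 → r≉0 (x·x≈0⇒x≈0 (R.trans r²≈c c≈0))) 1−c≉0 refl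
      ... | nonsquare c≉0 _ eq | square s s≉0 s²≈ eq′ =
        quadruples′ c -1ℤ 1ℤ eq eq′ c≉0 (λ 1−c≈0 → s≉0 (x·x≈0⇒x≈0 (R.trans s²≈ 1−c≈0))) refl
      ... | nonsquare c≉0 _ eq | nonsquare 1−c≉0 _ eq′ =
        quadruples′ c -1ℤ -1ℤ eq eq′ c≉0 1−c≉0 refl

    ⊖1≉0 : ¬ ⊖ 1# ≈ 0#
    ⊖1≉0 eq = 1≉0 (R.trans (R.sym (⊖-involutive 1#)) (R.trans (R.-‿cong eq) ⊖0≈0))

    χ[-1]²≡1 : χ (⊖ 1#) * χ (⊖ 1#) ≡ 1ℤ
    χ[-1]²≡1 = trans (χ-squared (⊖ 1#))
      (cong (_-_ 1ℤ) (𝟙-false (0# ≟ᶠ ⊖ 1#) (⊖1≉0 ∘ R.sym)))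

    -- If χ(-1) were s, then q - χ(-1) would be r - s = 2 modulo 4, while `4∣q-χ[-1]` makes it a
    -- multiple of 4. The pairs (1 , -1) and (3 , 1) for (r , s) rule out the wrong sign in each
    -- residue class.
    χ[-1]≢ : ∀ {r s} → q % 4 ≡ r → + r - s ≡ + 2 → χ (⊖ 1#) ≢ s
    χ[-1]≢ {r} {s} refl r-s≡2 χ≡s = contradiction
      (trans (cong (_% 4) (trans (cong ∣_∣ 2≡4[k-n]) (ℤ.abs-* (k - n) (+ 4)))) (ℕ.m*n%n≡0 ∣ k - n ∣ 4))
      λ ()
      where
      open ≡-Reasoning
      n = + (q ℕ./ 4)
      k = proj₁ 4∣q-χ[-1]
      q≡r+4n : + q ≡ + r + n * + 4
      q≡r+4n = trans (cong +_ (ℕ.m≡m%n+[m/n]*n q 4)) (cong (_+_ (+ r)) (ℤ.pos-* (q ℕ./ 4) 4))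
      regroup : ∀ r s n → r - s ≡ ((r + n * + 4) - s) - n * + 4
      regroup = solve-∀
      factor : ∀ k n → + 4 * k - n * + 4 ≡ (k - n) * + 4
      factor = solve-∀
      2≡4[k-n] : + 2 ≡ (k - n) * + 4
      2≡4[k-n] = begin
        + 2                             ≡⟨ r-s≡2 ⟨
        + r - s                         ≡⟨ regroup (+ r) s n ⟩
        ((+ r + n * + 4) - s) - n * + 4 ≡⟨ cong (_- n * + 4) (cong₂ _-_ q≡r+4n χ≡s) ⟨
        (+ q - χ (⊖ 1#)) - n * + 4      ≡⟨ cong (_- n * + 4) (proj₂ 4∣q-χ[-1]) ⟩
        + 4 * k - n * + 4               ≡⟨ factor k n ⟩
        (k - n) * + 4                   ∎

    χ[-1]≡1 : q % 4 ≡ 1 → χ (⊖ 1#) ≡ 1ℤ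
    χ[-1]≡1 q%4≡1 with classify (⊖ 1#)
    ... | zero ⊖1≈0 _      = contradiction ⊖1≈0 ⊖1≉0
    ... | square _ _ _ eq  = eq
    ... | nonsquare _ _ eq = contradiction eq (χ[-1]≢ q%4≡1 refl)

    χ[-1]≡-1 : q % 4 ≡ 3 → χ (⊖ 1#) ≡ -1ℤ
    χ[-1]≡-1 q%4≡3 with classify (⊖ 1#)
    ... | zero ⊖1≈0 _      = contradiction ⊖1≈0 ⊖1≉0
    ... | square _ _ _ eq  = contradiction eq (χ[-1]≢ q%4≡3 refl)
    ... | nonsquare _ _ eq = eq

-- Quadratic form, bilinear form and summation over the affine space

module PointSums {c ℓ q} (F : FiniteField c ℓ q) (q-odd : q % 2 ≡ 1) where
  open IntegerSums
  open QuadraticCharacter F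
  open OddOrder q-odd
  open import Algebra.Bundles using (CommutativeRing)
  import Algebra.Solver.Ring.NaturalCoefficients.Default as SemiringSolver
  open import Data.Fin.Base using (zero; suc)
  open import Data.Integer.Base using (ℤ; +_; 0ℤ; 1ℤ; _+_; _*_; _≤_; _^_)
  import Data.Integer.Properties as ℤ
  open import Data.List.Base using ([]; _∷_; cartesianProductWith)
  import Data.Vec.Functional as Vec
  import Data.Vec.Functional.Relation.Binary.Equality.Setoid as VectorEquality
  open import Function.Base using (_∘_)
  open import Relation.Binary.PropositionalEquality
    using (refl; sym; trans; cong; module ≡-Reasoning)
  open import Relation.Nullary.Decidable using (Dec; yes; no)
  open import Relation.Nullary.Negation using (¬_; contradiction)

  open FiniteField F using () renaming (commutativeRing to R)
  private module R = CommutativeRing R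
  open R using (Carrier; _≈_; 0#)
    renaming (_+_ to _⊕_; _*_ to _·_; setoid to ≈-setoid)
  open VectorEquality ≈-setoid using (_≋_)
  open import Algebra.Properties.CommutativeMonoid.Sum R.+-commutativeMonoid using (sum; sum-cong-≋)

  -- At a coordinatewise difference this unfolds to `‖ x − y ‖`, so `SQ` can be rewritten with
  -- `norm` without any transport.
  norm : ∀ {d} → Point F d → Carrier
  norm ξ = sum λ i → ξ i · ξ i

  dot : ∀ {d} → Point F d → Point F d → Carrier
  dot ξ z = sum λ i → ξ i · z i

  norm-cong : ∀ {d} {ξ ζ : Point F d} → ξ ≋ ζ → norm ξ ≈ norm ζ
  norm-cong ξ≋ζ = sum-cong-≋ λ i → R.*-cong (ξ≋ζ i) (ξ≋ζ i)

  dot-cong : ∀ {d} {ξ ζ z w : Point F d} → ξ ≋ ζ → z ≋ w → dot ξ z ≈ dot ζ w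
  dot-cong ξ≋ζ z≋w = sum-cong-≋ λ i → R.*-cong (ξ≋ζ i) (z≋w i)

  norm-zero : ∀ {d} {ξ : Point F d} → (∀ i → ξ i ≈ 0#) → norm ξ ≈ 0#
  norm-zero {ℕ.zero}  ξ≈0 = R.refl
  norm-zero {ℕ.suc d} ξ≈0 = R.trans
    (R.+-cong (R.trans (R.*-congʳ (ξ≈0 zero)) (R.zeroˡ _)) (norm-zero (ξ≈0 ∘ suc))) (R.+-identityˡ 0#)

  dot-zeroʳ : ∀ {d} (ξ : Point F d) {z} → (∀ i → z i ≈ 0#) → dot ξ z ≈ 0#
  dot-zeroʳ {ℕ.zero}  ξ z≈0 = R.refl
  dot-zeroʳ {ℕ.suc d} ξ z≈0 = R.trans
    (R.+-cong (R.trans (R.*-congˡ (z≈0 zero)) (R.zeroʳ _)) (dot-zeroʳ (ξ ∘ suc) (z≈0 ∘ suc)))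
    (R.+-identityˡ 0#)

  dot-zeroˡ : ∀ {d} (z : Point F d) → dot (λ _ → 0#) z ≈ 0#
  dot-zeroˡ {ℕ.zero}  z = R.refl
  dot-zeroˡ {ℕ.suc d} z = R.trans (R.+-cong (R.zeroˡ _) (dot-zeroˡ (z ∘ suc))) (R.+-identityˡ 0#)

  dot-⊕ : ∀ {d} (ξ x y : Point F d) → dot ξ (λ i → x i ⊕ y i) ≈ dot ξ x ⊕ dot ξ y
  dot-⊕ {ℕ.zero}  ξ x y = R.sym (R.+-identityˡ 0#)
  dot-⊕ {ℕ.suc d} ξ x y = R.trans (R.+-congˡ (dot-⊕ (ξ ∘ suc) (x ∘ suc) (y ∘ suc)))
    (solve 5 (λ a b c u v → a :* (b :+ c) :+ (u :+ v) := (a :* b :+ u) :+ (a :* c :+ v))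
      R.refl (ξ zero) (x zero) (y zero) _ _)
    where open SemiringSolver R.commutativeSemiring

  -- Writing 2 t as `t ⊕ t` makes each coordinate step an identity of commutative semirings.
  norm-translate : ∀ {d} t (ξ z : Point F d) →
    norm (λ i → ξ i ⊕ t · z i) ≈ (norm ξ ⊕ (t ⊕ t) · dot ξ z) ⊕ norm z · (t · t)
  norm-translate {ℕ.zero}  t ξ z = solve 1
    (λ t → con 0 := con 0 :+ (t :+ t) :* con 0 :+ con 0 :* (t :* t)) R.refl t
    where open SemiringSolver R.commutativeSemiring
  norm-translate {ℕ.suc d} t ξ z = R.trans (R.+-congˡ (norm-translate t (ξ ∘ suc) (z ∘ suc)))
    (solve 6 (λ t x z n s m → (x :+ t :* z) :* (x :+ t :* z) :+ (n :+ (t :+ t) :* s :+ m :* (t :* t))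
        := (x :* x :+ n) :+ (t :+ t) :* (x :* z :+ s) :+ (z :* z :+ m) :* (t :* t))
      R.refl t (ξ zero) (z zero) _ _ _)
    where open SemiringSolver R.commutativeSemiring

  RespectsPoints : ∀ {d} → (Point F d → ℤ) → Set _
  RespectsPoints f = ∀ {ξ ζ} → ξ ≋ ζ → f ξ ≡ f ζ

  points : ∀ d → List (Point F d)
  points ℕ.zero    = Vec.[] ∷ []
  points (ℕ.suc d) = cartesianProductWith Vec._∷_ 𝔽 (points d)

  ∑points-suc : ∀ d (f : Point F (ℕ.suc d) → ℤ) →
    ∑ (points (ℕ.suc d)) f ≡ ∑[ x ∈ 𝔽 ] ∑[ ξ ∈ points d ] f (x Vec.∷ ξ)
  ∑points-suc d f = ∑-cartesianProductWith Vec._∷_ 𝔽 (points d) f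

  ∷-cong : ∀ {d x y} {ξ ζ : Point F d} → x ≈ y → ξ ≋ ζ → (x Vec.∷ ξ) ≋ (y Vec.∷ ζ)
  ∷-cong x≈y ξ≋ζ zero    = x≈y
  ∷-cong x≈y ξ≋ζ (suc i) = ξ≋ζ i

  ∑points-const : ∀ d k → ∑[ ξ ∈ points d ] k ≡ (+ q) ^ d * k
  ∑points-const ℕ.zero    k = trans (ℤ.+-identityʳ k) (sym (ℤ.*-identityˡ k))
  ∑points-const (ℕ.suc d) k = trans (∑points-suc d _) (trans (∑𝔽-const _)
    (trans (cong (_*_ (+ q)) (∑points-const d k)) (sym (ℤ.*-assoc (+ q) ((+ q) ^ d) k))))

  ∑points-translate : ∀ d (v : Point F d) (f : Point F d → ℤ) → RespectsPoints f →
    ∑[ ξ ∈ points d ] f (λ i → ξ i ⊕ v i) ≡ ∑ (points d) f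
  ∑points-translate ℕ.zero    v f f-cong = cong (_+ 0ℤ) (f-cong λ ())
  ∑points-translate (ℕ.suc d) v f f-cong = begin
    ∑[ ξ ∈ points (ℕ.suc d) ] f (λ i → ξ i ⊕ v i)
      ≡⟨ ∑points-suc d _ ⟩
    ∑[ x ∈ 𝔽 ] ∑[ ξ ∈ points d ] f (λ i → (x Vec.∷ ξ) i ⊕ v i)
      ≡⟨ ∑-cong 𝔽 (λ x → ∑-cong (points d) λ ξ → f-cong λ { zero → R.refl ; (suc i) → R.refl }) ⟩
    ∑[ x ∈ 𝔽 ] ∑[ ξ ∈ points d ] f ((x ⊕ v zero) Vec.∷ (λ i → ξ i ⊕ v (suc i)))
      ≡⟨ ∑-cong 𝔽 (λ x → ∑points-translate d (v ∘ suc) (λ ξ → f ((x ⊕ v zero) Vec.∷ ξ))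
           (λ eq → f-cong (∷-cong R.refl eq))) ⟩
    ∑[ x ∈ 𝔽 ] ∑[ ξ ∈ points d ] f ((x ⊕ v zero) Vec.∷ ξ)
      ≡⟨ ∑𝔽-translate (v zero) (λ x → ∑[ ξ ∈ points d ] f (x Vec.∷ ξ))
           (λ eq → ∑-cong (points d) λ ξ → f-cong (∷-cong eq λ i → R.refl)) ⟩
    ∑[ x ∈ 𝔽 ] ∑[ ξ ∈ points d ] f (x Vec.∷ ξ)
      ≡⟨ ∑points-suc d f ⟨
    ∑ (points (ℕ.suc d)) f ∎
    where open ≡-Reasoning

  term≤∑points : ∀ d (f : Point F d → ℤ) → RespectsPoints f → (∀ ξ → 0ℤ ≤ f ξ) →
                 ∀ ζ → f ζ ≤ ∑ (points d) f
  term≤∑points ℕ.zero    f f-cong f≥0 ζ =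
    ℤ.≤-reflexive (trans (f-cong λ ()) (sym (ℤ.+-identityʳ _)))
  term≤∑points (ℕ.suc d) f f-cong f≥0 ζ = begin
    f ζ                                             ≡⟨ f-cong (λ { zero → R.refl ; (suc i) → R.refl }) ⟩
    f (ζ zero Vec.∷ (ζ ∘ suc))
      ≤⟨ term≤∑points d (λ ξ → f (ζ zero Vec.∷ ξ)) (λ eq → f-cong (∷-cong R.refl eq)) (λ ξ → f≥0 _) (ζ ∘ suc) ⟩
    ∑[ ξ ∈ points d ] f (ζ zero Vec.∷ ξ)
      ≤⟨ term≤∑𝔽 (λ x → ∑[ ξ ∈ points d ] f (x Vec.∷ ξ))
           (λ eq → ∑-cong (points d) λ ξ → f-cong (∷-cong eq λ i → R.refl))
           (λ x → ∑-nonneg (points d) λ ξ → f≥0 _) (ζ zero) ⟩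
    ∑[ x ∈ 𝔽 ] ∑[ ξ ∈ points d ] f (x Vec.∷ ξ)      ≡⟨ ∑points-suc d f ⟨
    ∑ (points (ℕ.suc d)) f                          ∎
    where open ℤ.≤-Reasoning

  -- If the first coordinate of `z` vanishes, that of `ξ` is free and contributes a factor q;
  -- otherwise it is determined by the other coordinates. The factor q on the left avoids the
  -- exponent d - 1.
  ∑points-⊥ : ∀ d (z : Point F d) → ¬ (∀ i → z i ≈ 0#) → ∀ u →
              + q * (∑[ ξ ∈ points d ] 𝟙 (u ≟ᶠ dot ξ z)) ≡ (+ q) ^ d
  ∑points-⊥ ℕ.zero    z z≉0 u = contradiction (λ ()) z≉0
  ∑points-⊥ (ℕ.suc d) z z≉0 u = by-head (z zero ≟ᶠ 0#)
    where
    open ≡-Reasoning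
    by-head : Dec (z zero ≈ 0#) →
              + q * (∑[ ξ ∈ points (ℕ.suc d) ] 𝟙 (u ≟ᶠ dot ξ z)) ≡ (+ q) ^ ℕ.suc d
    by-head (yes z₀≈0) = cong (_*_ (+ q)) (begin
      ∑[ ξ ∈ points (ℕ.suc d) ] 𝟙 (u ≟ᶠ dot ξ z)
        ≡⟨ ∑points-suc d _ ⟩
      ∑[ x ∈ 𝔽 ] ∑[ ξ ∈ points d ] 𝟙 (u ≟ᶠ (x · z zero) ⊕ dot ξ (z ∘ suc))
        ≡⟨ ∑-cong 𝔽 (λ x → ∑-cong (points d) λ ξ → 𝟙-≟-cong R.refl (drop x ξ)) ⟩
      ∑[ x ∈ 𝔽 ] ∑[ ξ ∈ points d ] 𝟙 (u ≟ᶠ dot ξ (z ∘ suc))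
        ≡⟨ ∑𝔽-const _ ⟩
      + q * (∑[ ξ ∈ points d ] 𝟙 (u ≟ᶠ dot ξ (z ∘ suc)))
        ≡⟨ ∑points-⊥ d (z ∘ suc) (λ z′≈0 → z≉0 λ { zero → z₀≈0 ; (suc i) → z′≈0 i }) u ⟩
      (+ q) ^ d ∎)
      where
      drop : ∀ x ξ → (x · z zero) ⊕ dot ξ (z ∘ suc) ≈ dot ξ (z ∘ suc)
      drop x ξ = R.trans (R.+-congʳ (R.trans (R.*-congˡ z₀≈0) (R.zeroʳ x))) (R.+-identityˡ _)
    by-head (no z₀≉0) = cong (_*_ (+ q)) (begin
      ∑[ ξ ∈ points (ℕ.suc d) ] 𝟙 (u ≟ᶠ dot ξ z)
        ≡⟨ trans (∑points-suc d _) (∑-swap 𝔽 (points d) _) ⟩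
      ∑[ ξ ∈ points d ] ∑[ x ∈ 𝔽 ] 𝟙 (u ≟ᶠ (x · z zero) ⊕ dot ξ (z ∘ suc))
        ≡⟨ ∑-cong (points d) (λ ξ → one-solution (dot ξ (z ∘ suc))) ⟩
      ∑[ ξ ∈ points d ] 1ℤ
        ≡⟨ trans (∑points-const d 1ℤ) (ℤ.*-identityʳ _) ⟩
      (+ q) ^ d ∎)
      where
      one-solution : ∀ v → ∑[ x ∈ 𝔽 ] 𝟙 (u ≟ᶠ (x · z zero) ⊕ v) ≡ 1ℤ
      one-solution v = begin
        ∑[ x ∈ 𝔽 ] 𝟙 (u ≟ᶠ (x · z zero) ⊕ v)
          ≡⟨ ∑-cong 𝔽 (λ x → 𝟙-≟-cong R.refl (R.+-congʳ (R.*-comm x (z zero)))) ⟩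
        ∑[ x ∈ 𝔽 ] 𝟙 (u ≟ᶠ (z zero · x) ⊕ v)
          ≡⟨ ∑𝔽-scale z₀≉0 (λ x → 𝟙 (u ≟ᶠ x ⊕ v)) (λ x≈y → 𝟙-≟-cong R.refl (R.+-congʳ x≈y)) ⟩
        ∑[ x ∈ 𝔽 ] 𝟙 (u ≟ᶠ x ⊕ v)
          ≡⟨ ∑𝔽-translate v (λ x → 𝟙 (u ≟ᶠ x)) (𝟙-≟-cong R.refl) ⟩
        ∑[ x ∈ 𝔽 ] 𝟙 (u ≟ᶠ x)
          ≡⟨ ∑𝔽-𝟙 u ⟩
        1ℤ ∎

-- Value distribution of the norm, on the space and on hyperplanes

module QuadricCounts {c ℓ q} (F : FiniteField c ℓ q) (q-odd : q % 2 ≡ 1) where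
  open IntegerSums
  open QuadraticCharacter F
  open OddOrder q-odd
  open PointSums F q-odd
  open import Algebra.Bundles using (CommutativeRing)
  import Algebra.Properties.Ring as RingProperties
  open import Data.Integer.Base using (ℤ; +_; 0ℤ; 1ℤ; -1ℤ; _+_; _*_; _-_; -_; _^_)
  import Data.Integer.Properties as ℤ
  open import Data.Integer.Tactic.RingSolver using (solve-∀)
  open import Relation.Binary.PropositionalEquality
    using (refl; sym; trans; cong; cong₂; module ≡-Reasoning)
  open import Relation.Nullary.Decidable using (Dec; yes; no)
  open import Relation.Nullary.Negation using (¬_)

  open FiniteField F using () renaming (commutativeRing to R)
  private module R = CommutativeRing R
  open R using (Carrier; _≈_; 0#; 1#)
    renaming (_+_ to _⊕_; -_ to ⊖_; _*_ to _·_; _-_ to _−_)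
  open RingProperties R.ring using (-0#≈0#)
    renaming ( //-rightDividesʳ to x⊕y−y≈x
             ; x∙y⁻¹≈ε⇒x≈y to x−y≈0⇒x≈y; x≈y⇒x∙y⁻¹≈ε to x≈y⇒x−y≈0)

  -- The form x² + y² takes every value q - χ(-1) times, and the value 0 another q χ(-1) times.
  ∑∑-two-squares : ∀ (h : Carrier → ℤ) → Respects h →
    ∑[ x ∈ 𝔽 ] ∑[ y ∈ 𝔽 ] h (x · x ⊕ y · y)
    ≡ (+ q - χ (⊖ 1#)) * ∑ 𝔽 h + + q * χ (⊖ 1#) * h 0#
  ∑∑-two-squares h h-cong = begin
    ∑[ x ∈ 𝔽 ] ∑[ y ∈ 𝔽 ] h (x · x ⊕ y · y)
      ≡⟨ ∑-cong 𝔽 (λ x → ∑𝔽-squares (λ v → h (x · x ⊕ v)) (λ eq → h-cong (R.+-congˡ eq))) ⟩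
    ∑[ x ∈ 𝔽 ] ∑[ v ∈ 𝔽 ] (1ℤ + χ v) * h (x · x ⊕ v)
      ≡⟨ ∑𝔽-squares (λ u → ∑[ v ∈ 𝔽 ] (1ℤ + χ v) * h (u ⊕ v))
           (λ eq → ∑-cong 𝔽 λ v → cong (_*_ (1ℤ + χ v)) (h-cong (R.+-congʳ eq))) ⟩
    ∑[ u ∈ 𝔽 ] (1ℤ + χ u) * (∑[ v ∈ 𝔽 ] (1ℤ + χ v) * h (u ⊕ v))
      ≡⟨ ∑-cong 𝔽 (λ u → cong (_*_ (1ℤ + χ u)) (recentre u)) ⟩
    ∑[ u ∈ 𝔽 ] (1ℤ + χ u) * (∑[ b ∈ 𝔽 ] (1ℤ + χ (b − u)) * h b)
      ≡⟨ ∑-cong 𝔽 (λ u → sym (∑-*ˡ 𝔽 (1ℤ + χ u) (λ b → (1ℤ + χ (b − u)) * h b))) ⟩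
    ∑[ u ∈ 𝔽 ] ∑[ b ∈ 𝔽 ] (1ℤ + χ u) * ((1ℤ + χ (b − u)) * h b)
      ≡⟨ ∑-swap 𝔽 𝔽 (λ u b → (1ℤ + χ u) * ((1ℤ + χ (b − u)) * h b)) ⟩
    ∑[ b ∈ 𝔽 ] ∑[ u ∈ 𝔽 ] (1ℤ + χ u) * ((1ℤ + χ (b − u)) * h b)
      ≡⟨ ∑-cong 𝔽 (λ b → trans (∑-cong 𝔽 λ u → sym (ℤ.*-assoc (1ℤ + χ u) (1ℤ + χ (b − u)) (h b)))
           (∑-*ʳ 𝔽 (h b) (λ u → (1ℤ + χ u) * (1ℤ + χ (b − u))))) ⟩
    ∑[ b ∈ 𝔽 ] (∑[ u ∈ 𝔽 ] (1ℤ + χ u) * (1ℤ + χ (b − u))) * h b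
      ≡⟨ ∑-cong 𝔽 (λ b → trans (cong (_* h b) (∑-[1+χ]*[1+χ]-reflected b))
           (regroup (+ q) (χ (⊖ 1#)) (𝟙 (0# ≟ᶠ b)) (h b))) ⟩
    ∑[ b ∈ 𝔽 ] (+ q - χ (⊖ 1#)) * h b + + q * χ (⊖ 1#) * (𝟙 (0# ≟ᶠ b) * h b)
      ≡⟨ ∑-linear 𝔽 (+ q - χ (⊖ 1#)) (+ q * χ (⊖ 1#)) h (λ b → 𝟙 (0# ≟ᶠ b) * h b) ⟩
    (+ q - χ (⊖ 1#)) * ∑ 𝔽 h + + q * χ (⊖ 1#) * (∑[ b ∈ 𝔽 ] 𝟙 (0# ≟ᶠ b) * h b)
      ≡⟨ cong (λ s → (+ q - χ (⊖ 1#)) * ∑ 𝔽 h + + q * χ (⊖ 1#) * s) (∑𝔽-select 0# h h-cong) ⟩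
    (+ q - χ (⊖ 1#)) * ∑ 𝔽 h + + q * χ (⊖ 1#) * h 0# ∎
    where
    open ≡-Reasoning
    regroup : ∀ q x i h → (q + x * (q * i - 1ℤ)) * h ≡ (q - x) * h + q * x * (i * h)
    regroup = solve-∀
    recentre : ∀ u → ∑[ v ∈ 𝔽 ] (1ℤ + χ v) * h (u ⊕ v) ≡ ∑[ b ∈ 𝔽 ] (1ℤ + χ (b − u)) * h b
    recentre u = trans
      (∑-cong 𝔽 λ v → cong₂ (λ i j → (1ℤ + i) * j)
        (χ-cong (R.sym (x⊕y−y≈x u v))) (h-cong (R.+-comm u v)))
      (∑𝔽-translate u (λ b → (1ℤ + χ (b − u)) * h b)
        (λ eq → cong₂ (λ i j → (1ℤ + i) * j) (χ-cong (R.+-congʳ eq)) (h-cong eq)))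

  Q : ℕ → ℤ
  Q m = (+ q) ^ m

  ε : ℕ → ℤ
  ε m = χ (⊖ 1#) ^ m

  -- In dimension 2m + 1 the norm takes the value b exactly Q² + ε Q χ(b) times. The induction
  -- splits off two squares: the uniform part of their distribution kills the `χ` term, as ∑ χ = 0,
  -- and their excess at 0 carries it on with the factor q χ(-1). The equation for `d` lets a
  -- dimension not of the literal form `suc (m * 2)` be used.
  ∑points-norm : ∀ {d} m → d ≡ suc (m ℕ.* 2) → (g : Carrier → ℤ) → Respects g →
    ∑[ ξ ∈ points d ] g (norm ξ)
    ≡ (Q m * Q m) * ∑ 𝔽 g + (ε m * Q m) * (∑[ b ∈ 𝔽 ] χ b * g b)
  ∑points-norm zero refl g g-cong = begin
    ∑[ ξ ∈ points 1 ] g (norm ξ)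
      ≡⟨ trans (∑points-suc 0 (λ ξ → g (norm ξ))) (∑-cong 𝔽 λ x → ℤ.+-identityʳ _) ⟩
    ∑[ x ∈ 𝔽 ] g (x · x ⊕ 0#)
      ≡⟨ ∑-cong 𝔽 (λ x → g-cong (R.+-identityʳ (x · x))) ⟩
    ∑[ x ∈ 𝔽 ] g (x · x)
      ≡⟨ ∑𝔽-squares g g-cong ⟩
    ∑[ b ∈ 𝔽 ] (1ℤ + χ b) * g b
      ≡⟨ ∑-cong 𝔽 (λ b → expand (χ b) (g b)) ⟩
    ∑[ b ∈ 𝔽 ] 1ℤ * 1ℤ * g b + 1ℤ * 1ℤ * (χ b * g b)
      ≡⟨ ∑-linear 𝔽 (1ℤ * 1ℤ) (1ℤ * 1ℤ) g (λ b → χ b * g b) ⟩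
    (1ℤ * 1ℤ) * ∑ 𝔽 g + (1ℤ * 1ℤ) * (∑[ b ∈ 𝔽 ] χ b * g b) ∎
    where
    open ≡-Reasoning
    expand : ∀ x g → (1ℤ + x) * g ≡ 1ℤ * 1ℤ * g + 1ℤ * 1ℤ * (x * g)
    expand = solve-∀
  ∑points-norm (suc m) refl g g-cong = begin
    ∑[ ξ ∈ points (suc (suc (suc (m ℕ.* 2)))) ] g (norm ξ)
      ≡⟨ trans (∑points-suc _ (λ ξ → g (norm ξ))) (∑-cong 𝔽 λ x → ∑points-suc _ _) ⟩
    ∑[ x ∈ 𝔽 ] ∑[ y ∈ 𝔽 ] ∑[ ξ ∈ points (suc (m ℕ.* 2)) ] g (x · x ⊕ (y · y ⊕ norm ξ))
      ≡⟨ ∑-cong 𝔽 (λ x → ∑-cong 𝔽 λ y → trans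
           (∑-cong (points (suc (m ℕ.* 2))) λ ξ → g-cong (R.sym (R.+-assoc (x · x) (y · y) (norm ξ))))
           (∑points-norm m refl (λ b → g ((x · x ⊕ y · y) ⊕ b)) (λ eq → g-cong (R.+-congˡ eq)))) ⟩
    ∑[ x ∈ 𝔽 ] ∑[ y ∈ 𝔽 ] h (x · x ⊕ y · y)
      ≡⟨ ∑∑-two-squares h h-cong ⟩
    (+ q - χ (⊖ 1#)) * ∑ 𝔽 h + + q * χ (⊖ 1#) * h 0#
      ≡⟨ cong₂ (λ s t → (+ q - χ (⊖ 1#)) * s + + q * χ (⊖ 1#) * t) ∑h h0 ⟩
    (+ q - χ (⊖ 1#)) * (P * (+ q * G) + K * 0ℤ) + + q * χ (⊖ 1#) * (P * G + K * X)
      ≡⟨ final (+ q) (χ (⊖ 1#)) (Q m) (ε m) G X ⟩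
    (Q (suc m) * Q (suc m)) * G + (ε (suc m) * Q (suc m)) * X ∎
    where
    open ≡-Reasoning
    P = Q m * Q m
    K = ε m * Q m
    G = ∑ 𝔽 g
    X = ∑[ b ∈ 𝔽 ] χ b * g b
    h : Carrier → ℤ
    h u = P * (∑[ b ∈ 𝔽 ] g (u ⊕ b)) + K * (∑[ b ∈ 𝔽 ] χ b * g (u ⊕ b))
    h-cong : Respects h
    h-cong eq = cong₂ (λ s t → P * s + K * t)
      (∑-cong 𝔽 λ b → g-cong (R.+-congʳ eq))
      (∑-cong 𝔽 λ b → cong (_*_ (χ b)) (g-cong (R.+-congʳ eq)))
    translated : ∀ b → ∑[ u ∈ 𝔽 ] g (u ⊕ b) ≡ G
    translated b = ∑𝔽-translate b g g-cong
    ∑h : ∑ 𝔽 h ≡ P * (+ q * G) + K * 0ℤ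
    ∑h = begin
      ∑ 𝔽 h
        ≡⟨ ∑-linear 𝔽 P K (λ u → ∑[ b ∈ 𝔽 ] g (u ⊕ b)) (λ u → ∑[ b ∈ 𝔽 ] χ b * g (u ⊕ b)) ⟩
      P * (∑[ u ∈ 𝔽 ] ∑[ b ∈ 𝔽 ] g (u ⊕ b)) + K * (∑[ u ∈ 𝔽 ] ∑[ b ∈ 𝔽 ] χ b * g (u ⊕ b))
        ≡⟨ cong₂ (λ s t → P * s + K * t)
             (trans (∑-swap 𝔽 𝔽 (λ u b → g (u ⊕ b))) (trans (∑-cong 𝔽 translated) (∑𝔽-const G)))
             (trans (∑-swap 𝔽 𝔽 (λ u b → χ b * g (u ⊕ b))) (trans
               (∑-cong 𝔽 λ b → trans (∑-*ˡ 𝔽 (χ b) (λ u → g (u ⊕ b))) (cong (_*_ (χ b)) (translated b)))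
               (trans (∑-*ʳ 𝔽 G χ) (trans (cong (_* G) ∑χ≡0) (ℤ.*-zeroˡ G))))) ⟩
      P * (+ q * G) + K * 0ℤ ∎
    h0 : h 0# ≡ P * G + K * X
    h0 = cong₂ (λ s t → P * s + K * t)
      (∑-cong 𝔽 λ b → g-cong (R.+-identityˡ b))
      (∑-cong 𝔽 λ b → cong (_*_ (χ b)) (g-cong (R.+-identityˡ b)))
    final : ∀ q x Q e G X →
      (q - x) * ((Q * Q) * (q * G) + (e * Q) * 0ℤ) + q * x * ((Q * Q) * G + (e * Q) * X)
      ≡ ((q * Q) * (q * Q)) * G + ((x * e) * (q * Q)) * X
    final = solve-∀

  -- For s ≠ 0 the map from t to b + 2 t s is a bijection, since 2 ≠ 0. One formula with an
  -- indicator serves both slopes, so that it can be summed over ξ linearly.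
  ∑𝔽-affine : ∀ (g : Carrier → ℤ) → Respects g → ∀ b s →
    ∑[ t ∈ 𝔽 ] g (b ⊕ (t ⊕ t) · s) ≡ 𝟙 (0# ≟ᶠ s) * (+ q * g b - ∑ 𝔽 g) + ∑ 𝔽 g
  ∑𝔽-affine g g-cong b s = by-slope (0# ≟ᶠ s)
    where
    open ≡-Reasoning
    by-slope : (P : Dec (0# ≈ s)) →
      ∑[ t ∈ 𝔽 ] g (b ⊕ (t ⊕ t) · s) ≡ 𝟙 P * (+ q * g b - ∑ 𝔽 g) + ∑ 𝔽 g
    by-slope (yes 0≈s) = begin
      ∑[ t ∈ 𝔽 ] g (b ⊕ (t ⊕ t) · s)
        ≡⟨ ∑-cong 𝔽 (λ t → g-cong (R.trans (R.+-congˡ (R.trans (R.*-congˡ (R.sym 0≈s)) (R.zeroʳ _)))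
             (R.+-identityʳ b))) ⟩
      ∑[ t ∈ 𝔽 ] g b               ≡⟨ ∑𝔽-const (g b) ⟩
      + q * g b                    ≡⟨ cancel (+ q * g b) (∑ 𝔽 g) ⟩
      1ℤ * (+ q * g b - ∑ 𝔽 g) + ∑ 𝔽 g ∎
      where
      cancel : ∀ x G → x ≡ 1ℤ * (x - G) + G
      cancel = solve-∀
    by-slope (no 0≉s) = begin
      ∑[ t ∈ 𝔽 ] g (b ⊕ (t ⊕ t) · s)      ≡⟨ ∑-cong 𝔽 (λ t → g-cong (R.trans (R.+-comm b _) (R.+-congʳ (rate t)))) ⟩
      ∑[ t ∈ 𝔽 ] g (((1# ⊕ 1#) · s) · t ⊕ b)
        ≡⟨ ∑𝔽-scale (x·y≉0 2≉0 (λ s≈0 → 0≉s (R.sym s≈0))) (λ t → g (t ⊕ b)) (λ eq → g-cong (R.+-congʳ eq)) ⟩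
      ∑[ t ∈ 𝔽 ] g (t ⊕ b)                ≡⟨ ∑𝔽-translate b g g-cong ⟩
      ∑ 𝔽 g                               ≡⟨ trans (cong (_+ ∑ 𝔽 g) (ℤ.*-zeroˡ (+ q * g b - ∑ 𝔽 g))) (ℤ.+-identityˡ _) ⟨
      0ℤ * (+ q * g b - ∑ 𝔽 g) + ∑ 𝔽 g    ∎
      where
      rate : ∀ t → (t ⊕ t) · s ≈ ((1# ⊕ 1#) · s) · t
      rate t = solve 2 (λ t s → (t :+ t) :* s := ((con 1 :+ con 1) :* s) :* t) R.refl t s
        where
        open import Algebra.Solver.Ring.NaturalCoefficients.Default R.commutativeSemiring

  -- Translating ξ by t z turns ‖ξ‖ − ‖z‖ t² into ‖ξ‖ + 2 t (ξ · z), which for fixed ξ is either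
  -- constant in t or runs once through the field.
  ∑∑-norm-shift : ∀ d (z : Point F d) (g : Carrier → ℤ) → Respects g →
    ∑[ t ∈ 𝔽 ] ∑[ ξ ∈ points d ] g (norm ξ − norm z · (t · t))
    ≡ ∑[ ξ ∈ points d ] 𝟙 (0# ≟ᶠ dot ξ z) * (+ q * g (norm ξ) - ∑ 𝔽 g) + ∑ 𝔽 g
  ∑∑-norm-shift d z g g-cong = begin
    ∑[ t ∈ 𝔽 ] ∑[ ξ ∈ points d ] g (norm ξ − norm z · (t · t))
      ≡⟨ ∑-cong 𝔽 (λ t → ∑points-translate d (λ i → t · z i) (λ ξ → g (norm ξ − norm z · (t · t)))
           (λ eq → g-cong (R.+-congʳ (norm-cong eq)))) ⟨
    ∑[ t ∈ 𝔽 ] ∑[ ξ ∈ points d ] g (norm (λ i → ξ i ⊕ t · z i) − norm z · (t · t))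
      ≡⟨ ∑-cong 𝔽 (λ t → ∑-cong (points d) λ ξ → g-cong
           (R.trans (R.+-congʳ (norm-translate t ξ z)) (x⊕y−y≈x (norm z · (t · t)) _))) ⟩
    ∑[ t ∈ 𝔽 ] ∑[ ξ ∈ points d ] g (norm ξ ⊕ (t ⊕ t) · dot ξ z)
      ≡⟨ ∑-swap 𝔽 (points d) (λ t ξ → g (norm ξ ⊕ (t ⊕ t) · dot ξ z)) ⟩
    ∑[ ξ ∈ points d ] ∑[ t ∈ 𝔽 ] g (norm ξ ⊕ (t ⊕ t) · dot ξ z)
      ≡⟨ ∑-cong (points d) (λ ξ → ∑𝔽-affine g g-cong (norm ξ) (dot ξ z)) ⟩
    ∑[ ξ ∈ points d ] 𝟙 (0# ≟ᶠ dot ξ z) * (+ q * g (norm ξ) - ∑ 𝔽 g) + ∑ 𝔽 g ∎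
    where open ≡-Reasoning

  -- For `a` equal to `norm z` this is the double sum of `∑∑-norm-shift`, evaluated instead from the
  -- distribution of `norm`. Translation removes t from the unweighted term, so `a` survives only
  -- next to `χ`.
  ∑∑-norm-count : ∀ {d} m → d ≡ suc (m ℕ.* 2) → (a : Carrier) (g : Carrier → ℤ) → Respects g →
    ∑[ t ∈ 𝔽 ] ∑[ ξ ∈ points d ] g (norm ξ − a · (t · t))
    ≡ (Q m * Q m) * (+ q * ∑ 𝔽 g) + (ε m * Q m) * (∑[ t ∈ 𝔽 ] ∑[ b ∈ 𝔽 ] χ b * g (b − a · (t · t)))
  ∑∑-norm-count {d} m d≡ a g g-cong = begin
    ∑[ t ∈ 𝔽 ] ∑[ ξ ∈ points d ] g (norm ξ − a · (t · t))
      ≡⟨ ∑-cong 𝔽 (λ t → ∑points-norm m d≡ (λ b → g (b − a · (t · t))) (λ eq → g-cong (R.+-congʳ eq))) ⟩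
    ∑[ t ∈ 𝔽 ] (Q m * Q m) * (∑[ b ∈ 𝔽 ] g (b − a · (t · t)))
               + (ε m * Q m) * (∑[ b ∈ 𝔽 ] χ b * g (b − a · (t · t)))
      ≡⟨ ∑-linear 𝔽 (Q m * Q m) (ε m * Q m) (λ t → ∑[ b ∈ 𝔽 ] g (b − a · (t · t)))
           (λ t → ∑[ b ∈ 𝔽 ] χ b * g (b − a · (t · t))) ⟩
    (Q m * Q m) * (∑[ t ∈ 𝔽 ] ∑[ b ∈ 𝔽 ] g (b − a · (t · t))) + (ε m * Q m) * T
      ≡⟨ cong (λ s → (Q m * Q m) * s + (ε m * Q m) * T)
           (trans (∑-cong 𝔽 λ t → ∑𝔽-translate (⊖ (a · (t · t))) g g-cong) (∑𝔽-const (∑ 𝔽 g))) ⟩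
    (Q m * Q m) * (+ q * ∑ 𝔽 g) + (ε m * Q m) * T ∎
    where
    open ≡-Reasoning
    T = ∑[ t ∈ 𝔽 ] ∑[ b ∈ 𝔽 ] χ b * g (b − a · (t · t))

  ∑χ*χ : ∑[ b ∈ 𝔽 ] χ b * χ b ≡ + q - 1ℤ
  ∑χ*χ = trans
    (∑-cong 𝔽 λ b → cong (_*_ (χ b)) (χ-cong (R.sym (R.trans (R.+-congˡ -0#≈0#) (R.+-identityʳ b)))))
    (correlation-0 {0#} R.refl)

  ∑χ*𝟙 : ∀ v → ∑[ b ∈ 𝔽 ] χ b * 𝟙 (0# ≟ᶠ b − v) ≡ χ v
  ∑χ*𝟙 v = trans
    (∑-cong 𝔽 λ b → trans (ℤ.*-comm (χ b) (𝟙 (0# ≟ᶠ b − v))) (cong (_* χ b)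
      (𝟙-cong (0# ≟ᶠ b − v) (v ≟ᶠ b) (λ eq → R.sym (x−y≈0⇒x≈y b v (R.sym eq)))
        (λ eq → R.sym (x≈y⇒x−y≈0 (R.sym eq))))))
    (∑𝔽-select v χ χ-cong)

  ∑𝟙[0≡_] : ∀ a → ∑[ t ∈ 𝔽 ] 𝟙 (0# ≟ᶠ a · (t · t)) ≡ (+ q - 1ℤ) * 𝟙 (0# ≟ᶠ a) + 1ℤ
  ∑𝟙[0≡ a ] = by-zero (0# ≟ᶠ a)
    where
    degenerate : ∀ q → q * 1ℤ ≡ (q - 1ℤ) * 1ℤ + 1ℤ
    degenerate = solve-∀
    regular : ∀ q → 1ℤ ≡ (q - 1ℤ) * 0ℤ + 1ℤ
    regular = solve-∀
    by-zero : (P : Dec (0# ≈ a)) →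
              ∑[ t ∈ 𝔽 ] 𝟙 (0# ≟ᶠ a · (t · t)) ≡ (+ q - 1ℤ) * 𝟙 P + 1ℤ
    by-zero (yes 0≈a) = trans
      (∑-cong 𝔽 λ t → 𝟙-true (0# ≟ᶠ a · (t · t))
        (R.trans (R.sym (R.zeroˡ (t · t))) (R.*-congʳ 0≈a)))
      (trans (∑𝔽-const 1ℤ) (degenerate (+ q)))
    by-zero (no 0≉a) = trans
      (∑-cong 𝔽 λ t → 𝟙-cong (0# ≟ᶠ a · (t · t)) (0# ≟ᶠ t)
        (λ eq → R.sym (x·x≈0⇒x≈0 (x·y≈0⇒y≈0 (λ a≈0 → 0≉a (R.sym a≈0)) (R.sym eq))))
        (λ 0≈t → R.sym (R.trans (R.*-congˡ (R.trans (R.*-congʳ (R.sym 0≈t)) (R.zeroˡ t))) (R.zeroʳ a))))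
      (trans (∑𝔽-𝟙 0#) (regular (+ q)))

  isotropic : ∀ {d} → Point F d → ℤ
  isotropic ξ = 𝟙 (0# ≟ᶠ norm ξ)

  orthogonal : ∀ {d} → Point F d → Point F d → ℤ
  orthogonal ξ z = 𝟙 (0# ≟ᶠ dot ξ z)

  q^[2m+1] : ∀ {d} m → d ≡ suc (m ℕ.* 2) → (+ q) ^ d ≡ + q * (Q m * Q m)
  q^[2m+1] zero    refl = refl
  q^[2m+1] (suc m) refl = trans (cong (λ s → + q * (+ q * s)) (q^[2m+1] m refl)) (regroup (+ q) (Q m))
    where
    regroup : ∀ q Q → q * (q * (q * (Q * Q))) ≡ q * ((q * Q) * (q * Q))
    regroup = solve-∀

  ∑-orthogonal-zero : ∀ {d} m → d ≡ suc (m ℕ.* 2) → (z : Point F d) → (∀ i → z i ≈ 0#) →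
    ∑[ ξ ∈ points d ] (+ q * orthogonal ξ z - 1ℤ) ≡ + q * (Q m * Q m) * (+ q - 1ℤ)
  ∑-orthogonal-zero {d} m d≡ z z≈0 = trans
    (∑-cong (points d) λ ξ → trans
      (cong (λ i → + q * i - 1ℤ) (𝟙-true (0# ≟ᶠ dot ξ z) (R.sym (dot-zeroʳ ξ z≈0))))
      (cong (_- 1ℤ) (ℤ.*-identityʳ (+ q))))
    (trans (∑points-const d (+ q - 1ℤ)) (cong (_* (+ q - 1ℤ)) (q^[2m+1] m d≡)))

  -- Orthogonality of characters after grouping by punctured lines: a hyperplane through 0 contains
  -- exactly one q-th of all points.
  ∑-orthogonal-nonzero : ∀ d (z : Point F d) → ¬ (∀ i → z i ≈ 0#) →
    ∑[ ξ ∈ points d ] (+ q * orthogonal ξ z - 1ℤ) ≡ 0ℤ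
  ∑-orthogonal-nonzero d z z≉0 = begin
    ∑[ ξ ∈ points d ] (+ q * orthogonal ξ z - 1ℤ)
      ≡⟨ ∑-+ (points d) (λ ξ → + q * orthogonal ξ z) (λ _ → - 1ℤ) ⟩
    (∑[ ξ ∈ points d ] + q * orthogonal ξ z) + (∑[ ξ ∈ points d ] - 1ℤ)
      ≡⟨ cong₂ _+_ (trans (∑-*ˡ (points d) (+ q) (λ ξ → orthogonal ξ z)) (∑points-⊥ d z z≉0 0#))
           (∑points-const d (- 1ℤ)) ⟩
    (+ q) ^ d + (+ q) ^ d * - 1ℤ
      ≡⟨ cancel ((+ q) ^ d) ⟩
    0ℤ ∎
    where
    open ≡-Reasoning
    cancel : ∀ x → x + x * - 1ℤ ≡ 0ℤ
    cancel = solve-∀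

  module _ {d} (m : ℕ) (d≡ : d ≡ suc (m ℕ.* 2)) (z : Point F d) where
    -- Fourier inversion for η‖z‖. Dividing q^d = q Q² by the factor ε Q of the eigenvalue leaves ε
    -- Q q, and grouping by punctured lines contributes q - 1.
    ∑-isotropic-orthogonal : ∑[ ξ ∈ points d ] (+ q * isotropic ξ - 1ℤ) * (+ q * orthogonal ξ z - 1ℤ)
                             ≡ (ε m * Q m) * (+ q * (+ q - 1ℤ) * χ (norm z))
    ∑-isotropic-orthogonal = begin
      ∑[ ξ ∈ points d ] (+ q * isotropic ξ - 1ℤ) * (+ q * orthogonal ξ z - 1ℤ)
        -- The part multiplied by q is the summand of `∑∑-norm-shift` for the indicator of 0, whose
        -- total over the field is 1; the remaining part does not involve `z`.
        ≡⟨ ∑-cong (points d) (λ ξ → split (+ q) (isotropic ξ) (orthogonal ξ z)) ⟩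
      ∑[ ξ ∈ points d ] + q * (orthogonal ξ z * (+ q * isotropic ξ - 1ℤ) + 1ℤ)
                        + 1ℤ * (- + q * isotropic ξ + (1ℤ - + q) * 1ℤ)
        ≡⟨ ∑-linear (points d) (+ q) 1ℤ (λ ξ → orthogonal ξ z * (+ q * isotropic ξ - 1ℤ) + 1ℤ)
             (λ ξ → - + q * isotropic ξ + (1ℤ - + q) * 1ℤ) ⟩
      + q * (∑[ ξ ∈ points d ] orthogonal ξ z * (+ q * isotropic ξ - 1ℤ) + 1ℤ)
        + 1ℤ * (∑[ ξ ∈ points d ] - + q * isotropic ξ + (1ℤ - + q) * 1ℤ)
        ≡⟨ cong₂ (λ s t → + q * s + 1ℤ * t) shifted (trans
             (∑-linear (points d) (- + q) (1ℤ - + q) isotropic (λ _ → 1ℤ))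
             (cong₂ (λ s t → - + q * s + (1ℤ - + q) * t) ∑-isotropic
               (trans (∑points-const d 1ℤ) (trans (ℤ.*-identityʳ _) (q^[2m+1] m d≡))))) ⟩
      + q * ((Q m * Q m) * (+ q * 1ℤ) + (ε m * Q m) * (χ (norm z) * (+ q - 1ℤ)))
        + 1ℤ * (- + q * ((Q m * Q m) * 1ℤ + (ε m * Q m) * 0ℤ) + (1ℤ - + q) * (+ q * (Q m * Q m)))
        ≡⟨ final (+ q) (Q m) (ε m) (χ (norm z)) ⟩
      (ε m * Q m) * (+ q * (+ q - 1ℤ) * χ (norm z)) ∎
      where
      open ≡-Reasoning
      split : ∀ q i o → (q * i - 1ℤ) * (q * o - 1ℤ)
              ≡ q * (o * (q * i - 1ℤ) + 1ℤ) + 1ℤ * (- q * i + (1ℤ - q) * 1ℤ)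
      split = solve-∀
      final : ∀ q Q e x →
        q * ((Q * Q) * (q * 1ℤ) + (e * Q) * (x * (q - 1ℤ)))
        + 1ℤ * (- q * ((Q * Q) * 1ℤ + (e * Q) * 0ℤ) + (1ℤ - q) * (q * (Q * Q)))
        ≡ (e * Q) * (q * (q - 1ℤ) * x)
      final = solve-∀
      g : Carrier → ℤ
      g b = 𝟙 (0# ≟ᶠ b)
      g-cong : Respects g
      g-cong = 𝟙-≟-cong R.refl
      ∑-isotropic : ∑ (points d) isotropic ≡ (Q m * Q m) * 1ℤ + (ε m * Q m) * 0ℤ
      ∑-isotropic = trans (∑points-norm m d≡ g g-cong) (cong₂ (λ s t → (Q m * Q m) * s + (ε m * Q m) * t)
        (∑𝔽-𝟙 0#)
        (trans (∑-cong 𝔽 λ b → ℤ.*-comm (χ b) (g b)) (trans (∑𝔽-select 0# χ χ-cong) (χ-zero R.refl))))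
      χ[at²] : ∀ t → χ (norm z · (t · t)) ≡ χ (norm z) * (1ℤ - 𝟙 (0# ≟ᶠ t))
      χ[at²] t = trans (χ-* (norm z) (t · t)) (cong (_*_ (χ (norm z))) (trans (χ-* t t) (χ-squared t)))
      nonzero : ∑[ t ∈ 𝔽 ] (1ℤ - 𝟙 (0# ≟ᶠ t)) ≡ + q - 1ℤ
      nonzero = trans (∑-cong 𝔽 λ t → sym (χ-squared t)) ∑χ*χ
      shifted : ∑[ ξ ∈ points d ] orthogonal ξ z * (+ q * isotropic ξ - 1ℤ) + 1ℤ
                ≡ (Q m * Q m) * (+ q * 1ℤ) + (ε m * Q m) * (χ (norm z) * (+ q - 1ℤ))
      shifted = begin
        ∑[ ξ ∈ points d ] orthogonal ξ z * (+ q * isotropic ξ - 1ℤ) + 1ℤ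
          ≡⟨ ∑-cong (points d) (λ ξ → cong (λ s → orthogonal ξ z * (+ q * isotropic ξ - s) + s) (∑𝔽-𝟙 0#)) ⟨
        ∑[ ξ ∈ points d ] orthogonal ξ z * (+ q * isotropic ξ - ∑ 𝔽 g) + ∑ 𝔽 g
          ≡⟨ ∑∑-norm-shift d z g g-cong ⟨
        ∑[ t ∈ 𝔽 ] ∑[ ξ ∈ points d ] g (norm ξ − norm z · (t · t))
          ≡⟨ ∑∑-norm-count m d≡ (norm z) g g-cong ⟩
        (Q m * Q m) * (+ q * ∑ 𝔽 g) + (ε m * Q m) * (∑[ t ∈ 𝔽 ] ∑[ b ∈ 𝔽 ] χ b * g (b − norm z · (t · t)))
          ≡⟨ cong₂ (λ s t → (Q m * Q m) * (+ q * s) + (ε m * Q m) * t) (∑𝔽-𝟙 0#)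
               (trans (∑-cong 𝔽 λ t → trans (∑χ*𝟙 (norm z · (t · t))) (χ[at²] t))
                 (trans (∑-*ˡ 𝔽 (χ (norm z)) (λ t → 1ℤ - 𝟙 (0# ≟ᶠ t))) (cong (_*_ (χ (norm z))) nonzero))) ⟩
        (Q m * Q m) * (+ q * 1ℤ) + (ε m * Q m) * (χ (norm z) * (+ q - 1ℤ)) ∎

    -- The dual identity: the transform of `χ ∘ norm` is a multiple of the centred indicator of
    -- isotropy. The count now runs through `correlation` at `norm z · (t · t)`, which detects
    -- whether `norm z` or t is zero.
    ∑-χ-orthogonal : ∑[ ξ ∈ points d ] χ (norm ξ) * (+ q * orthogonal ξ z - 1ℤ)
                     ≡ (ε m * Q m) * ((+ q - 1ℤ) * (+ q * 𝟙 (0# ≟ᶠ norm z) - 1ℤ))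
    ∑-χ-orthogonal = begin
      ∑[ ξ ∈ points d ] χ (norm ξ) * (+ q * orthogonal ξ z - 1ℤ)
        -- The zeros stand for `∑ 𝔽 χ` and give the summand the shape required by `∑∑-norm-shift`
        -- for `χ`.
        ≡⟨ ∑-cong (points d) (λ ξ → split (+ q) (χ (norm ξ)) (orthogonal ξ z)) ⟩
      ∑[ ξ ∈ points d ] 1ℤ * (orthogonal ξ z * (+ q * χ (norm ξ) - 0ℤ) + 0ℤ) + -1ℤ * χ (norm ξ)
        ≡⟨ ∑-linear (points d) 1ℤ -1ℤ (λ ξ → orthogonal ξ z * (+ q * χ (norm ξ) - 0ℤ) + 0ℤ)
             (λ ξ → χ (norm ξ)) ⟩
      1ℤ * (∑[ ξ ∈ points d ] orthogonal ξ z * (+ q * χ (norm ξ) - 0ℤ) + 0ℤ)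
        + -1ℤ * (∑[ ξ ∈ points d ] χ (norm ξ))
        ≡⟨ cong₂ (λ s t → 1ℤ * s + -1ℤ * t) shifted (trans (∑points-norm m d≡ χ χ-cong)
             (cong₂ (λ s t → (Q m * Q m) * s + (ε m * Q m) * t) ∑χ≡0 ∑χ*χ)) ⟩
      1ℤ * ((Q m * Q m) * (+ q * 0ℤ)
            + (ε m * Q m) * (+ q * ((+ q - 1ℤ) * 𝟙 (0# ≟ᶠ norm z) + 1ℤ) + + q * - 1ℤ))
        + -1ℤ * ((Q m * Q m) * 0ℤ + (ε m * Q m) * (+ q - 1ℤ))
        ≡⟨ final (+ q) (Q m) (ε m) (𝟙 (0# ≟ᶠ norm z)) ⟩
      (ε m * Q m) * ((+ q - 1ℤ) * (+ q * 𝟙 (0# ≟ᶠ norm z) - 1ℤ)) ∎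
      where
      open ≡-Reasoning
      split : ∀ q x o → x * (q * o - 1ℤ) ≡ 1ℤ * (o * (q * x - 0ℤ) + 0ℤ) + -1ℤ * x
      split = solve-∀
      final : ∀ q Q e i →
        1ℤ * ((Q * Q) * (q * 0ℤ) + (e * Q) * (q * ((q - 1ℤ) * i + 1ℤ) + q * - 1ℤ))
        + -1ℤ * ((Q * Q) * 0ℤ + (e * Q) * (q - 1ℤ))
        ≡ (e * Q) * ((q - 1ℤ) * (q * i - 1ℤ))
      final = solve-∀
      shifted : ∑[ ξ ∈ points d ] orthogonal ξ z * (+ q * χ (norm ξ) - 0ℤ) + 0ℤ
                ≡ (Q m * Q m) * (+ q * 0ℤ)
                  + (ε m * Q m) * (+ q * ((+ q - 1ℤ) * 𝟙 (0# ≟ᶠ norm z) + 1ℤ) + + q * - 1ℤ)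
      shifted = begin
        ∑[ ξ ∈ points d ] orthogonal ξ z * (+ q * χ (norm ξ) - 0ℤ) + 0ℤ
          ≡⟨ ∑-cong (points d) (λ ξ → cong (λ s → orthogonal ξ z * (+ q * χ (norm ξ) - s) + s) ∑χ≡0) ⟨
        ∑[ ξ ∈ points d ] orthogonal ξ z * (+ q * χ (norm ξ) - ∑ 𝔽 χ) + ∑ 𝔽 χ
          ≡⟨ ∑∑-norm-shift d z χ χ-cong ⟨
        ∑[ t ∈ 𝔽 ] ∑[ ξ ∈ points d ] χ (norm ξ − norm z · (t · t))
          ≡⟨ ∑∑-norm-count m d≡ (norm z) χ χ-cong ⟩
        (Q m * Q m) * (+ q * ∑ 𝔽 χ) + (ε m * Q m) * (∑[ t ∈ 𝔽 ] correlation (norm z · (t · t)))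
          ≡⟨ cong₂ (λ s t → (Q m * Q m) * (+ q * s) + (ε m * Q m) * t) ∑χ≡0 (begin
            ∑[ t ∈ 𝔽 ] correlation (norm z · (t · t))
              ≡⟨ ∑-cong 𝔽 (λ t → correlation-≡ (norm z · (t · t))) ⟩
            ∑[ t ∈ 𝔽 ] (+ q * 𝟙 (0# ≟ᶠ norm z · (t · t)) - 1ℤ)
              ≡⟨ ∑-+ 𝔽 (λ t → + q * 𝟙 (0# ≟ᶠ norm z · (t · t))) (λ _ → - 1ℤ) ⟩
            (∑[ t ∈ 𝔽 ] + q * 𝟙 (0# ≟ᶠ norm z · (t · t))) + (∑[ t ∈ 𝔽 ] - 1ℤ)
              ≡⟨ cong₂ _+_ (trans (∑-*ˡ 𝔽 (+ q) (λ t → 𝟙 (0# ≟ᶠ norm z · (t · t))))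
                   (cong (_*_ (+ q)) ∑𝟙[0≡ norm z ])) (∑𝔽-const (- 1ℤ)) ⟩
            + q * ((+ q - 1ℤ) * 𝟙 (0# ≟ᶠ norm z) + 1ℤ) + + q * - 1ℤ ∎) ⟩
        (Q m * Q m) * (+ q * 0ℤ)
          + (ε m * Q m) * (+ q * ((+ q - 1ℤ) * 𝟙 (0# ≟ᶠ norm z) + 1ℤ) + + q * - 1ℤ) ∎

-- Spectral identities and inequalities for the point set

module SquareDistances {c ℓ q} (F : FiniteField c ℓ q) (q-odd : q % 2 ≡ 1)
                       (d m : ℕ) (d≡ : d ≡ suc (m ℕ.* 2)) (A : List (Point F d)) (A-unique : IsSubset F A) where
  open IntegerSums
  open QuadraticCharacter F
  open OddOrder q-odd
  open PointSums F q-odd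
  open QuadricCounts F q-odd
  open import Algebra.Bundles using (CommutativeRing)
  import Algebra.Properties.Ring as RingProperties
  open import Data.Integer.Base
    using (ℤ; +_; -[1+_]; 0ℤ; 1ℤ; -1ℤ; _+_; _*_; _-_; -_; _≤_; _<_; +≤+)
  import Data.Integer.Base as ℤ
  import Data.Integer.Properties as ℤ
  open import Data.Integer.Tactic.RingSolver using (solve-∀)
  open import Data.List.Base using (length; cartesianProduct)
  open import Data.Product.Base using (_×_; _,_; proj₁; proj₂)
  import Data.Vec.Functional.Relation.Binary.Equality.Setoid as VectorEquality
  import Data.Vec.Functional.Relation.Binary.Pointwise.Properties as Pointwise
  open import Function.Base using (_∘_)
  open import Relation.Binary.PropositionalEquality
    using (refl; sym; trans; cong; cong₂; module ≡-Reasoning)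
  open import Relation.Nullary.Decidable using (Dec; yes; no)

  open FiniteField F using () renaming (commutativeRing to R)
  private module R = CommutativeRing R
  open R using (Carrier; _≈_; 0#)
    renaming (_+_ to _⊕_; _*_ to _·_; _-_ to _−_; setoid to ≈-setoid)
  open RingProperties R.ring using ()
    renaming ( //-rightDividesˡ to x−y⊕y≈x; //-rightDividesʳ to x⊕y−y≈x
             ; x∙y⁻¹≈ε⇒x≈y to x−y≈0⇒x≈y; x≈y⇒x∙y⁻¹≈ε to x≈y⇒x−y≈0)
  open VectorEquality ≈-setoid using (_≋_; ≋-setoid)

  private
    _≋?_ : ∀ (x y : Point F d) → Dec (x ≋ y)
    _≋?_ = Pointwise.decidable _≟ᶠ_

    _∸ᵖ_ : Point F d → Point F d → Point F d
    (x ∸ᵖ y) i = x i − y i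

  a S Z : ℤ
  a = + length A
  S = ∑[ x ∈ A ] ∑[ y ∈ A ] χ (norm (x ∸ᵖ y))
  Z = ∑[ x ∈ A ] ∑[ y ∈ A ] 𝟙 (0# ≟ᶠ norm (x ∸ᵖ y))

  ∑∑-const : ∀ k → ∑[ x ∈ A ] ∑[ y ∈ A ] k ≡ a * a * k
  ∑∑-const k = trans (trans (∑-cong A λ _ → ∑-const A k) (∑-const A (a * k))) (sym (ℤ.*-assoc a a k))

  ∑∑-linear : ∀ k l (f g : Point F d → Point F d → ℤ) →
    ∑[ x ∈ A ] ∑[ y ∈ A ] (k * f x y + l * g x y)
    ≡ k * (∑[ x ∈ A ] ∑[ y ∈ A ] f x y) + l * (∑[ x ∈ A ] ∑[ y ∈ A ] g x y)
  ∑∑-linear k l f g = trans (∑-cong A λ x → ∑-linear A k l (f x) (g x)) (∑-linear A k l _ _)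

  diagonal : ∑[ x ∈ A ] ∑[ y ∈ A ] 𝟙 (x ≋? y) ≡ a
  diagonal = ∑∑-𝟙 (≋-setoid d) _≋?_ A-unique

  a≤Z : a ≤ Z
  a≤Z = ℤ.≤-trans (ℤ.≤-reflexive (sym diagonal)) (∑-mono-≤ A λ x → ∑-mono-≤ A λ y →
    𝟙-mono (x ≋? y) (0# ≟ᶠ norm (x ∸ᵖ y)) λ x≋y → R.sym (norm-zero λ i → x≈y⇒x−y≈0 (x≋y i)))

  S≤a² : S ≤ a * a
  S≤a² = ℤ.≤-trans (∑-mono-≤ A λ x → ∑-mono-≤ A λ y → proj₁ (∣χ∣≤1 (norm (x ∸ᵖ y))))
    (ℤ.≤-reflexive (trans (∑∑-const 1ℤ) (ℤ.*-identityʳ (a * a))))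

  -- Pointwise, twice the indicator of η = 1 is 1 - [n = 0] + η(n). The coefficients 1 in the
  -- intermediate terms fit them to `∑∑-linear`.
  2SQ≡ : + 2 * + SQ F A ≡ a * a - Z + S
  2SQ≡ = begin
    + 2 * + SQ F A
      ≡⟨ cong (_*_ (+ 2)) (trans (length-filter-∑ _ (cartesianProduct A A))
           (∑-cartesianProductWith _,_ A A _)) ⟩
    + 2 * (∑[ x ∈ A ] ∑[ y ∈ A ] 𝟙 (η F (norm (x ∸ᵖ y)) ℤ.≟ 1ℤ))
      ≡⟨ ∑-*ˡ A (+ 2) _ ⟨
    ∑[ x ∈ A ] + 2 * (∑[ y ∈ A ] 𝟙 (η F (norm (x ∸ᵖ y)) ℤ.≟ 1ℤ))
      ≡⟨ ∑-cong A (λ x → trans (sym (∑-*ˡ A (+ 2) _)) (∑-cong A λ y → pointwise (norm (x ∸ᵖ y)))) ⟩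
    ∑[ x ∈ A ] ∑[ y ∈ A ] (1ℤ * (1ℤ * 1ℤ + -1ℤ * 𝟙 (0# ≟ᶠ norm (x ∸ᵖ y))) + 1ℤ * χ (norm (x ∸ᵖ y)))
      ≡⟨ ∑∑-linear 1ℤ 1ℤ (λ x y → 1ℤ * 1ℤ + -1ℤ * 𝟙 (0# ≟ᶠ norm (x ∸ᵖ y))) (λ x y → χ (norm (x ∸ᵖ y))) ⟩
    1ℤ * (∑[ x ∈ A ] ∑[ y ∈ A ] 1ℤ * 1ℤ + -1ℤ * 𝟙 (0# ≟ᶠ norm (x ∸ᵖ y))) + 1ℤ * S
      ≡⟨ cong (λ s → 1ℤ * s + 1ℤ * S) (trans
           (∑∑-linear 1ℤ -1ℤ (λ _ _ → 1ℤ) (λ x y → 𝟙 (0# ≟ᶠ norm (x ∸ᵖ y))))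
           (cong (λ s → 1ℤ * s + -1ℤ * Z) (∑∑-const 1ℤ))) ⟩
    1ℤ * (1ℤ * (a * a * 1ℤ) + -1ℤ * Z) + 1ℤ * S
      ≡⟨ simplify a Z S ⟩
    a * a - Z + S ∎
    where
    open ≡-Reasoning
    simplify : ∀ a Z S → 1ℤ * (1ℤ * (a * a * 1ℤ) + -1ℤ * Z) + 1ℤ * S ≡ a * a - Z + S
    simplify = solve-∀
    pointwise : ∀ n → + 2 * 𝟙 (η F n ℤ.≟ 1ℤ) ≡ 1ℤ * (1ℤ * 1ℤ + -1ℤ * 𝟙 (0# ≟ᶠ n)) + 1ℤ * χ n
    pointwise n = trans (cong (λ i → + 2 * 𝟙 (i ℤ.≟ 1ℤ)) (sym (χ≡η n))) (by-class (classify n))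
      where
      by-class : QuadraticClass n → + 2 * 𝟙 (χ n ℤ.≟ 1ℤ) ≡ 1ℤ * (1ℤ * 1ℤ + -1ℤ * 𝟙 (0# ≟ᶠ n)) + 1ℤ * χ n
      by-class (zero n≈0 eq) rewrite eq | 𝟙-true (0# ≟ᶠ n) (R.sym n≈0) = refl
      by-class (square r r≉0 r²≈n eq) rewrite eq
        | 𝟙-false (0# ≟ᶠ n) (λ 0≈n → r≉0 (x·x≈0⇒x≈0 (R.trans r²≈n (R.sym 0≈n)))) = refl
      by-class (nonsquare n≉0 _ eq) rewrite eq | 𝟙-false (0# ≟ᶠ n) (n≉0 ∘ R.sym) = refl

  -- With Fourier coefficients Â, this is the sum of |Â(s ξ)|² over s ≠ 0: summing over a punctured
  -- line replaces the characters by an indicator.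
  weight : Point F d → ℤ
  weight ξ = ∑[ x ∈ A ] ∑[ y ∈ A ] (+ q * orthogonal ξ (x ∸ᵖ y) - 1ℤ)

  weight-cong : RespectsPoints weight
  weight-cong ξ≋ζ = ∑-cong A λ x → ∑-cong A λ y → cong (λ i → + q * i - 1ℤ)
    (𝟙-≟-cong R.refl (dot-cong {z = x ∸ᵖ y} ξ≋ζ λ i → R.refl))

  weight-zero : weight (λ _ → 0#) ≡ a * a * (+ q - 1ℤ)
  weight-zero = trans (∑-cong A λ x → ∑-cong A λ y → trans
    (cong (λ i → + q * i - 1ℤ) (𝟙-true (0# ≟ᶠ dot (λ _ → 0#) (x ∸ᵖ y)) (R.sym (dot-zeroˡ (x ∸ᵖ y)))))
    (cong (_- 1ℤ) (ℤ.*-identityʳ (+ q)))) (∑∑-const (+ q - 1ℤ))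

  dot-∸ : ∀ (ξ x y : Point F d) → dot ξ (x ∸ᵖ y) ≈ dot ξ x − dot ξ y
  dot-∸ ξ x y = R.trans (R.sym (x⊕y−y≈x (dot ξ y) _)) (R.+-congʳ (R.trans
    (R.sym (dot-⊕ ξ (x ∸ᵖ y) y)) (dot-cong {ξ = ξ} {z = λ i → (x ∸ᵖ y) i ⊕ y i} (λ i → R.refl) (λ i → x−y⊕y≈x (y i) (x i)))))

  i*i≥0 : ∀ i → 0ℤ ≤ i * i
  i*i≥0 (+ n)    = ℤ.≤-trans (+≤+ ℕ.z≤n) (ℤ.≤-reflexive (ℤ.pos-* n n))
  i*i≥0 -[1+ n ] = +≤+ ℕ.z≤n

  -- Cauchy–Schwarz for the distribution n of ξ · x on A, in the form Σᵤ (q n(u) − |A|)² ≥ 0.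
  weight-nonneg : ∀ ξ → 0ℤ ≤ weight ξ
  weight-nonneg ξ = ℤ.*-cancelˡ-≤-pos 0ℤ (weight ξ) (+ q) {{ℤ.positive 0<q}} (begin
    + q * 0ℤ                                ≡⟨ ℤ.*-zeroʳ (+ q) ⟩
    0ℤ                                      ≤⟨ ∑-nonneg 𝔽 (λ u → i*i≥0 (+ q * n u - a)) ⟩
    ∑[ u ∈ 𝔽 ] (+ q * n u - a) * (+ q * n u - a)
      ≡⟨ ∑-cong 𝔽 (λ u → expand (+ q) (n u) a) ⟩
    ∑[ u ∈ 𝔽 ] + q * + q * (n u * n u) + 1ℤ * (- (+ 2 * + q * a) * (n u * 1ℤ) + a * a * 1ℤ)
      ≡⟨ ∑-linear 𝔽 (+ q * + q) 1ℤ (λ u → n u * n u) (λ u → - (+ 2 * + q * a) * (n u * 1ℤ) + a * a * 1ℤ) ⟩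
    + q * + q * (∑[ u ∈ 𝔽 ] n u * n u) + 1ℤ * (∑[ u ∈ 𝔽 ] - (+ 2 * + q * a) * (n u * 1ℤ) + a * a * 1ℤ)
      ≡⟨ cong₂ (λ s t → + q * + q * s + 1ℤ * t) (sym (∑𝔽-fibres A (dot ξ) n n-cong))
           (trans (∑-linear 𝔽 (- (+ 2 * + q * a)) (a * a) (λ u → n u * 1ℤ) (λ _ → 1ℤ))
             (cong₂ (λ s t → - (+ 2 * + q * a) * s + a * a * t)
               (trans (sym (∑𝔽-fibres A (dot ξ) (λ _ → 1ℤ) (λ _ → refl))) (∑-const A 1ℤ)) (∑𝔽-const 1ℤ))) ⟩
    + q * + q * E + 1ℤ * (- (+ 2 * + q * a) * (a * 1ℤ) + a * a * (+ q * 1ℤ))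
      ≡⟨ collect (+ q) E a ⟩
    + q * (+ q * E + -1ℤ * (a * a * 1ℤ))    ≡⟨ cong (_*_ (+ q)) weight≡ ⟨
    + q * weight ξ                          ∎)
    where
    open ℤ.≤-Reasoning
    0<q : 0ℤ < + q
    0<q = ℤ.<-≤-trans (ℤ.+<+ (ℕ.s≤s ℕ.z≤n)) 2≤q
    n : Carrier → ℤ
    n u = ∑[ y ∈ A ] 𝟙 (dot ξ y ≟ᶠ u)
    n-cong : Respects n
    n-cong u≈v = ∑-cong A λ y → 𝟙-≟-cong R.refl u≈v
    E = ∑[ x ∈ A ] n (dot ξ x)
    expand : ∀ q n a → (q * n - a) * (q * n - a)
                       ≡ q * q * (n * n) + 1ℤ * (- (+ 2 * q * a) * (n * 1ℤ) + a * a * 1ℤ)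
    expand = solve-∀
    collect : ∀ q E a → q * q * E + 1ℤ * (- (+ 2 * q * a) * (a * 1ℤ) + a * a * (q * 1ℤ))
                        ≡ q * (q * E + -1ℤ * (a * a * 1ℤ))
    collect = solve-∀
    same-fibre : ∀ x y → orthogonal ξ (x ∸ᵖ y) ≡ 𝟙 (dot ξ y ≟ᶠ dot ξ x)
    same-fibre x y = 𝟙-cong (0# ≟ᶠ dot ξ (x ∸ᵖ y)) (dot ξ y ≟ᶠ dot ξ x)
      (λ eq → R.sym (x−y≈0⇒x≈y (dot ξ x) (dot ξ y) (R.sym (R.trans eq (dot-∸ ξ x y)))))
      (λ eq → R.sym (R.trans (dot-∸ ξ x y) (x≈y⇒x−y≈0 (R.sym eq))))
    weight≡ : weight ξ ≡ + q * E + -1ℤ * (a * a * 1ℤ)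
    weight≡ = trans
      (∑-cong A λ x → ∑-cong A λ y → cong (λ i → + q * i - 1ℤ) (same-fibre x y))
      (trans (∑∑-linear (+ q) -1ℤ (λ x y → 𝟙 (dot ξ y ≟ᶠ dot ξ x)) (λ _ _ → 1ℤ))
        (cong (λ s → + q * E + -1ℤ * s) (∑∑-const 1ℤ)))

  -- Exchanging the sums puts the frequencies innermost, where for each pair x, y one of the kernel
  -- identities applies with z = x - y.
  ∑-weighted : ∀ (f : Point F d → ℤ) → ∑[ ξ ∈ points d ] f ξ * weight ξ
    ≡ ∑[ x ∈ A ] ∑[ y ∈ A ] ∑[ ξ ∈ points d ] f ξ * (+ q * orthogonal ξ (x ∸ᵖ y) - 1ℤ)
  ∑-weighted f = begin
    ∑[ ξ ∈ points d ] f ξ * weight ξ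
      ≡⟨ ∑-cong (points d) (λ ξ → trans (sym (∑-*ˡ A (f ξ) _)) (∑-cong A λ x → sym (∑-*ˡ A (f ξ) _))) ⟩
    ∑[ ξ ∈ points d ] ∑[ x ∈ A ] ∑[ y ∈ A ] f ξ * (+ q * orthogonal ξ (x ∸ᵖ y) - 1ℤ)
      ≡⟨ ∑-swap (points d) A _ ⟩
    ∑[ x ∈ A ] ∑[ ξ ∈ points d ] ∑[ y ∈ A ] f ξ * (+ q * orthogonal ξ (x ∸ᵖ y) - 1ℤ)
      ≡⟨ ∑-cong A (λ x → ∑-swap (points d) A _) ⟩
    ∑[ x ∈ A ] ∑[ y ∈ A ] ∑[ ξ ∈ points d ] f ξ * (+ q * orthogonal ξ (x ∸ᵖ y) - 1ℤ) ∎
    where open ≡-Reasoning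

  private
    -- The number of points on a punctured line.
    r = + q - 1ℤ

    ∑w ∑iw ∑χw : ℤ
    ∑w  = ∑ (points d) weight
    ∑iw = ∑[ ξ ∈ points d ] isotropic ξ * weight ξ
    ∑χw = ∑[ ξ ∈ points d ] χ (norm ξ) * weight ξ

  -- Parseval, with each frequency counted `r` times: only the pairs x = y survive orthogonality.
  ∑-weight : ∑w ≡ + q * (Q m * Q m) * r * a
  ∑-weight = begin
    ∑ (points d) weight
      ≡⟨ ∑-cong (points d) (λ ξ → sym (ℤ.*-identityˡ (weight ξ))) ⟩
    ∑[ ξ ∈ points d ] 1ℤ * weight ξ
      ≡⟨ ∑-weighted (λ _ → 1ℤ) ⟩
    ∑[ x ∈ A ] ∑[ y ∈ A ] ∑[ ξ ∈ points d ] 1ℤ * (+ q * orthogonal ξ (x ∸ᵖ y) - 1ℤ)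
      ≡⟨ ∑-cong A (λ x → ∑-cong A λ y → trans
           (∑-cong (points d) λ ξ → ℤ.*-identityˡ (+ q * orthogonal ξ (x ∸ᵖ y) - 1ℤ)) (kernel x y (x ≋? y))) ⟩
    ∑[ x ∈ A ] ∑[ y ∈ A ] + q * (Q m * Q m) * r * 𝟙 (x ≋? y)
      ≡⟨ trans (∑-cong A λ x → ∑-*ˡ A (+ q * (Q m * Q m) * r) (λ y → 𝟙 (x ≋? y)))
           (∑-*ˡ A (+ q * (Q m * Q m) * r) (λ x → ∑[ y ∈ A ] 𝟙 (x ≋? y))) ⟩
    + q * (Q m * Q m) * r * (∑[ x ∈ A ] ∑[ y ∈ A ] 𝟙 (x ≋? y))
      ≡⟨ cong (_*_ (+ q * (Q m * Q m) * r)) diagonal ⟩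
    + q * (Q m * Q m) * r * a ∎
    where
    open ≡-Reasoning
    kernel : ∀ x y (P : Dec (x ≋ y)) →
      ∑[ ξ ∈ points d ] (+ q * orthogonal ξ (x ∸ᵖ y) - 1ℤ) ≡ + q * (Q m * Q m) * r * 𝟙 P
    kernel x y (yes x≋y) = trans (∑-orthogonal-zero m d≡ (x ∸ᵖ y) (λ i → x≈y⇒x−y≈0 (x≋y i)))
      (sym (ℤ.*-identityʳ (+ q * (Q m * Q m) * r)))
    kernel x y (no x≇y)  = trans
      (∑-orthogonal-nonzero d (x ∸ᵖ y) λ x−y≈0 → x≇y λ i → x−y≈0⇒x≈y (x i) (y i) (x−y≈0 i))
      (sym (ℤ.*-zeroʳ (+ q * (Q m * Q m) * r)))

  ∑-isotropic-weight : + q * ∑iw + -1ℤ * ∑w ≡ ε m * Q m * (+ q * r) * S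
  ∑-isotropic-weight = begin
    + q * ∑iw + -1ℤ * ∑w
      ≡⟨ ∑-linear (points d) (+ q) -1ℤ (λ ξ → isotropic ξ * weight ξ) weight ⟨
    ∑[ ξ ∈ points d ] + q * (isotropic ξ * weight ξ) + -1ℤ * weight ξ
      ≡⟨ ∑-cong (points d) (λ ξ → factor (+ q) (isotropic ξ) (weight ξ)) ⟩
    ∑[ ξ ∈ points d ] (+ q * isotropic ξ - 1ℤ) * weight ξ
      ≡⟨ ∑-weighted (λ ξ → + q * isotropic ξ - 1ℤ) ⟩
    ∑[ x ∈ A ] ∑[ y ∈ A ] ∑[ ξ ∈ points d ] (+ q * isotropic ξ - 1ℤ) * (+ q * orthogonal ξ (x ∸ᵖ y) - 1ℤ)
      ≡⟨ ∑-cong A (λ x → ∑-cong A λ y → trans (∑-isotropic-orthogonal m d≡ (x ∸ᵖ y))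
           (sym (ℤ.*-assoc (ε m * Q m) (+ q * r) (χ (norm (x ∸ᵖ y)))))) ⟩
    ∑[ x ∈ A ] ∑[ y ∈ A ] ε m * Q m * (+ q * r) * χ (norm (x ∸ᵖ y))
      ≡⟨ trans (∑-cong A λ x → ∑-*ˡ A (ε m * Q m * (+ q * r)) (λ y → χ (norm (x ∸ᵖ y))))
           (∑-*ˡ A (ε m * Q m * (+ q * r)) (λ x → ∑[ y ∈ A ] χ (norm (x ∸ᵖ y)))) ⟩
    ε m * Q m * (+ q * r) * S ∎
    where
    open ≡-Reasoning
    factor : ∀ q i w → q * (i * w) + -1ℤ * w ≡ (q * i - 1ℤ) * w
    factor = solve-∀

  -- The expected part |A|²/q of `Z` comes from the frequency 0, where `χ` vanishes; it therefore
  -- reappears as the subtracted `a * a`.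
  ∑-χ-weight : ∑χw ≡ ε m * Q m * r * (+ q * Z - a * a)
  ∑-χ-weight = begin
    ∑[ ξ ∈ points d ] χ (norm ξ) * weight ξ
      ≡⟨ ∑-weighted (χ ∘ norm) ⟩
    ∑[ x ∈ A ] ∑[ y ∈ A ] ∑[ ξ ∈ points d ] χ (norm ξ) * (+ q * orthogonal ξ (x ∸ᵖ y) - 1ℤ)
      ≡⟨ ∑-cong A (λ x → ∑-cong A λ y → trans (∑-χ-orthogonal m d≡ (x ∸ᵖ y))
           (expand (ε m * Q m) (+ q) (𝟙 (0# ≟ᶠ norm (x ∸ᵖ y))))) ⟩
    ∑[ x ∈ A ] ∑[ y ∈ A ] (ε m * Q m * r * + q * 𝟙 (0# ≟ᶠ norm (x ∸ᵖ y)) + - (ε m * Q m * r) * 1ℤ)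
      ≡⟨ ∑∑-linear (ε m * Q m * r * + q) (- (ε m * Q m * r)) (λ x y → 𝟙 (0# ≟ᶠ norm (x ∸ᵖ y))) (λ _ _ → 1ℤ) ⟩
    ε m * Q m * r * + q * Z + - (ε m * Q m * r) * (∑[ x ∈ A ] ∑[ y ∈ A ] 1ℤ)
      ≡⟨ cong (λ s → ε m * Q m * r * + q * Z + - (ε m * Q m * r) * s) (∑∑-const 1ℤ) ⟩
    ε m * Q m * r * + q * Z + - (ε m * Q m * r) * (a * a * 1ℤ)
      ≡⟨ collect (ε m * Q m * r) (+ q) Z a ⟩
    ε m * Q m * r * (+ q * Z - a * a) ∎
    where
    open ≡-Reasoning
    expand : ∀ k q i → k * ((q - 1ℤ) * (q * i - 1ℤ)) ≡ k * (q - 1ℤ) * q * i + - (k * (q - 1ℤ)) * 1ℤ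
    expand = solve-∀
    collect : ∀ k q Z a → k * q * Z + - k * (a * a * 1ℤ) ≡ k * (q * Z - a * a)
    collect = solve-∀

  -- Testing the weights against nonnegative functions

  private
    0≤+ : ∀ {i j} → 0ℤ ≤ i → 0ℤ ≤ j → 0ℤ ≤ i + j
    0≤+ = ℤ.+-mono-≤

    0≤* : ∀ {i j} → 0ℤ ≤ i → 0ℤ ≤ j → 0ℤ ≤ i * j
    0≤* {i} {j} 0≤i 0≤j = ℤ.≤-trans (ℤ.≤-reflexive (sym (ℤ.*-zeroʳ i)))
      (ℤ.*-monoˡ-≤-nonNeg i {{ℤ.nonNegative 0≤i}} 0≤j)

    0<* : ∀ {i j} → 0ℤ < i → 0ℤ < j → 0ℤ < i * j
    0<* {i} {j} 0<i 0<j = ℤ.≤-<-trans (ℤ.≤-reflexive (sym (ℤ.*-zeroʳ i)))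
      (ℤ.*-monoˡ-<-pos i {{ℤ.positive 0<i}} 0<j)

    0≤⇒≤ : ∀ {i j k} → j - i ≡ k → 0ℤ ≤ k → i ≤ j
    0≤⇒≤ eq 0≤k = ℤ.0≤i-j⇒j≤i (ℤ.≤-trans 0≤k (ℤ.≤-reflexive (sym eq)))

    ≤⇒0≤ : ∀ {i j} → i ≤ j → 0ℤ ≤ j - i
    ≤⇒0≤ = ℤ.i≤j⇒0≤j-i

  0<q : 0ℤ < + q
  0<q = ℤ.<-≤-trans (ℤ.+<+ (ℕ.s≤s ℕ.z≤n)) 2≤q

  0<Q : ∀ n → 0ℤ < Q n
  0<Q zero    = ℤ.+<+ (ℕ.s≤s ℕ.z≤n)
  0<Q (suc n) = 0<* 0<q (0<Q n)

  private
    0≤q = ℤ.<⇒≤ 0<q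
    0≤Q = ℤ.<⇒≤ (0<Q m)

    0<r : 0ℤ < r
    0<r = ℤ.<-≤-trans (ℤ.+<+ (ℕ.s≤s ℕ.z≤n)) (ℤ.+-monoˡ-≤ (- 1ℤ) 2≤q)

    instance
      _ = ℤ.positive 0<r
      _ = ℤ.positive (0<* (0<Q m) 0<r)
      q≢0 = ℤ.≢-nonZero λ q≡0 → ℤ.<-irrefl (sym q≡0) 0<q

    -- `∑-isotropic-weight` determines only q times `∑iw`, so the identity is proved after
    -- multiplication by q and then cancelled.
    anisotropic-weight : ∑w - ∑iw ≡ Q m * r * (Q m * r * a - ε m * S)
    anisotropic-weight = ℤ.*-cancelˡ-≡ (+ q) _ _ (begin
      + q * (∑w - ∑iw)
        ≡⟨ combine (+ q) ∑w ∑iw ⟩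
      r * ∑w - (+ q * ∑iw + -1ℤ * ∑w)
        ≡⟨ cong₂ (λ u v → r * u - v) ∑-weight ∑-isotropic-weight ⟩
      r * (+ q * (Q m * Q m) * r * a) - ε m * Q m * (+ q * r) * S
        ≡⟨ factor (+ q) (Q m) r a (ε m) S ⟩
      + q * (Q m * r * (Q m * r * a - ε m * S)) ∎)
      where
      open ≡-Reasoning
      combine : ∀ q w i → q * (w - i) ≡ (q - 1ℤ) * w - (q * i + -1ℤ * w)
      combine = solve-∀
      factor : ∀ q Q r a e S → r * (q * (Q * Q) * r * a) - e * Q * (q * r) * S
                               ≡ q * (Q * r * (Q * r * a - e * S))
      factor = solve-∀

    isotropic-weight : ∑iw ≡ r * (Q m * (Q m * a + ε m * S))
    isotropic-weight = begin
      ∑iw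
        ≡⟨ complement ∑w ∑iw ⟩
      ∑w - (∑w - ∑iw)
        ≡⟨ cong₂ _-_ ∑-weight anisotropic-weight ⟩
      + q * (Q m * Q m) * r * a - Q m * r * (Q m * r * a - ε m * S)
        ≡⟨ factor (+ q) (Q m) a (ε m) S ⟩
      r * (Q m * (Q m * a + ε m * S)) ∎
      where
      open ≡-Reasoning
      complement : ∀ w i → i ≡ w - (w - i)
      complement = solve-∀
      factor : ∀ q Q a e S →
        q * (Q * Q) * (q - 1ℤ) * a - Q * (q - 1ℤ) * (Q * (q - 1ℤ) * a - e * S)
        ≡ (q - 1ℤ) * (Q * (Q * a + e * S))
      factor = solve-∀

    ∑f*weight≥0 : ∀ (f : Point F d → ℤ) → (∀ ξ → 0ℤ ≤ f ξ) → 0ℤ ≤ ∑[ ξ ∈ points d ] f ξ * weight ξ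
    ∑f*weight≥0 f f≥0 = ∑-nonneg (points d) λ ξ → 0≤* (f≥0 ξ) (weight-nonneg ξ)

    -- The two expressions are twice the indicators of nonsquares and of nonzero squares, in this
    -- order.
    0≤1-isotropic±χ : ∀ (n : Carrier) → 0ℤ ≤ 1ℤ - 𝟙 (0# ≟ᶠ n) + -1ℤ * χ n × 0ℤ ≤ 1ℤ - 𝟙 (0# ≟ᶠ n) + 1ℤ * χ n
    0≤1-isotropic±χ n with classify n
    ... | zero n≈0 eq rewrite eq | 𝟙-true (0# ≟ᶠ n) (R.sym n≈0) = ℤ.≤-refl , ℤ.≤-refl
    ... | square r r≉0 r²≈n eq rewrite eq
        | 𝟙-false (0# ≟ᶠ n) (λ 0≈n → r≉0 (x·x≈0⇒x≈0 (R.trans r²≈n (R.sym 0≈n)))) = ℤ.≤-refl , +≤+ ℕ.z≤n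
    ... | nonsquare n≉0 _ eq rewrite eq | 𝟙-false (0# ≟ᶠ n) (n≉0 ∘ R.sym) = +≤+ ℕ.z≤n , ℤ.≤-refl

    -- One formula for three test functions: k = 0 selects the anisotropic frequencies, k = 1 and k
    -- = -1 twice those of nonzero square and of nonsquare norm.
    ∑-anisotropic±χ : ∀ k → ∑[ ξ ∈ points d ] (1ℤ - isotropic ξ + k * χ (norm ξ)) * weight ξ
                            ≡ Q m * r * ((Q m * r * a - ε m * S) + k * (ε m * (+ q * Z - a * a)))
    ∑-anisotropic±χ k = begin
      ∑[ ξ ∈ points d ] (1ℤ - isotropic ξ + k * χ (norm ξ)) * weight ξ
        ≡⟨ ∑-cong (points d) (λ ξ → expand (isotropic ξ) k (χ (norm ξ)) (weight ξ)) ⟩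
      ∑[ ξ ∈ points d ] 1ℤ * (1ℤ * weight ξ + -1ℤ * (isotropic ξ * weight ξ)) + k * (χ (norm ξ) * weight ξ)
        ≡⟨ ∑-linear (points d) 1ℤ k (λ ξ → 1ℤ * weight ξ + -1ℤ * (isotropic ξ * weight ξ))
             (λ ξ → χ (norm ξ) * weight ξ) ⟩
      1ℤ * (∑[ ξ ∈ points d ] 1ℤ * weight ξ + -1ℤ * (isotropic ξ * weight ξ)) + k * ∑χw
        ≡⟨ cong (λ s → 1ℤ * s + k * ∑χw) (∑-linear (points d) 1ℤ -1ℤ weight (λ ξ → isotropic ξ * weight ξ)) ⟩
      1ℤ * (1ℤ * ∑w + -1ℤ * ∑iw) + k * ∑χw
        ≡⟨ cong (_+ k * ∑χw) (as-difference ∑w ∑iw) ⟩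
      (∑w - ∑iw) + k * ∑χw
        ≡⟨ cong₂ (λ s t → s + k * t) anisotropic-weight ∑-χ-weight ⟩
      Q m * r * (Q m * r * a - ε m * S) + k * (ε m * Q m * r * (+ q * Z - a * a))
        ≡⟨ collect (Q m) r k (Q m * r * a - ε m * S) (ε m) (+ q * Z - a * a) ⟩
      Q m * r * ((Q m * r * a - ε m * S) + k * (ε m * (+ q * Z - a * a))) ∎
      where
      open ≡-Reasoning
      expand : ∀ i k x w → (1ℤ - i + k * x) * w ≡ 1ℤ * (1ℤ * w + -1ℤ * (i * w)) + k * (x * w)
      expand = solve-∀
      as-difference : ∀ w i → 1ℤ * (1ℤ * w + -1ℤ * i) ≡ w - i
      as-difference = solve-∀
      collect : ∀ Q r k t e z → Q * r * t + k * (e * Q * r * z) ≡ Q * r * (t + k * (e * z))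
      collect = solve-∀

    cancel-Qr : ∀ {i} → 0ℤ ≤ Q m * r * i → 0ℤ ≤ i
    cancel-Qr {i} 0≤ = ℤ.*-cancelˡ-≤-pos 0ℤ i (Q m * r)
      (ℤ.≤-trans (ℤ.≤-reflexive (ℤ.*-zeroʳ (Q m * r))) 0≤)

  -- The case k = 0: the anisotropic weight is nonnegative. For ε = 1 this bounds `S` by its largest
  -- eigenvalue.
  χ-bound : ε m * S ≤ Q m * r * a
  χ-bound = ℤ.0≤i-j⇒j≤i (cancel-Qr (ℤ.≤-trans (ℤ.≤-trans
    (∑f*weight≥0 (λ ξ → 1ℤ - isotropic ξ + 0ℤ * χ (norm ξ)) λ ξ → ℤ.≤-trans
      (≤⇒0≤ (isotropic≤1 ξ)) (ℤ.≤-reflexive (sym (ℤ.+-identityʳ _))))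
    (ℤ.≤-reflexive (∑-anisotropic±χ 0ℤ)))
    (ℤ.≤-reflexive (cong (_*_ (Q m * r)) (ℤ.+-identityʳ _)))))
    where
    isotropic≤1 : ∀ ξ → isotropic ξ ≤ 1ℤ
    isotropic≤1 ξ with 0# ≟ᶠ norm ξ
    ... | yes _ = ℤ.≤-refl
    ... | no _  = +≤+ ℕ.z≤n

  -- The frequency 0 is isotropic, and its weight alone is at most `∑iw`. For ε = -1 the result
  -- reads S ≤ Q a - a²/Q.
  isotropic-bound : a * a ≤ Q m * (Q m * a + ε m * S)
  isotropic-bound = ℤ.*-cancelˡ-≤-pos (a * a) _ r (begin
    r * (a * a)                                         ≡⟨ ℤ.*-comm r (a * a) ⟩
    a * a * r                                           ≡⟨ weight-zero ⟨
    weight (λ _ → 0#)                                   ≡⟨ ℤ.*-identityˡ (weight (λ _ → 0#)) ⟨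
    1ℤ * weight (λ _ → 0#)
      ≡⟨ cong (_* weight (λ _ → 0#)) (𝟙-true (0# ≟ᶠ norm {d} (λ _ → 0#)) (R.sym (norm-zero {d} λ _ → R.refl))) ⟨
    isotropic {d} (λ _ → 0#) * weight (λ _ → 0#)
      ≤⟨ term≤∑points d (λ ξ → isotropic ξ * weight ξ)
           (λ eq → cong₂ _*_ (𝟙-≟-cong R.refl (norm-cong eq)) (weight-cong eq))
           (λ ξ → 0≤* (𝟙-nonneg (0# ≟ᶠ norm ξ)) (weight-nonneg ξ)) (λ _ → 0#) ⟩
    ∑iw                                                 ≡⟨ isotropic-weight ⟩
    r * (Q m * (Q m * a + ε m * S))                     ∎)
    where open ℤ.≤-Reasoning

  -- Nonnegativity of the weight on frequencies of nonzero square norm. For ε = 1 it bounds q Z from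
  -- below by a² - Q r a + S.
  zero-bound⁺ : 0ℤ ≤ (Q m * r * a - ε m * S) + 1ℤ * (ε m * (+ q * Z - a * a))
  zero-bound⁺ = cancel-Qr (ℤ.≤-trans
    (∑f*weight≥0 (λ ξ → 1ℤ - isotropic ξ + 1ℤ * χ (norm ξ)) λ ξ → proj₂ (0≤1-isotropic±χ (norm ξ)))
    (ℤ.≤-reflexive (∑-anisotropic±χ 1ℤ)))

  -- The same for nonsquare norms; for ε = -1 it bounds q Z from below by a² - Q r a - S.
  zero-bound⁻ : 0ℤ ≤ (Q m * r * a - ε m * S) + -1ℤ * (ε m * (+ q * Z - a * a))
  zero-bound⁻ = cancel-Qr (ℤ.≤-trans
    (∑f*weight≥0 (λ ξ → 1ℤ - isotropic ξ + -1ℤ * χ (norm ξ)) λ ξ → proj₁ (0≤1-isotropic±χ (norm ξ)))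
    (ℤ.≤-reflexive (∑-anisotropic±χ -1ℤ)))

  -- The bounds for either sign, cleared of denominators

  module Positive (ε≡1 : ε m ≡ 1ℤ) where

    SQ-bound₁ : + 2 * + SQ F A ≤ a * a - Q m * a - a + + q * Q m * a
    SQ-bound₁ = 0≤⇒≤
      (trans (cong (λ s → (a * a - Q m * a - a + + q * Q m * a) - s) 2SQ≡) (trans
        (combine (+ q) (Q m) a S Z) (cong (λ e → (Z - a) + (Q m * r * a - e * S)) (sym ε≡1))))
      (0≤+ (≤⇒0≤ a≤Z) (≤⇒0≤ χ-bound))
      where
      combine : ∀ q Q a S Z → (a * a - Q * a - a + q * Q * a) - (a * a - Z + S)
                              ≡ (Z - a) + (Q * (q - 1ℤ) * a - 1ℤ * S)
      combine = solve-∀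

    -- No spectral input: η ≤ 1 on all pairs, and `Z` contains the diagonal.
    SQ-bound₂ : + 2 * + SQ F A ≤ a * a - Q m * a - a + (Q m * a + a * a)
    SQ-bound₂ = 0≤⇒≤
      (trans (cong (λ s → (a * a - Q m * a - a + (Q m * a + a * a)) - s) 2SQ≡) (combine (Q m) a S Z))
      (0≤+ (≤⇒0≤ a≤Z) (≤⇒0≤ S≤a²))
      where
      combine : ∀ Q a S Z → (a * a - Q * a - a + (Q * a + a * a)) - (a * a - Z + S)
                            ≡ (Z - a) + (a * a - S)
      combine = solve-∀

    -- `zero-bound⁺` holds q Z but a single -S. Adding `r` times `χ-bound` raises this to -q S, so
    -- that exactly q (Z - S) appears.
    SQ-bound₃ : + q * (+ 2 * + SQ F A)
                ≤ + q * (a * a) - + q * (Q m * a) - + q * a + (+ q * a + + q * (+ q * Q m * a) - a * a)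
    SQ-bound₃ = 0≤⇒≤
      (trans (cong (λ s → rhs - + q * s) 2SQ≡) (trans (combine (+ q) (Q m) a S Z)
        (cong (λ e → r * (Q m * r * a - e * S) + ((Q m * r * a - e * S) + 1ℤ * (e * (+ q * Z - a * a))))
          (sym ε≡1))))
      (0≤+ (0≤* (ℤ.<⇒≤ 0<r) (≤⇒0≤ χ-bound)) zero-bound⁺)
      where
      rhs = + q * (a * a) - + q * (Q m * a) - + q * a + (+ q * a + + q * (+ q * Q m * a) - a * a)
      combine : ∀ q Q a S Z →
        (q * (a * a) - q * (Q * a) - q * a + (q * a + q * (q * Q * a) - a * a)) - q * (a * a - Z + S)
        ≡ (q - 1ℤ) * (Q * (q - 1ℤ) * a - 1ℤ * S)
          + ((Q * (q - 1ℤ) * a - 1ℤ * S) + 1ℤ * (1ℤ * (q * Z - a * a)))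
      combine = solve-∀

  module Negative (ε≡-1 : ε m ≡ -1ℤ) where

    -- Trading q Z for S by `zero-bound⁻` raises the coefficient of `S` from q to q + 1, which is
    -- therefore the multiplier of `isotropic-bound`. The factor Q clears the denominator in that
    -- bound.
    SQ-bound₁ : + q * (Q m * (+ 2 * + SQ F A))
      ≤ + q * (Q m * (a * a)) + + 2 * (+ q * (Q m * (Q m * a))) - Q m * (a * a) - + q * (a * a) - a * a
    SQ-bound₁ = 0≤⇒≤
      (trans (cong (λ s → rhs - + q * (Q m * s)) 2SQ≡) (trans (combine (+ q) (Q m) a S Z)
        (cong (λ e → Q m * ((Q m * r * a - e * S) + -1ℤ * (e * (+ q * Z - a * a)))
                     + (+ q + 1ℤ) * (Q m * (Q m * a + e * S) - a * a)) (sym ε≡-1))))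
      (0≤+ (0≤* 0≤Q zero-bound⁻) (0≤* (0≤+ 0≤q (+≤+ ℕ.z≤n)) (≤⇒0≤ isotropic-bound)))
      where
      rhs = + q * (Q m * (a * a)) + + 2 * (+ q * (Q m * (Q m * a))) - Q m * (a * a) - + q * (a * a) - a * a
      combine : ∀ q Q a S Z →
        (q * (Q * (a * a)) + + 2 * (q * (Q * (Q * a))) - Q * (a * a) - q * (a * a) - a * a)
          - q * (Q * (a * a - Z + S))
        ≡ Q * ((Q * (q - 1ℤ) * a - -1ℤ * S) + -1ℤ * (-1ℤ * (q * Z - a * a)))
          + (q + 1ℤ) * (Q * (Q * a + -1ℤ * S) - a * a)
      combine = solve-∀

    SQ-bound₂ : Q m * (+ 2 * + SQ F A) ≤ Q m * (a * a) + Q m * (Q m * a) - a * a - Q m * a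
    SQ-bound₂ = 0≤⇒≤
      (trans (cong (λ s → (Q m * (a * a) + Q m * (Q m * a) - a * a - Q m * a) - Q m * s) 2SQ≡) (trans
        (combine (Q m) a S Z)
        (cong (λ e → Q m * (Z - a) + (Q m * (Q m * a + e * S) - a * a)) (sym ε≡-1))))
      (0≤+ (0≤* 0≤Q (≤⇒0≤ a≤Z)) (≤⇒0≤ isotropic-bound))
      where
      combine : ∀ Q a S Z →
        (Q * (a * a) + Q * (Q * a) - a * a - Q * a) - Q * (a * a - Z + S)
        ≡ Q * (Z - a) + (Q * (Q * a + -1ℤ * S) - a * a)
      combine = solve-∀

-- Passing from integer to rational inequalities

module CommonDenominator (k : ℕ) .{{_ : NonZero k}} where
  open import Data.Integer.Base using (ℤ; +_)
  import Data.Integer.Base as ℤ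
  import Data.Integer.Properties as ℤ
  open import Data.Integer.Tactic.RingSolver using (solve-∀)
  open import Data.Rational.Base using (ℚ; toℚᵘ; _/_; _+_; _-_; _≤_)
  import Data.Rational.Properties as ℚ
  import Data.Rational.Unnormalised.Base as ℚᵘ
  open ℚᵘ using (_≃_; *≡*; *≤*)
  import Data.Rational.Unnormalised.Properties as ℚᵘ
  open import Relation.Binary.PropositionalEquality using (refl; sym; trans; cong)

  infix 4 _HasNumerator_

  -- The equation lives among unnormalised fractions, where numerators over `k` add without
  -- reduction to lowest terms. The record wrapper lets `p` and `n` be inferred.
  record _HasNumerator_ (p : ℚ) (n : ℤ) : Set where
    constructor over
    field equation : toℚᵘ p ≃ (n ℚᵘ./ k)

  toℚᵘ-/ : ∀ n l .{{_ : NonZero l}} → toℚᵘ (n / l) ≃ (n ℚᵘ./ l)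
  toℚᵘ-/ n (suc l) = ℚ.toℚᵘ-fromℚᵘ (ℚᵘ.mkℚᵘ n l)

  /-≃ : ∀ {n n′} l l′ .{{_ : NonZero l}} .{{_ : NonZero l′}} →
        n ℤ.* + l′ ≡ n′ ℤ.* + l → (n ℚᵘ./ l) ≃ (n′ ℚᵘ./ l′)
  /-≃ (suc l) (suc l′) eq = *≡* eq

  -- Cross-multiplication. `X`, `L` and `K` rename the images of the natural numbers as integer
  -- polynomials, so that the last premise is within reach of the ring solver.
  fraction : ∀ x l n .{{_ : NonZero l}} {X L K} → + x ≡ X → + l ≡ L → + k ≡ K →
             X ℤ.* K ≡ n ℤ.* L → (+ x / l) HasNumerator n
  fraction x l n refl refl refl eq = over (ℚᵘ.≃-trans (toℚᵘ-/ (+ x) l) (/-≃ l k eq))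

  /-+ : ∀ n n′ l .{{_ : NonZero l}} → (n ℚᵘ./ l) ℚᵘ.+ (n′ ℚᵘ./ l) ≃ ((n ℤ.+ n′) ℚᵘ./ l)
  /-+ n n′ (suc l) = *≡* (trans (regroup n n′ (+ suc l)) (cong (ℤ._*_ (n ℤ.+ n′)) (sym (ℤ.pos-* (suc l) (suc l)))))
    where
    regroup : ∀ n n′ l → (n ℤ.* l ℤ.+ n′ ℤ.* l) ℤ.* l ≡ (n ℤ.+ n′) ℤ.* (l ℤ.* l)
    regroup = solve-∀

  -‿/ : ∀ n l .{{_ : NonZero l}} → ℚᵘ.- (n ℚᵘ./ l) ≃ ((ℤ.- n) ℚᵘ./ l)
  -‿/ n (suc l) = ℚᵘ.≃-refl

  infixl 6 _⟨+⟩_ _⟨-⟩_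

  _⟨+⟩_ : ∀ {p p′ n n′} → p HasNumerator n → p′ HasNumerator n′ → (p + p′) HasNumerator (n ℤ.+ n′)
  _⟨+⟩_ {p} {p′} {n} {n′} (over eq) (over eq′) = over (ℚᵘ.≃-trans (ℚ.toℚᵘ-homo-+ p p′)
    (ℚᵘ.≃-trans (ℚᵘ.+-cong eq eq′) (/-+ n n′ k)))

  _⟨-⟩_ : ∀ {p p′ n n′} → p HasNumerator n → p′ HasNumerator n′ → (p - p′) HasNumerator (n ℤ.- n′)
  _⟨-⟩_ {p} {p′} {n} {n′} eq (over eq′) = eq ⟨+⟩ over {n = ℤ.- n′}
    (ℚᵘ.≃-trans (ℚ.toℚᵘ-homo‿- p′) (ℚᵘ.≃-trans (ℚᵘ.-‿cong eq′) (-‿/ n′ k)))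

  numerators-≤ : ∀ {p p′ n n′} → p HasNumerator n → p′ HasNumerator n′ → n ℤ.≤ n′ → p ≤ p′
  numerators-≤ {n = n} {n′} (over eq) (over eq′) n≤n′ = ℚ.toℚᵘ-cancel-≤
    (ℚᵘ.≤-trans (ℚᵘ.≤-reflexive eq) (ℚᵘ.≤-trans (/-mono k) (ℚᵘ.≤-reflexive (ℚᵘ.≃-sym eq′))))
    where
    /-mono : ∀ l .{{_ : NonZero l}} → (n ℚᵘ./ l) ℚᵘ.≤ (n′ ℚᵘ./ l)
    /-mono (suc l) = *≤* (ℤ.*-monoʳ-≤-nonNeg (+ suc l) n≤n′)

-- The bounds with their denominators

module RationalBounds {c ℓ q} .{{_ : NonZero q}} (F : FiniteField c ℓ q) (q-odd : q % 2 ≡ 1)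
                      (d m : ℕ) (d≡ : d ≡ suc (m ℕ.* 2)) (A : List (Point F d)) (A-unique : IsSubset F A) where
  open QuadricCounts F q-odd using (Q; ε)
  open SquareDistances F q-odd d m d≡ A A-unique using (module Positive; module Negative)
  open import Data.Integer.Base using (ℤ; +_; 1ℤ; -1ℤ)
  import Data.Integer.Base as ℤ
  import Data.Integer.Properties as ℤ
  open import Data.Integer.Tactic.RingSolver using (solve-∀)
  open import Data.List.Base using (length)
  open import Data.Nat.Base using (_*_; _^_)
  open import Data.Nat.Properties using (m*n≢0)
  open import Data.Rational.Base using (_/_; _+_; _-_; _≤_; _⊓_)
  import Data.Rational.Properties as ℚ
  open import Data.Sum.Base using (inj₁; inj₂)
  open import Relation.Binary.PropositionalEquality using (refl; sym; trans; cong; subst)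

  private
    a = length A
    s = SQ F A
    instance
      _ = m*n≢0 2 q

    pos-^ : ∀ n → + (q ^ n) ≡ Q n
    pos-^ zero    = refl
    pos-^ (suc n) = trans (ℤ.pos-* q (q ^ n)) (cong (ℤ._*_ (+ q)) (pos-^ n))

    pos-a² : + (a ^ 2) ≡ + a ℤ.* + a
    pos-a² = trans (cong (λ n → + (a * n)) (ℕ.*-identityʳ a)) (ℤ.pos-* a a)

    pos-^*a : ∀ n → + (q ^ n * a) ≡ Q n ℤ.* + a
    pos-^*a n = trans (ℤ.pos-* (q ^ n) a) (cong (ℤ._* + a) (pos-^ n))

    pos-2* : ∀ n {N} → + n ≡ N → + (2 * n) ≡ + 2 ℤ.* N
    pos-2* n refl = ℤ.pos-* 2 n

    ≤-+⊓ : ∀ p r x y → p ≤ r + x → p ≤ r + y → p ≤ r + (x ⊓ y)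
    ≤-+⊓ p r x y p≤r+x p≤r+y with ℚ.⊓-sel x y
    ... | inj₁ eq = subst (λ z → p ≤ r + z) (sym eq) p≤r+x
    ... | inj₂ eq = subst (λ z → p ≤ r + z) (sym eq) p≤r+y

  -- Every denominator divides 2 q^(m+1). The variable `n` stands for the half of d + 1, which
  -- equals `suc m` only propositionally.
  part₁-large : ε m ≡ -1ℤ → ∀ {n} → n ≡ suc m →
    .{{_ : NonZero (2 * q ^ m)}} .{{_ : NonZero (2 * q ^ n)}} →
    + s / 1 ≤ + (a ^ 2) / 2 + + (q ^ m * a) / 1 - + (a ^ 2) / (2 * q)
              - + (a ^ 2) / (2 * q ^ m) - + (a ^ 2) / (2 * q ^ n)
  part₁-large ε≡-1 refl = numerators-≤
    (fraction s 1 (+ q ℤ.* (Q m ℤ.* (+ 2 ℤ.* + s))) refl refl K (e₁ (+ s) (+ q) (Q m)))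
    (fraction (a ^ 2) 2 (+ q ℤ.* (Q m ℤ.* (+ a ℤ.* + a))) pos-a² refl K (e₂ (+ a) (+ q) (Q m))
      ⟨+⟩ fraction (q ^ m * a) 1 (+ 2 ℤ.* (+ q ℤ.* (Q m ℤ.* (Q m ℤ.* + a)))) (pos-^*a m) refl K
            (e₃ (+ a) (+ q) (Q m))
      ⟨-⟩ fraction (a ^ 2) (2 * q) (Q m ℤ.* (+ a ℤ.* + a)) pos-a² (pos-2* q refl) K (e₄ (+ a) (+ q) (Q m))
      ⟨-⟩ fraction (a ^ 2) (2 * q ^ m) (+ q ℤ.* (+ a ℤ.* + a)) pos-a² (pos-2* (q ^ m) (pos-^ m)) K
            (e₅ (+ a) (+ q) (Q m))
      ⟨-⟩ fraction (a ^ 2) (2 * q ^ suc m) (+ a ℤ.* + a) pos-a² K K refl)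
    (Negative.SQ-bound₁ ε≡-1)
    where
    open CommonDenominator (2 * q ^ suc m)
    K : + (2 * q ^ suc m) ≡ + 2 ℤ.* (+ q ℤ.* Q m)
    K = pos-2* (q ^ suc m) (pos-^ (suc m))
    e₁ : ∀ s q Q → s ℤ.* (+ 2 ℤ.* (q ℤ.* Q)) ≡ q ℤ.* (Q ℤ.* (+ 2 ℤ.* s)) ℤ.* 1ℤ
    e₁ = solve-∀
    e₂ : ∀ a q Q → a ℤ.* a ℤ.* (+ 2 ℤ.* (q ℤ.* Q)) ≡ q ℤ.* (Q ℤ.* (a ℤ.* a)) ℤ.* + 2
    e₂ = solve-∀
    e₃ : ∀ a q Q → Q ℤ.* a ℤ.* (+ 2 ℤ.* (q ℤ.* Q)) ≡ + 2 ℤ.* (q ℤ.* (Q ℤ.* (Q ℤ.* a))) ℤ.* 1ℤ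
    e₃ = solve-∀
    e₄ : ∀ a q Q → a ℤ.* a ℤ.* (+ 2 ℤ.* (q ℤ.* Q)) ≡ Q ℤ.* (a ℤ.* a) ℤ.* (+ 2 ℤ.* q)
    e₄ = solve-∀
    e₅ : ∀ a q Q → a ℤ.* a ℤ.* (+ 2 ℤ.* (q ℤ.* Q)) ≡ q ℤ.* (a ℤ.* a) ℤ.* (+ 2 ℤ.* Q)
    e₅ = solve-∀

  part₁-small : ε m ≡ -1ℤ → .{{_ : NonZero (2 * q ^ m)}} →
    + s / 1 ≤ + (a ^ 2) / 2 + + (q ^ m * a) / 2 - + (a ^ 2) / (2 * q ^ m) - + a / 2
  part₁-small ε≡-1 = numerators-≤
    (fraction s 1 (Q m ℤ.* (+ 2 ℤ.* + s)) refl refl K (e₁ (+ s) (Q m)))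
    (fraction (a ^ 2) 2 (Q m ℤ.* (+ a ℤ.* + a)) pos-a² refl K (e₂ (+ a ℤ.* + a) (Q m))
      ⟨+⟩ fraction (q ^ m * a) 2 (Q m ℤ.* (Q m ℤ.* + a)) (pos-^*a m) refl K (e₂ (Q m ℤ.* + a) (Q m))
      ⟨-⟩ fraction (a ^ 2) (2 * q ^ m) (+ a ℤ.* + a) pos-a² K K refl
      ⟨-⟩ fraction a 2 (Q m ℤ.* + a) refl refl K (e₂ (+ a) (Q m)))
    (Negative.SQ-bound₂ ε≡-1)
    where
    open CommonDenominator (2 * q ^ m)
    K : + (2 * q ^ m) ≡ + 2 ℤ.* Q m
    K = pos-2* (q ^ m) (pos-^ m)
    e₁ : ∀ s Q → s ℤ.* (+ 2 ℤ.* Q) ≡ Q ℤ.* (+ 2 ℤ.* s) ℤ.* 1ℤ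
    e₁ = solve-∀
    e₂ : ∀ x Q → x ℤ.* (+ 2 ℤ.* Q) ≡ Q ℤ.* x ℤ.* + 2
    e₂ = solve-∀

  -- One inequality for each entry of the minimum: the first two over the denominator 2, the third
  -- over 2 q.
  part₂ : ε m ≡ 1ℤ → ∀ {n} → n ≡ suc m →
    + s / 1 ≤ + (a ^ 2) / 2 - + (q ^ m * a) / 2 - + a / 2
              + (+ (q ^ n * a) / 2
                 ⊓ (+ (q ^ m * a) / 2 + + (a ^ 2) / 2)
                 ⊓ (+ a / 2 + + (q ^ n * a) / 2 - + (a ^ 2) / (2 * q)))
  part₂ ε≡1 refl = ≤-+⊓ sq base (t₁ ⊓ t₂) t₃ (≤-+⊓ sq base t₁ t₂ first second) third
    where
    sq = + s / 1
    base = + (a ^ 2) / 2 - + (q ^ m * a) / 2 - + a / 2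
    t₁ = + (q ^ suc m * a) / 2
    t₂ = + (q ^ m * a) / 2 + + (a ^ 2) / 2
    t₃ = + a / 2 + + (q ^ suc m * a) / 2 - + (a ^ 2) / (2 * q)
    commute : ∀ x → x ℤ.* + 2 ≡ + 2 ℤ.* x ℤ.* 1ℤ
    commute = solve-∀
    module Over-2 where
      open CommonDenominator 2 public
      num-s  = fraction s 1 (+ 2 ℤ.* + s) refl refl refl (commute (+ s))
      num-a² = fraction (a ^ 2) 2 (+ a ℤ.* + a) pos-a² refl refl refl
      num-a  = fraction a 2 (+ a) refl refl refl refl
      num-Qa = fraction (q ^ m * a) 2 (Q m ℤ.* + a) (pos-^*a m) refl refl refl
      num-qQa = fraction (q ^ suc m * a) 2 (+ q ℤ.* Q m ℤ.* + a) (pos-^*a (suc m)) refl refl refl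
    first : sq ≤ base + t₁
    first = numerators-≤ num-s (num-a² ⟨-⟩ num-Qa ⟨-⟩ num-a ⟨+⟩ num-qQa) (Positive.SQ-bound₁ ε≡1)
      where open Over-2
    second : sq ≤ base + t₂
    second = numerators-≤ num-s (num-a² ⟨-⟩ num-Qa ⟨-⟩ num-a ⟨+⟩ (num-Qa ⟨+⟩ num-a²)) (Positive.SQ-bound₂ ε≡1)
      where open Over-2
    third : sq ≤ base + t₃
    third = numerators-≤ num-s
      (num-a² ⟨-⟩ num-Qa ⟨-⟩ num-a ⟨+⟩ (num-a ⟨+⟩ num-qQa ⟨-⟩ num-a²/q)) (Positive.SQ-bound₃ ε≡1)
      where
      open CommonDenominator (2 * q)
      K : + (2 * q) ≡ + 2 ℤ.* + q
      K = pos-2* q refl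
      e₁ : ∀ s q → s ℤ.* (+ 2 ℤ.* q) ≡ q ℤ.* (+ 2 ℤ.* s) ℤ.* 1ℤ
      e₁ = solve-∀
      e₂ : ∀ x q → x ℤ.* (+ 2 ℤ.* q) ≡ q ℤ.* x ℤ.* + 2
      e₂ = solve-∀
      num-s  = fraction s 1 (+ q ℤ.* (+ 2 ℤ.* + s)) refl refl K (e₁ (+ s) (+ q))
      num-a² = fraction (a ^ 2) 2 (+ q ℤ.* (+ a ℤ.* + a)) pos-a² refl K (e₂ (+ a ℤ.* + a) (+ q))
      num-a  = fraction a 2 (+ q ℤ.* + a) refl refl K (e₂ (+ a) (+ q))
      num-Qa = fraction (q ^ m * a) 2 (+ q ℤ.* (Q m ℤ.* + a)) (pos-^*a m) refl K (e₂ (Q m ℤ.* + a) (+ q))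
      num-qQa = fraction (q ^ suc m * a) 2 (+ q ℤ.* (+ q ℤ.* Q m ℤ.* + a)) (pos-^*a (suc m)) refl K
        (e₂ (+ q ℤ.* Q m ℤ.* + a) (+ q))
      num-a²/q = fraction (a ^ 2) (2 * q) (+ a ℤ.* + a) pos-a² K K refl

-- Halving odd dimensions

module OddDimension where
  open import Data.Nat.Base using (_+_; _*_; _∸_; _/_; ⌊_/2⌋)
  open import Data.Nat.DivMod using (m≡m%n+[m/n]*n)
  open import Relation.Binary.PropositionalEquality using (refl; sym; trans; cong)

  ⌊n*2/2⌋≡n : ∀ n → ⌊ n * 2 /2⌋ ≡ n
  ⌊n*2/2⌋≡n zero    = refl
  ⌊n*2/2⌋≡n (suc n) = cong suc (⌊n*2/2⌋≡n n)

  ⌊d∸1/2⌋≡ : ∀ {d} n → d ≡ suc (n * 2) → ⌊ d ∸ 1 /2⌋ ≡ n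
  ⌊d∸1/2⌋≡ n refl = ⌊n*2/2⌋≡n n

  ⌊d+1/2⌋≡ : ∀ {d} n → d ≡ suc (n * 2) → ⌊ d + 1 /2⌋ ≡ suc n
  ⌊d+1/2⌋≡ n refl = trans (cong (λ k → ⌊ suc k /2⌋) (ℕ.+-comm (n * 2) 1)) (cong suc (⌊n*2/2⌋≡n n))

  -- The values 0 and 1 of `j` encode the residues 1 and 3. Since d = 1 + 2 (j + 2 ⌊d/4⌋), the
  -- parity of m = (d - 1)/2 is that of `j`, which is what decides `ε`.
  module _ j d (d%4≡ : d % 4 ≡ suc (j * 2)) where
    private
      n = j + d / 4 * 2

      d≡1+n*2 : d ≡ suc (n * 2)
      d≡1+n*2 = trans (m≡m%n+[m/n]*n d 4) (trans (cong (_+ d / 4 * 4) d%4≡) (cong suc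
        (sym (trans (ℕ.*-distribʳ-+ 2 j (d / 4 * 2)) (cong (j * 2 +_) (ℕ.*-assoc (d / 4) 2 2))))))

    half≡ : ⌊ d ∸ 1 /2⌋ ≡ n
    half≡ = ⌊d∸1/2⌋≡ n d≡1+n*2

    d≡1+half*2 : d ≡ suc (⌊ d ∸ 1 /2⌋ * 2)
    d≡1+half*2 = trans d≡1+n*2 (cong (λ k → suc (k * 2)) (sym half≡))

    half⁺≡1+half : ⌊ d + 1 /2⌋ ≡ suc ⌊ d ∸ 1 /2⌋
    half⁺≡1+half = trans (⌊d+1/2⌋≡ n d≡1+n*2) (cong suc (sym half≡))

-- The sign of the eigenvalues from residues modulo 4

module Signs {c ℓ q} (F : FiniteField c ℓ q) (q-odd : q % 2 ≡ 1) where
  open QuadraticCharacter F using (χ; module OddOrder)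
  open OddOrder q-odd using (χ[-1]≡1; χ[-1]≡-1; χ[-1]²≡1)
  open QuadricCounts F q-odd using (ε)
  open OddDimension using (half≡)
  open import Algebra.Bundles using (CommutativeRing)
  open CommutativeRing (FiniteField.commutativeRing F) using (1#) renaming (-_ to ⊖_)
  open import Data.Integer.Base using (1ℤ; -1ℤ; _*_)
  import Data.Integer.Base as ℤ
  import Data.Integer.Properties as ℤ
  open import Data.Nat.Base using (⌊_/2⌋; _∸_)
  open import Relation.Binary.PropositionalEquality using (refl; sym; trans; cong; cong₂)

  ε-even : ∀ k → ε (k ℕ.* 2) ≡ 1ℤ
  ε-even zero    = refl
  ε-even (suc k) = trans (sym (ℤ.*-assoc (χ (⊖ 1#)) (χ (⊖ 1#)) (ε (k ℕ.* 2))))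
    (trans (cong (_* ε (k ℕ.* 2)) χ[-1]²≡1) (trans (ℤ.*-identityˡ (ε (k ℕ.* 2))) (ε-even k)))

  ε≡1-if-d%4≡1 : ∀ d → d % 4 ≡ 1 → ε ⌊ d ∸ 1 /2⌋ ≡ 1ℤ
  ε≡1-if-d%4≡1 d d%4≡1 = trans (cong ε (half≡ 0 d d%4≡1)) (ε-even (d ℕ./ 4))

  ε≡1-if-q%4≡1 : ∀ m → q % 4 ≡ 1 → ε m ≡ 1ℤ
  ε≡1-if-q%4≡1 m q%4≡1 = trans (cong (ℤ._^ m) (χ[-1]≡1 q%4≡1)) (ℤ.^-zeroˡ m)

  -- Here m is odd: an even power of χ(-1) contributes 1, and the one factor left over is -1.
  ε≡-1 : ∀ d → d % 4 ≡ 3 → q % 4 ≡ 3 → ε ⌊ d ∸ 1 /2⌋ ≡ -1ℤ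
  ε≡-1 d d%4≡3 q%4≡3 = trans (cong ε (half≡ 1 d d%4≡3)) (cong₂ _*_ (χ[-1]≡-1 q%4≡3) (ε-even (d ℕ./ 4)))

-- Assembly by residues modulo 4

open import Data.Integer.Base using (+_)
open import Data.List.Base using (List; length)
open import Data.Nat.Base using (ℕ; NonZero; _*_; _^_; _∸_; ⌊_/2⌋)
open import Data.Nat.DivMod using (_%_)
open import Data.Nat.Properties using (m*n≢0; m^n≢0)
open import Data.Product.Base using (_×_; _,_)
open import Data.Rational.Base using (_/_; _+_; _-_; _≤_; _⊓_)
open import Data.Sum.Base using (_⊎_; inj₁; inj₂)
open import Level using (Level)
open import Relation.Binary.PropositionalEquality.Core using (_≡_; refl)
import Data.Nat.Base as ℕ

theorem1p4 :
  ∀ {c ℓ : Level} (q d : ℕ) .{{_ : NonZero q}} .{{_ : NonZero d}} →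
  OddPrimePower q →
  (F : FiniteField c ℓ q) →
  (A : List (Point F d)) → IsSubset F A →
  let a  = length A
      m  = ⌊ d ∸ 1 /2⌋
      m⁺ = ⌊ d ℕ.+ 1 /2⌋
      sq = + (SQ F A) / 1
      instance
        _ = m*n≢0 2 q
        _ = m^n≢0 q m
        _ = m^n≢0 q m⁺
        _ = m*n≢0 2 (q ^ m)
        _ = m*n≢0 2 (q ^ m⁺)
  in
  (d % 4 ≡ 3 × q % 4 ≡ 3 →
    (threshold q d ≤ + a / 1 →
      sq ≤ + (a ^ 2) / 2 + + (q ^ m * a) / 1 - + (a ^ 2) / (2 * q)
           - + (a ^ 2) / (2 * q ^ m) - + (a ^ 2) / (2 * q ^ m⁺))
    ×
    (+ a / 1 ≤ threshold q d →
      sq ≤ + (a ^ 2) / 2 + + (q ^ m * a) / 2 - + (a ^ 2) / (2 * q ^ m)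
           - + a / 2))
  ×
  (d % 4 ≡ 1 ⊎ (d % 4 ≡ 3 × q % 4 ≡ 1) →
    sq ≤ + (a ^ 2) / 2 - + (q ^ m * a) / 2 - + a / 2
         + (+ (q ^ m⁺ * a) / 2
            ⊓ (+ (q ^ m * a) / 2 + + (a ^ 2) / 2)
            ⊓ (+ a / 2 + + (q ^ m⁺ * a) / 2 - + (a ^ 2) / (2 * q))))
theorem1p4 q d (_ , q-odd) F A A-unique =
    (λ (d%4≡3 , q%4≡3) →
        (λ _ → part₁-large 1 d%4≡3 (ε≡-1 d d%4≡3 q%4≡3) (half⁺≡1+half 1 d d%4≡3))
      , (λ _ → part₁-small 1 d%4≡3 (ε≡-1 d d%4≡3 q%4≡3)))
  -- In the first case m is even, in the second -1 is a square; either makes `ε` equal to 1.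
  , λ { (inj₁ d%4≡1)           → part₂ 0 d%4≡1 (ε≡1-if-d%4≡1 d d%4≡1) (half⁺≡1+half 0 d d%4≡1)
      ; (inj₂ (d%4≡3 , q%4≡1)) → part₂ 1 d%4≡3 (ε≡1-if-q%4≡1 ⌊ d ∸ 1 /2⌋ q%4≡1) (half⁺≡1+half 1 d d%4≡3) }
  where
  open OddDimension
  open Signs F q-odd
  module Bounds j (d%4≡ : d % 4 ≡ ℕ.suc (j * 2)) =
    RationalBounds F q-odd d ⌊ d ∸ 1 /2⌋ (d≡1+half*2 j d d%4≡) A A-unique
  open Bounds
  instance
    _ = m^n≢0 q ⌊ d ∸ 1 /2⌋
    _ = m^n≢0 q ⌊ d ℕ.+ 1 /2⌋
    _ = m*n≢0 2 (q ^ ⌊ d ∸ 1 /2⌋)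
    _ = m*n≢0 2 (q ^ ⌊ d ℕ.+ 1 /2⌋)
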